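{- Let $n\ge1$, $d\ge1$, let $c$ be a Coxeter element of $W(A_n)=S_{n+1}$, let $T_i=A_1^{m_1^{(i)}}*A_2^{m_2^{(i)}}*\dots*A_n^{m_n^{(i)}}$, $i=1,\dots,d$, be types, and let $l,m_1,\dots,m_l,s_1,\dots,s_l$ be non-negative integers with $\operatorname{rk}T_1+\dots+\operatorname{rk}T_d+s_1+\dots+s_l=n$. Then the number of factorisations $$c=\sigma_1\sigma_2\cdots\sigma_d\,\sigma_1^{(1)}\cdots\sigma_{m_1}^{(1)}\,\sigma_1^{(2)}\cdots\sigma_{m_2}^{(2)}\cdots\sigma_1^{(l)}\cdots\sigma_{m_l}^{(l)}$$ in $W(A_n)$ such that $\sigma_i$ has type $T_i$ ($i=1,\dots,d$) and $\ell_T(\sigma_1^{(i)})+\dots+\ell_T(\sigma_{m_i}^{(i)})=s_i$ ($i=1,\dots,l$) equals $$(n+1)^{d-1}\Bigg(\prod_{i=1}^{d}\frac{1}{n-\operatorname{rk}T_i+1}\binom{n-\operatorname{rk}T_i+1}{m_1^{(i)},\dots,m_n^{(i)}}\Bigg)\binom{m_1(n+1)}{s_1}\binom{m_2(n+1)}{s_2}\cdots\binom{m_l(n+1)}{s_l}.$$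
   Context: $W(A_n)$ is the symmetric group $S_{n+1}$ with reflections the transpositions; $\ell_T(w)$ is the minimal number of transpositions whose product is $w$ (equal to $n+1$ minus the number of cycles of $w$). Coxeter elements are the $(n+1)$-cycles. The type of a permutation (as a parabolic Coxeter element) is $A_1^{m_1}*A_2^{m_2}*\dots*A_n^{m_n}$, where $m_k$ is the number of its cycles of length $k+1$; its rank is $\sum_k k\,m_k$. Multinomial coefficient: $\binom{M}{m_1,\dots,m_r}=\frac{M!}{m_1!\cdots m_r!(M-m_1-\dots-m_r)!}$. -}

module Defs where

open import Data.Nat using (ℕ; zero; suc; _+_; _*_; _∸_; _≤_; _≤ᵇ_; _!; _/_; NonZero)
open import Data.Nat.Properties using (_!≢0; m*n≢0)
open import Data.Nat.Combinatorics using (_C_)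
open import Data.Fin using (Fin; toℕ; _≟_)
open import Data.Vec using (Vec; []; _∷_; lookup; tabulate; allFin; map; foldr; sum; zipWith; toList; count)
open import Data.Vec.Relation.Unary.All using (All)
open import Data.List using (List; length) renaming ([] to []ₗ; _∷_ to _∷ₗ_; _++_ to _++ₗ_; foldr to foldrₗ; concat to concatₗ)
open import Data.List.Relation.Unary.All using () renaming (All to Allₗ)
open import Data.Product using (Σ; ∃; ∃-syntax; _×_)
open import Data.Bool using (if_then_else_)
open import Relation.Nullary using (¬_; does)
open import Relation.Binary.PropositionalEquality using (_≡_)

-- Permutations of Fin N, represented by their value vectors
-- (σ is the map i ↦ lookup σ i).

Word : ℕ → Set
Word N = Vec (Fin N) N

IsPerm : ∀ {N} → Word N → Set
IsPerm {N} σ = ∀ (i j : Fin N) → lookup σ i ≡ lookup σ j → i ≡ j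

_·_ : ∀ {N} → Word N → Word N → Word N
σ · τ = tabulate (λ i → lookup σ (lookup τ i))

idP : ∀ {N} → Word N
idP = allFin _

prod : ∀ {N} → List (Word N) → Word N
prod = foldrₗ _·_ idP

iter : ∀ {N} → Word N → ℕ → Fin N → Fin N
iter σ zero    i = i
iter σ (suc k) i = lookup σ (iter σ k i)

orbitLen : ∀ {N} → Word N → Fin N → ℕ
orbitLen {N} σ i = search 1 N
  where
  search : ℕ → ℕ → ℕ
  search k zero    = k
  search k (suc f) = if does (iter σ k i ≟ i) then k else search (suc k) f

cycleCount : ∀ {N} → Word N → (L : ℕ) → .{{NonZero L}} → ℕ
cycleCount {N} σ L = count (λ i → Data.Nat._≟_ (orbitLen σ i) L) (allFin N) / L

-- Coxeter element of W(A_n) = S_{n+1}: an (n+1)-cycle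
IsCoxeter : ∀ {n} → Word (suc n) → Set
IsCoxeter {n} c = IsPerm c × cycleCount c (suc n) ≡ 1

-- Types  A₁^{m₁} * ⋯ * Aₙ^{mₙ}  as vectors (m₁,…,mₙ); entry k (0-based)
-- counts cycles of length k+2.

CoxType : ℕ → Set
CoxType n = Vec ℕ n

rank : ∀ {n} → CoxType n → ℕ
rank {n} T = sum (zipWith _*_ (tabulate (λ (k : Fin n) → suc (toℕ k))) T)

HasType : ∀ {n} → Word (suc n) → CoxType n → Set
HasType {n} σ T = IsPerm σ × (∀ (k : Fin n) → cycleCount σ (2 + toℕ k) ≡ lookup T k)

swapP : ∀ {N} → Fin N → Fin N → Word N
swapP a b = tabulate (λ x → if does (x ≟ a) then b else (if does (x ≟ b) then a else x))

IsTransposition : ∀ {N} → Word N → Set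
IsTransposition {N} t = ∃[ a ] ∃[ b ] (¬ a ≡ b × t ≡ swapP a b)

ReflLen : ∀ {N} → Word N → ℕ → Set
ReflLen {N} σ k =
  (∃[ ts ] (Allₗ IsTransposition ts × prod ts ≡ σ × length ts ≡ k)) ×
  (∀ (ts : List (Word N)) → Allₗ IsTransposition ts → prod ts ≡ σ → k ≤ length ts)

ReflLenSum : ∀ {N m} → Vec (Word N) m → ℕ → Set
ReflLenSum {N} {m} σs s =
  Σ (Vec ℕ m) (λ ks → Data.Vec.Relation.Binary.Pointwise.Inductive.Pointwise ReflLen σs ks × sum ks ≡ s)
  where import Data.Vec.Relation.Binary.Pointwise.Inductive

concatBlocks : ∀ {N l} {ms : Vec ℕ l} → All (λ m → Vec (Word N) m) ms → List (Word N)
concatBlocks All.[] = []ₗ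
concatBlocks (b All.∷ bs) = toList b ++ₗ concatBlocks bs

BlocksOK : ∀ {N l} {ms : Vec ℕ l} → All (λ m → Vec (Word N) m) ms → Vec ℕ l → Set
BlocksOK All.[] [] = Data.Unit.⊤ where import Data.Unit
BlocksOK (b All.∷ bs) (s ∷ ss) = ReflLenSum b s × BlocksOK bs ss

MainOK : ∀ {n d} → Vec (Word (suc n)) d → Vec (CoxType n) d → Set
MainOK [] [] = Data.Unit.⊤ where import Data.Unit
MainOK (σ ∷ σs) (T ∷ Ts) = HasType σ T × MainOK σs Ts

AllPerm : ∀ {N} → List (Word N) → Set
AllPerm = Allₗ IsPerm

-- the set of factorisations; the validity proof is irrelevant, so two
-- factorisations are equal iff their tuples of permutations are equal
record Factorisation (n d l : ℕ) (c : Word (suc n)) (Ts : Vec (CoxType n) d)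
                     (ms ss : Vec ℕ l) : Set where
  constructor fact
  field
    main   : Vec (Word (suc n)) d
    blocks : All (λ m → Vec (Word (suc n)) m) ms
    .allPerm : AllPerm (toList main ++ₗ concatBlocks blocks)
    .isProd  : prod (toList main ++ₗ concatBlocks blocks) ≡ c
    .types   : MainOK main Ts
    .lengths : BlocksOK blocks ss

factProd : ∀ {r} → Vec ℕ r → ℕ
factProd ms = foldr (λ _ → ℕ) (λ m acc → m ! * acc) 1 ms

factProd≢0 : ∀ {r} (ms : Vec ℕ r) → NonZero (factProd ms)
factProd≢0 [] = _
factProd≢0 (m ∷ ms) = m*n≢0 (m !) (factProd ms) {{m !≢0}} {{factProd≢0 ms}}

multinomial : ∀ {r} → ℕ → Vec ℕ r → ℕ
multinomial M ms =
  if sum ms ≤ᵇ M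
  then (M ! / (factProd ms * (M ∸ sum ms) !))
         {{m*n≢0 (factProd ms) ((M ∸ sum ms) !) {{factProd≢0 ms}} {{(M ∸ sum ms) !≢0}}}}
  else 0

prodV : ∀ {k} → Vec ℕ k → ℕ
prodV = foldr (λ _ → ℕ) _*_ 1

{-# OPTIONS --safe #-}
-- Let N = n + 1, let cyc σ be the number of cycles of σ and W(τ) = (cyc τ - 1)! · ∏ (cycle lengths of τ).
-- Multiplying by a transposition joining two cycles multiplies ∏ by (p + q)/(p q), hence summing W(π t) over
-- all transpositions t that join two cycles of π gives N · W(π): on permutations of minimal length, W is an
-- eigenvector of multiplication by transpositions, and W = N on N-cycles. So the number of ways to turn τ
-- into an N-cycle by cyc τ - 1 transpositions is a power of N times W(τ).
-- The same is true for other classes: if μ is a cycle type with M cycles and M + cyc τ = N + 1, then the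
-- number D of σ of type μ with τ σ an N-cycle satisfies D · ∏ μ_k! = (M - 1)! · W(τ). This is proved by induction
-- on the support, as for trees with given degrees: a point fixed by τ, or else one fixed by σ, is a leaf and is
-- removed. Up to explicit constants, multiplication by the class μ of rank r therefore acts on the final
-- indicator function of N-cycles as r transpositions do. Class sums commute with the sum of all
-- transpositions, so every factor can be traded in this way for transpositions, and the number of tuples whose product
-- is any N-cycle is a product of constants; all N-cycles being conjugate, each contributes equally. The factor
-- for a block of m permutations of total length s arises from the count by number of cycles, C(N, k), by
-- Vandermonde's identity.
module Submission where

open import Defs
open import Data.Bool using (Bool; true; false; if_then_else_)
import Data.Bool.Properties as Bool
open import Data.Nat using (ℕ; zero; suc; _+_; _*_; _∸_; _^_; _≤_; _<_; z≤n; s≤s; s≤s⁻¹; _!; NonZero; >-nonZero)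
import Data.Nat as ℕ
open import Data.Nat.Properties
open import Data.Nat.DivMod using (m*[n/m]≡n; m/n*n≡m)
open import Data.Nat.Divisibility using (_∣_; _∣0; ∣-refl; ∣m⇒∣m*n; ∣n⇒∣m*n; ∣m∣n⇒∣m+n; ∣m+n∣m⇒∣n; ∣-trans; *-monoʳ-∣)
open import Data.Nat.Combinatorics using (_C_; nCk≡n!/k![n-k]!; k![n∸k]!∣n!; k>n⇒nCk≡0; nCk+nC[k+1]≡[n+1]C[k+1])
open import Data.Nat.Tactic.RingSolver using (solve-∀)
open import Data.Fin using (Fin; zero; suc; toℕ; fromℕ<)
import Data.Fin as Fin
import Data.Fin.Properties as Fin
open import Data.Vec using (Vec; []; _∷_; map; sum; zipWith; lookup; tabulate; toList)
import Data.Vec as V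
import Data.Vec.Properties as V
open import Data.List using (List; []; _∷_; _++_; upTo)
import Data.List as L
import Data.List.Properties as L
open import Data.List.Membership.Propositional using (_∈_)
open import Data.List.Membership.Propositional.Properties
  using (∈-allFin; ∈-upTo⁺; ∈-upTo⁻; ∈-cartesianProductWith⁺; ∈-cartesianProduct⁺; ∈-filter⁺; ∈-filter⁻; ∈-lookup)
open import Data.List.Relation.Unary.Any as Any using (here; there)
open import Data.List.Relation.Unary.Any.Properties using (lookup-index)
open import Data.Vec.Relation.Unary.All using (All; []; _∷_)
open import Data.Vec.Relation.Binary.Pointwise.Inductive using (Pointwise; []; _∷_)
open import Data.List.Relation.Unary.All as Allₗ using ([]; _∷_) renaming (All to Allₗ)
open import Data.List.Relation.Unary.AllPairs using ([]; _∷_)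
open import Data.List.Relation.Unary.Unique.Propositional using (Unique)
import Data.List.Relation.Unary.Unique.Propositional.Properties as Unique
open import Data.Product using (∃; ∃-syntax; _×_; _,_; proj₁; proj₂)
open import Data.Sum using (_⊎_; inj₁; inj₂)
open import Data.Unit using (⊤; tt)
open import Function using (_∘_; id; _$_)
open import Function.Bundles using (_↔_; mk↔ₛ′)
open import Relation.Nullary using (¬_; Dec; does; yes; no; contradiction; recompute)
open import Relation.Nullary.Decidable using (_×-dec_; _→-dec_; ¬?; map′)
open import Relation.Binary.Definitions using (DecidableEquality; tri<; tri≈; tri>)
open import Relation.Binary.PropositionalEquality

-- Finite sums and products

-- The trees live in a bipartite graph: its vertices are the cycles of `τ` and of `σ` inside a set
-- `X`, its edges are the points of `X`, each joining the two cycles through it. A product that is a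
-- single cycle on `X` makes the graph connected, and the balance of cycle numbers leaves one vertex
-- more than edges. The leaves of this tree are fixed points. The induction never leaves `Word N`: a
-- shrinking `X` bounds the support, and `j` counts the points outside it. Proportionality to `W`
-- holds only on the border where the total rank `q` still to be multiplied just suffices to join
-- all cycles, that is at `q + 1` cycles. With more cycles both sides vanish; with fewer, nothing is
-- claimed. So the operator identities are restricted to permutations with at least `q + 1` cycles,
-- a range that a factor of rank `r` maps into the one for `q - r`. The hypothesis on ranks places
-- `ε` on the border. The count by number of cycles is not summed over types; a double count shows
-- that it is proportional to the cycle product, and one convenient `τ` fixes the constant. Division
-- is avoided by keeping numerators and denominators on opposite sides.

variable
  A B A′ : Set

⟦_⟧ : {P : Set} → Dec P → ℕ
⟦ d ⟧ = if does d then 1 else 0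

⟦⟧-yes : {P : Set} (d : Dec P) → P → ⟦ d ⟧ ≡ 1
⟦⟧-yes (yes _) _ = refl
⟦⟧-yes (no ¬p) p = contradiction p ¬p

⟦⟧-no : {P : Set} (d : Dec P) → ¬ P → ⟦ d ⟧ ≡ 0
⟦⟧-no (yes p) ¬p = contradiction p ¬p
⟦⟧-no (no _)  _  = refl

⟦⟧-cong : {P Q : Set} (d : Dec P) (e : Dec Q) → (P → Q) → (Q → P) → ⟦ d ⟧ ≡ ⟦ e ⟧
⟦⟧-cong (yes p) e f g = sym (⟦⟧-yes e (f p))
⟦⟧-cong (no ¬p) e f g = sym (⟦⟧-no e (λ q → ¬p (g q)))

⟦⟧-× : {P Q : Set} (d : Dec P) (e : Dec Q) → ⟦ d ×-dec e ⟧ ≡ ⟦ d ⟧ * ⟦ e ⟧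
⟦⟧-× (yes _) (yes _) = refl
⟦⟧-× (yes _) (no _)  = refl
⟦⟧-× (no _)  e       = refl

⟦⟧-guard : {P : Set} (d : Dec P) {x y : ℕ} → (P → x ≡ y) → ⟦ d ⟧ * x ≡ ⟦ d ⟧ * y
⟦⟧-guard (yes p) f = cong (_+ 0) (f p)
⟦⟧-guard (no _)  f = refl

∑ : List A → (A → ℕ) → ℕ
∑ []       f = 0
∑ (x ∷ xs) f = f x + ∑ xs f

∏ : List A → (A → ℕ) → ℕ
∏ []       f = 1
∏ (x ∷ xs) f = f x * ∏ xs f

∑-cong-∈ : (xs : List A) {f g : A → ℕ} → (∀ x → x ∈ xs → f x ≡ g x) → ∑ xs f ≡ ∑ xs g
∑-cong-∈ []       h = refl
∑-cong-∈ (x ∷ xs) h = cong₂ _+_ (h x (here refl)) (∑-cong-∈ xs (λ y y∈ → h y (there y∈)))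

∑-cong : (xs : List A) {f g : A → ℕ} → (∀ x → f x ≡ g x) → ∑ xs f ≡ ∑ xs g
∑-cong xs h = ∑-cong-∈ xs (λ x _ → h x)

∑-zero : (xs : List A) {f : A → ℕ} → (∀ x → f x ≡ 0) → ∑ xs f ≡ 0
∑-zero []       h = refl
∑-zero (x ∷ xs) h = cong₂ _+_ (h x) (∑-zero xs h)

+-interchange : ∀ a b c d → (a + b) + (c + d) ≡ (a + c) + (b + d)
+-interchange = solve-∀

∑-+ : (xs : List A) (f g : A → ℕ) → ∑ xs (λ x → f x + g x) ≡ ∑ xs f + ∑ xs g
∑-+ []       f g = refl
∑-+ (x ∷ xs) f g = trans (cong (f x + g x +_) (∑-+ xs f g)) (+-interchange (f x) (g x) (∑ xs f) (∑ xs g))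

∑-*ˡ : (xs : List A) (c : ℕ) (f : A → ℕ) → ∑ xs (λ x → c * f x) ≡ c * ∑ xs f
∑-*ˡ []       c f = sym (*-zeroʳ c)
∑-*ˡ (x ∷ xs) c f = trans (cong (c * f x +_) (∑-*ˡ xs c f)) (sym (*-distribˡ-+ c (f x) (∑ xs f)))

∑-*ʳ : (xs : List A) (f : A → ℕ) (c : ℕ) → ∑ xs (λ x → f x * c) ≡ ∑ xs f * c
∑-*ʳ []       f c = refl
∑-*ʳ (x ∷ xs) f c = trans (cong (f x * c +_) (∑-*ʳ xs f c)) (sym (*-distribʳ-+ c (f x) (∑ xs f)))

∑-swap : (xs : List A) (ys : List B) (f : A → B → ℕ) →
         ∑ xs (λ x → ∑ ys (f x)) ≡ ∑ ys (λ y → ∑ xs (λ x → f x y))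
∑-swap []       ys f = sym (∑-zero ys (λ _ → refl))
∑-swap (x ∷ xs) ys f = trans (cong (∑ ys (f x) +_) (∑-swap xs ys f))
                             (sym (∑-+ ys (f x) (λ y → ∑ xs (λ x → f x y))))

∑-++ : (xs ys : List A) (f : A → ℕ) → ∑ (xs ++ ys) f ≡ ∑ xs f + ∑ ys f
∑-++ []       ys f = refl
∑-++ (x ∷ xs) ys f = trans (cong (f x +_) (∑-++ xs ys f)) (sym (+-assoc (f x) _ _))

∑-map : (g : A → B) (xs : List A) (f : B → ℕ) → ∑ (L.map g xs) f ≡ ∑ xs (f ∘ g)
∑-map g []       f = refl
∑-map g (x ∷ xs) f = cong (f (g x) +_) (∑-map g xs f)

∑-cartesianProductWith : (h : A → B → A′) (xs : List A) (ys : List B) (f : A′ → ℕ) →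
                         ∑ (L.cartesianProductWith h xs ys) f ≡ ∑ xs (λ x → ∑ ys (λ y → f (h x y)))
∑-cartesianProductWith h []       ys f = refl
∑-cartesianProductWith h (x ∷ xs) ys f =
  trans (∑-++ (L.map (h x) ys) _ f) (cong₂ _+_ (∑-map (h x) ys f) (∑-cartesianProductWith h xs ys f))

∑-const : (xs : List A) (c : ℕ) → ∑ xs (λ _ → c) ≡ L.length xs * c
∑-const []       c = refl
∑-const (x ∷ xs) c = cong (c +_) (∑-const xs c)

∑-term≤ : {xs : List A} (f : A → ℕ) {a : A} → a ∈ xs → f a ≤ ∑ xs f
∑-term≤ {xs = x ∷ xs} f (here refl) = m≤m+n (f x) _
∑-term≤ {xs = x ∷ xs} f (there a∈) = ≤-trans (∑-term≤ f a∈) (m≤n+m _ (f x))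

∑-mono : (xs : List A) {f g : A → ℕ} → (∀ x → f x ≤ g x) → ∑ xs f ≤ ∑ xs g
∑-mono []       h = z≤n
∑-mono (x ∷ xs) h = +-mono-≤ (h x) (∑-mono xs h)

∏-cong-∈ : (xs : List A) {f g : A → ℕ} → (∀ x → x ∈ xs → f x ≡ g x) → ∏ xs f ≡ ∏ xs g
∏-cong-∈ []       h = refl
∏-cong-∈ (x ∷ xs) h = cong₂ _*_ (h x (here refl)) (∏-cong-∈ xs (λ y y∈ → h y (there y∈)))

∏-cong : (xs : List A) {f g : A → ℕ} → (∀ x → f x ≡ g x) → ∏ xs f ≡ ∏ xs g
∏-cong xs h = ∏-cong-∈ xs (λ x _ → h x)

*-interchange : ∀ a b c d → (a * b) * (c * d) ≡ (a * c) * (b * d)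
*-interchange = solve-∀

∏-* : (xs : List A) (f g : A → ℕ) → ∏ xs (λ x → f x * g x) ≡ ∏ xs f * ∏ xs g
∏-* []       f g = refl
∏-* (x ∷ xs) f g = trans (cong (f x * g x *_) (∏-* xs f g)) (*-interchange (f x) (g x) (∏ xs f) (∏ xs g))

∏-one : (xs : List A) {f : A → ℕ} → (∀ x → f x ≡ 1) → ∏ xs f ≡ 1
∏-one []       h = refl
∏-one (x ∷ xs) h = cong₂ _*_ (h x) (∏-one xs h)

∏-pos : (xs : List A) {f : A → ℕ} → (∀ x → 0 < f x) → 0 < ∏ xs f
∏-pos []       h = s≤s z≤n
∏-pos (x ∷ xs) h = *-mono-≤ (h x) (∏-pos xs h)

module _ (_≟_ : DecidableEquality A) where

  ∑-δ∉ : {xs : List A} {a : A} → Allₗ (λ x → ¬ a ≡ x) xs → (f : A → ℕ) → ∑ xs (λ x → ⟦ a ≟ x ⟧ * f x) ≡ 0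
  ∑-δ∉ []                f = refl
  ∑-δ∉ {a = a} (_∷_ {x = x} a≢x all) f rewrite ⟦⟧-no (a ≟ x) a≢x = ∑-δ∉ all f

  ∑-δ : {xs : List A} {a : A} → Unique xs → a ∈ xs → (f : A → ℕ) → ∑ xs (λ x → ⟦ a ≟ x ⟧ * f x) ≡ f a
  ∑-δ {xs = x ∷ xs} (x∉ ∷ u) (here refl) f rewrite ⟦⟧-yes (x ≟ x) refl | ∑-δ∉ x∉ f =
    trans (+-identityʳ _) (+-identityʳ _)
  ∑-δ {xs = x ∷ xs} {a} (x∉ ∷ u) (there a∈) f
    rewrite ⟦⟧-no (a ≟ x) (λ { refl → Allₗ.lookup x∉ a∈ refl }) = ∑-δ u a∈ f

  ∏-δ∉ : {xs : List A} {a : A} → Allₗ (λ x → ¬ a ≡ x) xs → (f : A → ℕ) → ∏ xs (λ x → f x ^ ⟦ a ≟ x ⟧) ≡ 1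
  ∏-δ∉ []                f = refl
  ∏-δ∉ {a = a} (_∷_ {x = x} a≢x all) f rewrite ⟦⟧-no (a ≟ x) a≢x = trans (+-identityʳ _) (∏-δ∉ all f)

  ∏-δ : {xs : List A} {a : A} → Unique xs → a ∈ xs → (f : A → ℕ) → ∏ xs (λ x → f x ^ ⟦ a ≟ x ⟧) ≡ f a
  ∏-δ {xs = x ∷ xs} (x∉ ∷ u) (here refl) f rewrite ⟦⟧-yes (x ≟ x) refl | ∏-δ∉ x∉ f =
    trans (*-identityʳ _) (*-identityʳ _)
  ∏-δ {xs = x ∷ xs} {a} (x∉ ∷ u) (there a∈) f
    rewrite ⟦⟧-no (a ≟ x) (λ { refl → Allₗ.lookup x∉ a∈ refl }) = trans (+-identityʳ _) (∏-δ u a∈ f)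

-- Finite sets given by duplicate-free lists

record Finite (A : Set) : Set where
  field
    elems    : List A
    complete : ∀ a → a ∈ elems
    unique   : Unique elems
    decEq    : DecidableEquality A
open Finite public using (elems)

fin : ∀ N → Finite (Fin N)
fin N = record { elems = L.allFin N ; complete = ∈-allFin ; unique = Unique.allFin⁺ N ; decEq = Fin._≟_ }

vec : ∀ m → Finite A → Finite (Vec A m)
vec zero F = record
  { elems = [] ∷ [] ; complete = λ { [] → here refl } ; unique = [] ∷ [] ; decEq = V.≡-dec (Finite.decEq F) }
vec (suc m) F = record
  { elems    = L.cartesianProductWith _∷_ (elems F) (elems (vec m F))
  ; complete = λ { (x ∷ v) → ∈-cartesianProductWith⁺ _∷_ (Finite.complete F x) (Finite.complete (vec m F) v) }
  ; unique   = Unique.cartesianProductWith⁺ _∷_ V.∷-injective (Finite.unique F) (Finite.unique (vec m F))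
  ; decEq    = V.≡-dec (Finite.decEq F)
  }

pair : Finite A → Finite B → Finite (A × B)
pair F G = record
  { elems    = L.cartesianProduct (elems F) (elems G)
  ; complete = λ { (x , y) → ∈-cartesianProduct⁺ (Finite.complete F x) (Finite.complete G y) }
  ; unique   = Unique.cartesianProduct⁺ (Finite.unique F) (Finite.unique G)
  ; decEq    = ×.≡-dec (Finite.decEq F) (Finite.decEq G)
  }
  where import Data.Product.Properties as ×

∑-pair : (F : Finite A) (G : Finite B) (f : A × B → ℕ) →
         ∑ (elems (pair F G)) f ≡ ∑ (elems F) (λ x → ∑ (elems G) (λ y → f (x , y)))
∑-pair F G f = ∑-cartesianProductWith _,_ (elems F) (elems G) f

∑-vec : (F : Finite A) (m : ℕ) (f : Vec A (suc m) → ℕ) →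
        ∑ (elems (vec (suc m) F)) f ≡ ∑ (elems F) (λ x → ∑ (elems (vec m F)) (λ v → f (x ∷ v)))
∑-vec F m f = ∑-cartesianProductWith _∷_ (elems F) (elems (vec m F)) f

∑-δF : (F : Finite A) (a : A) (f : A → ℕ) → ∑ (elems F) (λ x → ⟦ Finite.decEq F a x ⟧ * f x) ≡ f a
∑-δF F a f = ∑-δ (Finite.decEq F) (Finite.unique F) (Finite.complete F a) f

-- The sum over all pairs `(a , b)` with `b = φ a` is taken in both orders, so `φ` and `ψ` have to
-- be mutually inverse only between `P` and `Q`.
∑-reindex : (F : Finite A) (G : Finite B) {P : A → Set} {Q : B → Set}
            (P? : ∀ a → Dec (P a)) (Q? : ∀ b → Dec (Q b)) (φ : A → B) (ψ : B → A) →
            (∀ a → P a → Q (φ a)) → (∀ b → Q b → P (ψ b)) →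
            (∀ a → P a → ψ (φ a) ≡ a) → (∀ b → Q b → φ (ψ b) ≡ b) →
            {f : A → ℕ} {g : B → ℕ} → (∀ a → P a → f a ≡ g (φ a)) →
            ∑ (elems F) (λ a → ⟦ P? a ⟧ * f a) ≡ ∑ (elems G) (λ b → ⟦ Q? b ⟧ * g b)
∑-reindex F G {P} {Q} P? Q? φ ψ PQ QP ψφ φψ {f} {g} fg = begin
  ∑ (elems F) (λ a → ⟦ P? a ⟧ * f a)
    ≡⟨ ∑-cong (elems F) (λ a → trans (⟦⟧-guard (P? a) (λ p → trans (fg a p) (sym (∑-δF G (φ a) g))))
                                     (sym (∑-*ˡ (elems G) ⟦ P? a ⟧ _))) ⟩
  ∑ (elems F) (λ a → ∑ (elems G) (λ b → ⟦ P? a ⟧ * (⟦ Finite.decEq G (φ a) b ⟧ * g b)))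
    ≡⟨ ∑-swap (elems F) (elems G) _ ⟩
  ∑ (elems G) (λ b → ∑ (elems F) (λ a → ⟦ P? a ⟧ * (⟦ Finite.decEq G (φ a) b ⟧ * g b)))
    ≡⟨ ∑-cong (elems G) (λ b → ∑-cong (elems F) (λ a → step a b)) ⟩
  ∑ (elems G) (λ b → ∑ (elems F) (λ a → ⟦ Q? b ⟧ * (⟦ Finite.decEq F (ψ b) a ⟧ * g b)))
    ≡⟨ ∑-cong (elems G) (λ b → trans (∑-*ˡ (elems F) ⟦ Q? b ⟧ _) (cong (⟦ Q? b ⟧ *_) (∑-δF F (ψ b) (λ _ → g b)))) ⟩
  ∑ (elems G) (λ b → ⟦ Q? b ⟧ * g b) ∎
  where
  open ≡-Reasoning
  step : ∀ a b → ⟦ P? a ⟧ * (⟦ Finite.decEq G (φ a) b ⟧ * g b) ≡ ⟦ Q? b ⟧ * (⟦ Finite.decEq F (ψ b) a ⟧ * g b)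
  step a b = begin
    ⟦ P? a ⟧ * (⟦ e ⟧ * g b) ≡⟨ *-assoc ⟦ P? a ⟧ ⟦ e ⟧ (g b) ⟨
    ⟦ P? a ⟧ * ⟦ e ⟧ * g b ≡⟨ cong (_* g b) (⟦⟧-× (P? a) e) ⟨
    ⟦ P? a ×-dec e ⟧ * g b ≡⟨ cong (_* g b) (⟦⟧-cong (P? a ×-dec e) (Q? b ×-dec e′)
                                 (λ { (p , refl) → PQ a p , ψφ a p }) (λ { (q , refl) → QP b q , φψ b q })) ⟩
    ⟦ Q? b ×-dec e′ ⟧ * g b ≡⟨ cong (_* g b) (⟦⟧-× (Q? b) e′) ⟩
    ⟦ Q? b ⟧ * ⟦ e′ ⟧ * g b ≡⟨ *-assoc ⟦ Q? b ⟧ ⟦ e′ ⟧ (g b) ⟩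
    ⟦ Q? b ⟧ * (⟦ e′ ⟧ * g b) ∎
    where
    e  = Finite.decEq G (φ a) b
    e′ = Finite.decEq F (ψ b) a

-- Permutations

variable
  N : ℕ

_≟ᶠ_ : DecidableEquality (Fin N)
_≟ᶠ_ = Fin._≟_

word-ext : (σ τ : Word N) → (∀ i → lookup σ i ≡ lookup τ i) → σ ≡ τ
word-ext σ τ h = trans (sym (V.tabulate∘lookup σ)) (trans (V.tabulate-cong h) (V.tabulate∘lookup τ))

-- Opaque copies, so that arguments can be inferred from products.
opaque
  infixl 7 _∙_

  _∙_ : Word N → Word N → Word N
  _∙_ = _·_

  ε : Word N
  ε = idP

  swap : Fin N → Fin N → Word N
  swap = swapP

  ∙≡· : (σ τ : Word N) → σ ∙ τ ≡ σ · τ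
  ∙≡· σ τ = refl

  ε≡idP : ε {N} ≡ idP
  ε≡idP = refl

  lookup-∙ : (σ τ : Word N) (i : Fin N) → lookup (σ ∙ τ) i ≡ lookup σ (lookup τ i)
  lookup-∙ σ τ i = V.lookup∘tabulate _ i

  lookup-id : (i : Fin N) → lookup ε i ≡ i
  lookup-id = V.lookup-allFin

∙-assoc : (ρ σ τ : Word N) → (ρ ∙ σ) ∙ τ ≡ ρ ∙ (σ ∙ τ)
∙-assoc ρ σ τ = word-ext _ _ λ i → trans (lookup-∙ (ρ ∙ σ) τ i) (trans (lookup-∙ ρ σ _)
  (sym (trans (lookup-∙ ρ (σ ∙ τ) i) (cong (lookup ρ) (lookup-∙ σ τ i)))))

∙-identityˡ : (σ : Word N) → ε ∙ σ ≡ σ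
∙-identityˡ σ = word-ext _ _ λ i → trans (lookup-∙ ε σ i) (lookup-id _)

∙-identityʳ : (σ : Word N) → σ ∙ ε ≡ σ
∙-identityʳ σ = word-ext _ _ λ i → trans (lookup-∙ σ ε i) (cong (lookup σ) (lookup-id i))

-- IsPerm unfolds to a function type, from which the permutation cannot be inferred.
record Perm (σ : Word N) : Set where
  constructor perm
  field
    injective : IsPerm σ
open Perm public

perm-id : Perm {N} ε
perm-id .injective i j eq = trans (sym (lookup-id i)) (trans eq (lookup-id j))

perm-∙ : {σ τ : Word N} → Perm σ → Perm τ → Perm (σ ∙ τ)
perm-∙ {σ = σ} {τ} pσ pτ .injective i j eq =
  injective pτ i j (injective pσ _ _ (trans (sym (lookup-∙ σ τ i)) (trans eq (lookup-∙ σ τ j))))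

opaque
  perm? : (σ : Word N) → Dec (Perm σ)
  perm? σ = map′ perm injective $ Fin.all? λ i → Fin.all? λ j → (lookup σ i ≟ᶠ lookup σ j) →-dec (i ≟ᶠ j)

-- If `j` were missed, punching it out would inject `Fin (suc n)` into `Fin n`.
perm-surjective : {σ : Word N} → Perm σ → ∀ j → ∃ λ i → lookup σ i ≡ j
perm-surjective {N = suc n} {σ} pσ j with Fin.any? (λ i → lookup σ i ≟ᶠ j)
... | yes found = found
... | no none = contradiction
  (Fin.injective⇒≤ {f = λ i → Fin.punchOut {i = j} (λ eq → none (i , sym eq))}
    (λ {x} {y} eq → injective pσ x y (Fin.punchOut-injective (λ e → none (x , sym e)) (λ e → none (y , sym e)) eq)))
  1+n≰n

opaque
  preimage : (σ : Word N) (j : Fin N) → Fin N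
  preimage σ j with Fin.any? (λ i → lookup σ i ≟ᶠ j)
  ... | yes (i , _) = i
  -- A default that makes `inv` total; `perm-surjective` excludes it for permutations.
  ... | no _        = j

  inv : Word N → Word N
  inv σ = tabulate (preimage σ)

  lookup-inverseʳ : {σ : Word N} → Perm σ → ∀ j → lookup σ (lookup (inv σ) j) ≡ j
  lookup-inverseʳ {σ = σ} pσ j rewrite V.lookup∘tabulate (preimage σ) j with Fin.any? (λ i → lookup σ i ≟ᶠ j)
  ... | yes (_ , eq) = eq
  ... | no none      = contradiction (perm-surjective pσ j) none

lookup-inverseˡ : {σ : Word N} → Perm σ → ∀ i → lookup (inv σ) (lookup σ i) ≡ i
lookup-inverseˡ pσ i = injective pσ _ _ (lookup-inverseʳ pσ _)

perm-inv : {σ : Word N} → Perm σ → Perm (inv σ)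
perm-inv {σ = σ} pσ .injective i j eq = trans (sym (lookup-inverseʳ pσ i)) (trans (cong (lookup σ) eq) (lookup-inverseʳ pσ j))

opaque
  unfolding swap

  lookup-swap-x : (x y : Fin N) → lookup (swap x y) x ≡ y
  lookup-swap-x x y rewrite V.lookup∘tabulate (λ z → if does (z ≟ᶠ x) then y else (if does (z ≟ᶠ y) then x else z)) x
    with x ≟ᶠ x
  ... | yes _  = refl
  ... | no neq = contradiction refl neq

  lookup-swap-y : (x y : Fin N) → lookup (swap x y) y ≡ x
  lookup-swap-y x y rewrite V.lookup∘tabulate (λ z → if does (z ≟ᶠ x) then y else (if does (z ≟ᶠ y) then x else z)) y
    with y ≟ᶠ x
  ... | yes eq = eq
  ... | no _ with y ≟ᶠ y
  ...   | yes _  = refl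
  ...   | no neq = contradiction refl neq

  lookup-swap-≢ : (x y : Fin N) {z : Fin N} → ¬ z ≡ x → ¬ z ≡ y → lookup (swap x y) z ≡ z
  lookup-swap-≢ x y {z} z≢x z≢y
    rewrite V.lookup∘tabulate (λ z → if does (z ≟ᶠ x) then y else (if does (z ≟ᶠ y) then x else z)) z
    with z ≟ᶠ x
  ... | yes eq = contradiction eq z≢x
  ... | no _ with z ≟ᶠ y
  ...   | yes eq = contradiction eq z≢y
  ...   | no _   = refl

lookup-swap-swap : (x y z : Fin N) → lookup (swap x y) (lookup (swap x y) z) ≡ z
lookup-swap-swap x y z with z ≟ᶠ x
... | yes refl = trans (cong (lookup (swap x y)) (lookup-swap-x x y)) (lookup-swap-y x y)
... | no z≢x with z ≟ᶠ y
...   | yes refl = trans (cong (lookup (swap x y)) (lookup-swap-y x y)) (lookup-swap-x x y)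
...   | no z≢y   = trans (cong (lookup (swap x y)) (lookup-swap-≢ x y z≢x z≢y)) (lookup-swap-≢ x y z≢x z≢y)

swap-involutive : (x y : Fin N) → swap x y ∙ swap x y ≡ ε
swap-involutive x y = word-ext _ _ λ z →
  trans (lookup-∙ (swap x y) (swap x y) z) (trans (lookup-swap-swap x y z) (sym (lookup-id z)))

∙-swap-swap : (σ : Word N) (x y : Fin N) → (σ ∙ swap x y) ∙ swap x y ≡ σ
∙-swap-swap σ x y = trans (∙-assoc σ _ _) (trans (cong (σ ∙_) (swap-involutive x y)) (∙-identityʳ σ))

swap-swap-∙ : (x y : Fin N) (σ : Word N) → swap x y ∙ (swap x y ∙ σ) ≡ σ
swap-swap-∙ x y σ = trans (sym (∙-assoc _ _ σ)) (trans (cong (_∙ σ) (swap-involutive x y)) (∙-identityˡ σ))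

perm-swap : (x y : Fin N) → Perm (swap x y)
perm-swap x y .injective i j eq =
  trans (sym (lookup-swap-swap x y i)) (trans (cong (lookup (swap x y)) eq) (lookup-swap-swap x y j))

-- Transfers the merging lemmas, which concern multiplication on the right, to multiplication on the
-- left.
swap-push : {ρ : Word N} → Perm ρ → (x y : Fin N) → ρ ∙ swap x y ≡ swap (lookup ρ x) (lookup ρ y) ∙ ρ
swap-push {ρ = ρ} pρ x y = word-ext _ _ λ z → trans (lookup-∙ ρ _ z) (trans (go z) (sym (lookup-∙ _ ρ z)))
  where
  go : ∀ z → lookup ρ (lookup (swap x y) z) ≡ lookup (swap (lookup ρ x) (lookup ρ y)) (lookup ρ z)
  go z with z ≟ᶠ x
  ... | yes refl = trans (cong (lookup ρ) (lookup-swap-x x y)) (sym (lookup-swap-x (lookup ρ x) (lookup ρ y)))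
  ... | no z≢x with z ≟ᶠ y
  ...   | yes refl = trans (cong (lookup ρ) (lookup-swap-y x y)) (sym (lookup-swap-y (lookup ρ x) (lookup ρ y)))
  ...   | no z≢y   = trans (cong (lookup ρ) (lookup-swap-≢ x y z≢x z≢y))
                           (sym (lookup-swap-≢ _ _ (λ eq → z≢x (injective pρ _ _ eq)) (λ eq → z≢y (injective pρ _ _ eq))))

words : (N : ℕ) → Finite (Word N)
words N = vec N (fin N)

*-swapˡ : ∀ a b c → a * (b * c) ≡ b * (a * c)
*-swapˡ = solve-∀

opaque
  ∑ᵖ : (Word N → ℕ) → ℕ
  ∑ᵖ {N} f = ∑ (elems (words N)) (λ σ → ⟦ perm? σ ⟧ * f σ)

  ∑ᵖ-def : (f : Word N → ℕ) → ∑ᵖ f ≡ ∑ (elems (words N)) (λ σ → ⟦ perm? σ ⟧ * f σ)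
  ∑ᵖ-def f = refl

  ∑ᵖ-cong : {f g : Word N → ℕ} → (∀ σ → Perm σ → f σ ≡ g σ) → ∑ᵖ f ≡ ∑ᵖ g
  ∑ᵖ-cong {N} h = ∑-cong (elems (words N)) (λ σ → ⟦⟧-guard (perm? σ) (h σ))

  ∑ᵖ-zero : {f : Word N → ℕ} → (∀ σ → Perm σ → f σ ≡ 0) → ∑ᵖ f ≡ 0
  ∑ᵖ-zero {N} h = ∑-zero (elems (words N)) (λ σ → trans (⟦⟧-guard (perm? σ) (h σ)) (*-zeroʳ ⟦ perm? σ ⟧))

  ∑ᵖ-*ˡ : (c : ℕ) (f : Word N → ℕ) → ∑ᵖ (λ σ → c * f σ) ≡ c * ∑ᵖ f
  ∑ᵖ-*ˡ {N} c f = trans (∑-cong (elems (words N)) (λ σ → *-swapˡ ⟦ perm? σ ⟧ c (f σ))) (∑-*ˡ (elems (words N)) c _)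

  ∑ᵖ-*ʳ : (f : Word N → ℕ) (c : ℕ) → ∑ᵖ (λ σ → f σ * c) ≡ ∑ᵖ f * c
  ∑ᵖ-*ʳ {N} f c =
    trans (∑-cong (elems (words N)) (λ σ → sym (*-assoc ⟦ perm? σ ⟧ (f σ) c))) (∑-*ʳ (elems (words N)) _ c)

  ∑ᵖ-∑ : (xs : List A) (f : Word N → A → ℕ) → ∑ᵖ (λ σ → ∑ xs (f σ)) ≡ ∑ xs (λ x → ∑ᵖ (λ σ → f σ x))
  ∑ᵖ-∑ {N = N} xs f =
    trans (∑-cong (elems (words N)) (λ σ → sym (∑-*ˡ xs ⟦ perm? σ ⟧ (f σ)))) (∑-swap (elems (words N)) xs _)

  ∑ᵖ-∑ᵖ : (f : Word N → Word N → ℕ) → ∑ᵖ (λ σ → ∑ᵖ (f σ)) ≡ ∑ᵖ (λ τ → ∑ᵖ (λ σ → f σ τ))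
  ∑ᵖ-∑ᵖ {N} f = trans (∑ᵖ-∑ {N = N} (elems (words N)) (λ σ τ → ⟦ perm? τ ⟧ * f σ τ))
    (∑-cong (elems (words N)) (λ τ → ∑ᵖ-*ˡ {N} ⟦ perm? τ ⟧ (λ σ → f σ τ)))

  ∑ᵖ-reindex : (φ ψ : Word N → Word N) →
               (∀ {σ} → Perm σ → Perm (φ σ)) → (∀ {σ} → Perm σ → Perm (ψ σ)) →
               (∀ {σ} → Perm σ → ψ (φ σ) ≡ σ) → (∀ {σ} → Perm σ → φ (ψ σ) ≡ σ) →
               (f : Word N → ℕ) → ∑ᵖ (λ σ → f (φ σ)) ≡ ∑ᵖ f
  ∑ᵖ-reindex {N} φ ψ pφ pψ ψφ φψ f =
    ∑-reindex (words N) (words N) perm? perm? φ ψ (λ _ → pφ) (λ _ → pψ) (λ _ → ψφ) (λ _ → φψ) (λ _ _ → refl)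

  ∑ᵖ-δ : {τ : Word N} → Perm τ → (f : Word N → ℕ) → ∑ᵖ (λ σ → ⟦ Finite.decEq (words N) τ σ ⟧ * f σ) ≡ f τ
  ∑ᵖ-δ {N} {τ} pτ f = trans (∑-cong (elems (words N)) (λ σ → *-swapˡ ⟦ perm? σ ⟧ ⟦ Finite.decEq (words N) τ σ ⟧ (f σ)))
    (trans (∑-δF (words N) τ _) (trans (cong (_* f τ) (⟦⟧-yes (perm? τ) pτ)) (+-identityʳ _)))

-- Conjugation

conj : Word N → Word N → Word N
conj γ σ = γ ∙ (σ ∙ inv γ)

conj-∙ : {γ : Word N} → Perm γ → (σ τ : Word N) → conj γ (σ ∙ τ) ≡ conj γ σ ∙ conj γ τ
conj-∙ {γ = γ} pγ σ τ = word-ext _ _ λ i → begin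
  lookup (conj γ (σ ∙ τ)) i
    ≡⟨ trans (lookup-∙ γ _ i) (cong (lookup γ) (trans (lookup-∙ (σ ∙ τ) _ i) (lookup-∙ σ τ _))) ⟩
  lookup γ (lookup σ (lookup τ (lookup (inv γ) i)))
    ≡⟨ cong (λ z → lookup γ (lookup σ z)) (lookup-inverseˡ pγ _) ⟨
  lookup γ (lookup σ (lookup (inv γ) (lookup γ (lookup τ (lookup (inv γ) i)))))
    ≡⟨ cong (λ z → lookup γ (lookup σ (lookup (inv γ) z)))
         (trans (lookup-∙ γ _ i) (cong (lookup γ) (lookup-∙ τ _ i))) ⟨
  lookup γ (lookup σ (lookup (inv γ) (lookup (conj γ τ) i)))
    ≡⟨ trans (lookup-∙ γ _ _) (cong (lookup γ) (lookup-∙ σ _ _)) ⟨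
  lookup (conj γ σ) (lookup (conj γ τ) i)
    ≡⟨ lookup-∙ (conj γ σ) (conj γ τ) i ⟨
  lookup (conj γ σ ∙ conj γ τ) i ∎
  where open ≡-Reasoning

lookup-conj : {γ : Word N} → Perm γ → (σ : Word N) (i : Fin N) →
              lookup (conj γ σ) (lookup γ i) ≡ lookup γ (lookup σ i)
lookup-conj {γ = γ} pγ σ i = trans (lookup-∙ γ _ _) (cong (lookup γ)
  (trans (lookup-∙ σ _ _) (cong (lookup σ) (lookup-inverseˡ pγ i))))

perm-conj : {γ σ : Word N} → Perm γ → Perm σ → Perm (conj γ σ)
perm-conj pγ pσ = perm-∙ pγ (perm-∙ pσ (perm-inv pγ))

-- The points `lookup γ i` exhaust `Fin N`, so the intertwining relation determines `τ`.
conj-unique : {γ : Word N} → Perm γ → (σ τ : Word N) →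
              (∀ i → lookup τ (lookup γ i) ≡ lookup γ (lookup σ i)) → conj γ σ ≡ τ
conj-unique {γ = γ} pγ σ τ h = word-ext _ _ go
  where
  go : ∀ j → lookup (conj γ σ) j ≡ lookup τ j
  go j with i , refl ← perm-surjective {σ = γ} pγ j = trans (lookup-conj pγ σ i) (sym (h i))

conj-inverse : {γ : Word N} → Perm γ → (σ : Word N) → conj (inv γ) (conj γ σ) ≡ σ
conj-inverse {γ = γ} pγ σ = conj-unique (perm-inv pγ) (conj γ σ) σ go
  where
  go : ∀ j → lookup σ (lookup (inv γ) j) ≡ lookup (inv γ) (lookup (conj γ σ) j)
  go j with i , refl ← perm-surjective {σ = γ} pγ j = begin
    lookup σ (lookup (inv γ) (lookup γ i)) ≡⟨ cong (lookup σ) (lookup-inverseˡ pγ i) ⟩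
    lookup σ i ≡⟨ lookup-inverseˡ pγ _ ⟨
    lookup (inv γ) (lookup γ (lookup σ i)) ≡⟨ cong (lookup (inv γ)) (lookup-conj pγ σ i) ⟨
    lookup (inv γ) (lookup (conj γ σ) (lookup γ i)) ∎
    where open ≡-Reasoning

conj-inverse′ : {γ : Word N} → Perm γ → (σ : Word N) → conj γ (conj (inv γ) σ) ≡ σ
conj-inverse′ {γ = γ} pγ σ = conj-unique pγ (conj (inv γ) σ) σ go
  where
  go : ∀ i → lookup σ (lookup γ i) ≡ lookup γ (lookup (conj (inv γ) σ) i)
  go i = begin
    lookup σ (lookup γ i) ≡⟨ lookup-inverseʳ pγ _ ⟨
    lookup γ (lookup (inv γ) (lookup σ (lookup γ i))) ≡⟨ cong (lookup γ) (lookup-conj (perm-inv pγ) σ (lookup γ i)) ⟨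
    lookup γ (lookup (conj (inv γ) σ) (lookup (inv γ) (lookup γ i)))
      ≡⟨ cong (λ z → lookup γ (lookup (conj (inv γ) σ) z)) (lookup-inverseˡ pγ i) ⟩
    lookup γ (lookup (conj (inv γ) σ) i) ∎
    where open ≡-Reasoning

∑ᵖ-conj : {γ : Word N} → Perm γ → (f : Word N → ℕ) → ∑ᵖ (λ σ → f (conj γ σ)) ≡ ∑ᵖ f
∑ᵖ-conj {γ = γ} pγ f = ∑ᵖ-reindex (conj γ) (conj (inv γ)) (perm-conj pγ) (perm-conj (perm-inv pγ))
  (λ {σ} _ → conj-inverse pγ σ) (λ {σ} _ → conj-inverse′ pγ σ) f

-- Orbits

-- The local function of orbitLen has no name outside its definition: it is recovered by unification
-- from a goal in which the fuel no longer occurs in the types.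
mutual
  search : Word N → Fin N → ℕ → ℕ → ℕ
  search = _

  orbitLen-search : ∀ m (σ : Word (suc m)) i →
                    orbitLen σ i ≡ (if does (iter σ 1 i ≟ᶠ i) then 1 else search σ i 2 m)
  orbitLen-search m σ i with suc m | σ | i | 2
  ... | _ | _ | _ | _ = refl

record IsPeriod (σ : Word N) (i : Fin N) (p : ℕ) : Set where
  field
    positive : 0 < p
    returns  : iter σ p i ≡ i
    minimal  : ∀ {j} → 0 < j → j < p → ¬ iter σ j i ≡ i

-- Invariant of the search: no return before `k`, and some return `j` before the fuel runs out. The
-- answer given on empty fuel is therefore never reached.
search-period : (σ : Word N) (i : Fin N) (k f : ℕ) → 0 < k →
                (∀ {j} → 0 < j → j < k → ¬ iter σ j i ≡ i) →
                ∀ {j} → k ≤ j → j < k + f → iter σ j i ≡ i → IsPeriod σ i (search σ i k f)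
search-period σ i k zero k>0 min k≤j j<k eq = contradiction (subst (_ <_) (+-identityʳ k) j<k) (≤⇒≯ k≤j)
search-period σ i k (suc f) k>0 min {j} k≤j j<k+f eq with iter σ k i ≟ᶠ i
... | yes ret = record { positive = k>0 ; returns = ret ; minimal = min }
... | no ¬ret = search-period σ i (suc k) f (s≤s z≤n) min′
                  (≤∧≢⇒< k≤j (λ { refl → ¬ret eq })) (subst (j <_) (+-suc k f) j<k+f) eq
  where
  min′ : ∀ {j} → 0 < j → j < suc k → ¬ iter σ j i ≡ i
  min′ {j} j>0 j<1+k eq with j ℕ.≟ k
  ... | yes refl = ¬ret eq
  ... | no j≢k   = min j>0 (≤∧≢⇒< (s≤s⁻¹ j<1+k) j≢k) eq

iter-+ : (σ : Word N) (m k : ℕ) (i : Fin N) → iter σ (m + k) i ≡ iter σ m (iter σ k i)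
iter-+ σ zero    k i = refl
iter-+ σ (suc m) k i = cong (lookup σ) (iter-+ σ m k i)

iter-injective : {σ : Word N} → Perm σ → (k : ℕ) {i j : Fin N} → iter σ k i ≡ iter σ k j → i ≡ j
iter-injective pσ zero    eq = eq
iter-injective pσ (suc k) eq = iter-injective pσ k (injective pσ _ _ eq)

iter-cancel : {σ : Word N} → Perm σ → {a b : ℕ} → a < b → {i : Fin N} → iter σ a i ≡ iter σ b i → iter σ (b ∸ a) i ≡ i
iter-cancel {σ = σ} pσ {a} {b} a<b {i} eq = iter-injective {σ = σ} pσ a
  (trans (sym (iter-+ σ a (b ∸ a) i)) (trans (cong (λ m → iter σ m i) (m+[n∸m]≡n (<⇒≤ a<b))) (sym eq)))

-- Two of the iterates with exponents `0` to `N` coincide, and the difference of the exponents is a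
-- return time. Being at most `N`, it lies within the fuel of `orbitLen`.
some-return : {σ : Word N} → Perm σ → (i : Fin N) → ∃[ j ] (1 ≤ j × j < 1 + N × iter σ j i ≡ i)
some-return {N} {σ} pσ i
  with a , b , a<b , eq ← Fin.pigeonhole (n<1+n N) (λ a → iter σ (toℕ a) i) =
  toℕ b ∸ toℕ a , m<n⇒0<n∸m a<b , ≤-trans (s≤s (m∸n≤m (toℕ b) (toℕ a))) (Fin.toℕ<n b) , iter-cancel {σ = σ} pσ a<b eq

opaque
  len : Word N → Fin N → ℕ
  len = orbitLen

  len-def : (σ : Word N) (i : Fin N) → len σ i ≡ orbitLen σ i
  len-def σ i = refl

  len-period : {σ : Word N} → Perm σ → (i : Fin N) → IsPeriod σ i (len σ i)
  len-period {N} {σ} pσ i with j , 1≤j , j<1+N , eq ← some-return {σ = σ} pσ i =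
    search-period σ i 1 N ≤-refl (λ j>0 j<1 → contradiction j>0 (<⇒≱ j<1)) 1≤j j<1+N eq

record Reach (σ : Word N) (i j : Fin N) : Set where
  constructor reach
  field
    steps   : ℕ
    arrives : iter σ steps i ≡ j
open Reach

reach-refl : {σ : Word N} {i : Fin N} → Reach σ i i
reach-refl = reach 0 refl

reach-step : {σ : Word N} {i : Fin N} → Reach σ i (lookup σ i)
reach-step = reach 1 refl

reach-trans : {σ : Word N} {i j k : Fin N} → Reach σ i j → Reach σ j k → Reach σ i k
reach-trans {σ = σ} {i} (reach m refl) (reach n eq) = reach (n + m) (trans (iter-+ σ n m i) eq)

-- Exponents wrap around to `0` at the period; the recursion replaces a division with remainder.
reach-short : {σ : Word N} → Perm σ → {i j : Fin N} → Reach σ i j → ∃[ k ] (k < len σ i × iter σ k i ≡ j)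
reach-short {σ = σ} pσ {i} (reach k refl) = go k
  where
  open IsPeriod (len-period pσ i)
  go : ∀ k → ∃[ k′ ] (k′ < len σ i × iter σ k′ i ≡ iter σ k i)
  go zero = 0 , positive , refl
  go (suc k) with k′ , k′<p , eq ← go k with suc k′ ℕ.≟ len σ i
  ... | yes last = 0 , positive , trans (sym returns) (trans (cong (λ m → iter σ m i) (sym last)) (cong (lookup σ) eq))
  ... | no ¬last = suc k′ , ≤∧≢⇒< k′<p ¬last , cong (lookup σ) eq

reach-sym : {σ : Word N} → Perm σ → {i j : Fin N} → Reach σ i j → Reach σ j i
reach-sym {σ = σ} pσ {i} r with k , k<p , refl ← reach-short pσ r = reach (len σ i ∸ k)
  (trans (sym (iter-+ σ (len σ i ∸ k) k i))
         (trans (cong (λ m → iter σ m i) (m∸n+n≡m (<⇒≤ k<p))) (IsPeriod.returns (len-period pσ i))))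

-- Every point of the orbit, `i` included, is reached by a path whose first step leaves `i`. In
-- `cross` it is exactly this step that the transposition redirects.
reach-suc : {σ : Word N} → Perm σ → {i j : Fin N} → Reach σ i j → ∃[ k ] iter σ k (lookup σ i) ≡ j
reach-suc {σ = σ} pσ {i} {j} r with reach-trans (reach-sym pσ (reach-step {σ = σ} {i})) r
... | reach k eq = k , eq

reach-short-unique : {σ : Word N} → Perm σ → {i : Fin N} {a b : ℕ} → a < len σ i → b < len σ i →
                     iter σ a i ≡ iter σ b i → a ≡ b
reach-short-unique {σ = σ} pσ {i} {a} {b} a<p b<p eq with <-cmp a b
... | tri≈ _ a≡b _ = a≡b
... | tri< a<b _ _ = contradiction (iter-cancel {σ = σ} pσ a<b eq)
                       (IsPeriod.minimal (len-period pσ i) (m<n⇒0<n∸m a<b) (≤-<-trans (m∸n≤m b a) b<p))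
... | tri> _ _ b<a = contradiction (iter-cancel {σ = σ} pσ b<a (sym eq))
                       (IsPeriod.minimal (len-period pσ i) (m<n⇒0<n∸m b<a) (≤-<-trans (m∸n≤m a b) a<p))

∑ᶠ : (Fin N → ℕ) → ℕ
∑ᶠ {N} = ∑ (L.allFin N)

opaque
  reach? : {σ : Word N} → Perm σ → (i j : Fin N) → Dec (Reach σ i j)
  reach? {σ = σ} pσ i j = map′ (λ (k , _ , eq) → reach k eq) (reach-short pσ)
    (anyUpTo? (λ k → iter σ k i ≟ᶠ j) (len σ i))

-- The iterates below the period hit each reachable point exactly once. Lengths can thus be compared
-- through the reachability relations alone.
len-∑ : {σ : Word N} (pσ : Perm σ) (i : Fin N) → ∑ᶠ (λ j → ⟦ reach? pσ i j ⟧) ≡ len σ i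
len-∑ {N} {σ} pσ i = begin
  ∑ᶠ (λ j → ⟦ reach? pσ i j ⟧) ≡⟨ ∑-cong (L.allFin N) each ⟩
  ∑ᶠ (λ j → ∑ (upTo (len σ i)) (λ k → ⟦ iter σ k i ≟ᶠ j ⟧ * 1)) ≡⟨ ∑-swap (L.allFin N) (upTo (len σ i)) _ ⟩
  ∑ (upTo (len σ i)) (λ k → ∑ᶠ (λ j → ⟦ iter σ k i ≟ᶠ j ⟧ * 1)) ≡⟨ ∑-cong (upTo (len σ i)) (λ k → ∑-δF (fin N) (iter σ k i) (λ _ → 1)) ⟩
  ∑ (upTo (len σ i)) (λ _ → 1) ≡⟨ ∑-const (upTo (len σ i)) 1 ⟩
  L.length (upTo (len σ i)) * 1 ≡⟨ trans (*-identityʳ _) (L.length-upTo (len σ i)) ⟩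
  len σ i ∎
  where
  open ≡-Reasoning
  each : ∀ j → ⟦ reach? pσ i j ⟧ ≡ ∑ (upTo (len σ i)) (λ k → ⟦ iter σ k i ≟ᶠ j ⟧ * 1)
  each j with reach? pσ i j
  ... | no ¬r = sym (∑-zero (upTo (len σ i)) (λ k → cong (_* 1) (⟦⟧-no (iter σ k i ≟ᶠ j) (λ eq → ¬r (reach k eq)))))
  ... | yes r with k′ , k′<p , refl ← reach-short pσ r = sym (trans
    (∑-cong-∈ (upTo (len σ i)) (λ k k∈ → cong (_* 1) (⟦⟧-cong (iter σ k i ≟ᶠ iter σ k′ i) (k′ ℕ.≟ k)
      (λ eq → reach-short-unique pσ k′<p (∈-upTo⁻ k∈) (sym eq)) (λ { refl → refl }))))
    (∑-δ ℕ._≟_ (Unique.upTo⁺ (len σ i)) (∈-upTo⁺ k′<p) (λ _ → 1)))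

len-cong : {σ τ : Word N} → Perm σ → Perm τ → {i : Fin N} →
           (∀ j → Reach σ i j → Reach τ i j) → (∀ j → Reach τ i j → Reach σ i j) → len σ i ≡ len τ i
len-cong {N} pσ pτ {i} f g = trans (sym (len-∑ pσ i)) (trans
  (∑-cong (L.allFin N) (λ j → ⟦⟧-cong (reach? pσ i j) (reach? pτ i j) (f j) (g j))) (len-∑ pτ i))

len-reach : {σ : Word N} → Perm σ → {i j : Fin N} → Reach σ i j → len σ i ≡ len σ j
len-reach {N} pσ {i} {j} r = trans (sym (len-∑ pσ i)) (trans
  (∑-cong (L.allFin N) (λ k → ⟦⟧-cong (reach? pσ i k) (reach? pσ j k) (reach-trans (reach-sym pσ r)) (reach-trans r)))
  (len-∑ pσ j))

len-positive : {σ : Word N} → Perm σ → (i : Fin N) → 0 < len σ i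
len-positive pσ i = IsPeriod.positive (len-period pσ i)

len≤N : {σ : Word N} → Perm σ → (i : Fin N) → len σ i ≤ N
len≤N {N} pσ i = subst₂ _≤_ (len-∑ pσ i) (trans (∑-const (L.allFin N) 1) (trans (*-identityʳ _) (L.length-tabulate {n = N} id)))
  (∑-mono (L.allFin N) (λ j → ⟦⟧≤1 (reach? pσ i j)))
  where
  ⟦⟧≤1 : {P : Set} (d : Dec P) → ⟦ d ⟧ ≤ 1
  ⟦⟧≤1 (yes _) = ≤-refl
  ⟦⟧≤1 (no _)  = z≤n

iter-fixed : {σ : Word N} {i : Fin N} → lookup σ i ≡ i → ∀ k → iter σ k i ≡ i
iter-fixed {σ = σ} fix zero    = refl
iter-fixed {σ = σ} fix (suc k) = trans (cong (lookup σ) (iter-fixed {σ = σ} fix k)) fix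

len-fixed : {σ : Word N} → Perm σ → {i : Fin N} → lookup σ i ≡ i → len σ i ≡ 1
len-fixed {σ = σ} pσ {i} fix with len σ i in eq | len-positive pσ i
... | suc zero    | _ = refl
... | suc (suc p) | _ = contradiction fix (IsPeriod.minimal (len-period pσ i) ≤-refl
                          (subst (1 <_) (sym eq) (s≤s (s≤s z≤n))))

fixed-len : {σ : Word N} → Perm σ → {i : Fin N} → len σ i ≡ 1 → lookup σ i ≡ i
fixed-len {σ = σ} pσ {i} eq = subst (λ p → iter σ p i ≡ i) eq (IsPeriod.returns (len-period pσ i))

-- Orbits after multiplication by a transposition

module _ {σ : Word N} (pσ : Perm σ) {x y : Fin N} where

  private
    σ′ : Word N
    σ′ = σ ∙ swap x y

    pσ′ : Perm σ′
    pσ′ = perm-∙ pσ (perm-swap x y)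

    at-x : lookup σ′ x ≡ lookup σ y
    at-x = trans (lookup-∙ σ _ x) (cong (lookup σ) (lookup-swap-x x y))

    at-y : lookup σ′ y ≡ lookup σ x
    at-y = trans (lookup-∙ σ _ y) (cong (lookup σ) (lookup-swap-y x y))

    at-≢ : ∀ {z} → ¬ z ≡ x → ¬ z ≡ y → lookup σ′ z ≡ lookup σ z
    at-≢ z≢x z≢y = trans (lookup-∙ σ _ _) (cong (lookup σ) (lookup-swap-≢ x y z≢x z≢y))

  Joined : Fin N → Set
  Joined i = Reach σ x i ⊎ Reach σ y i

  joined-trans : ∀ {i j} → Joined i → Reach σ i j → Joined j
  joined-trans (inj₁ r) s = inj₁ (reach-trans r s)
  joined-trans (inj₂ r) s = inj₂ (reach-trans r s)

  -- The two permutations differ only in the steps out of `x` and `y`, and these stay in the union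
  -- of the two orbits. The orbits may be equal, so the lemma serves merging and splitting alike.
  reach-swap : ∀ {i j} → Reach (σ ∙ swap x y) i j → Reach σ i j ⊎ (Joined i × Joined j)
  reach-swap {i} (reach k refl) = go k
    where
    step : ∀ z → Reach σ z (lookup σ′ z) ⊎ (Joined z × Joined (lookup σ′ z))
    step z with z ≟ᶠ x
    ... | yes refl = inj₂ (inj₁ reach-refl , inj₂ (reach 1 (sym at-x)))
    ... | no z≢x with z ≟ᶠ y
    ...   | yes refl = inj₂ (inj₂ reach-refl , inj₁ (reach 1 (sym at-y)))
    ...   | no z≢y   = inj₁ (reach 1 (sym (at-≢ z≢x z≢y)))
    go : ∀ k → Reach σ i (iter σ′ k i) ⊎ (Joined i × Joined (iter σ′ k i))
    go zero = inj₁ reach-refl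
    go (suc k) with go k | step (iter σ′ k i)
    ... | inj₁ r       | inj₁ s        = inj₁ (reach-trans r s)
    ... | inj₁ r       | inj₂ (j , j′) = inj₂ (joined-trans j (reach-sym pσ r) , j′)
    ... | inj₂ (j , h) | inj₁ s        = inj₂ (j , joined-trans h s)
    ... | inj₂ (j , _) | inj₂ (_ , j′) = inj₂ (j , j′)

  module _ (x≁y : ¬ Reach σ x y) where

    private
      cross : ∀ {j} → Reach σ x j → Reach (σ ∙ swap x y) y j
      cross r with k , refl ← reach-suc pσ r = go k
        where
        go : ∀ k → Reach (σ ∙ swap x y) y (iter σ k (lookup σ x))
        go zero = reach 1 at-y
        go (suc k) with iter σ k (lookup σ x) ≟ᶠ x
        -- The `σ`-path is back at `x`; its next point is `lookup σ x`, which `y` reaches in one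
        -- step, so the path restarts.
        ... | yes eq = reach 1 (trans at-y (cong (lookup σ) (sym eq)))
        ... | no z≢x = reach-trans (go k) (reach 1 (at-≢ z≢x λ eq → x≁y (reach-trans reach-step (reach k eq))))

      cross′ : ∀ {j} → Reach σ y j → Reach (σ ∙ swap x y) x j
      cross′ r with k , refl ← reach-suc pσ r = go k
        where
        go : ∀ k → Reach (σ ∙ swap x y) x (iter σ k (lookup σ y))
        go zero = reach 1 at-x
        go (suc k) with iter σ k (lookup σ y) ≟ᶠ y
        ... | yes eq = reach 1 (trans at-x (cong (lookup σ) (sym eq)))
        ... | no z≢y = reach-trans (go k) (reach 1 (at-≢ (λ eq → x≁y (reach-sym pσ (reach-trans reach-step (reach k eq)))) z≢y))

      from-x : ∀ {i} → Joined i → Reach (σ ∙ swap x y) x i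
      from-x (inj₁ r) = reach-trans (cross′ reach-refl) (cross r)
      from-x (inj₂ r) = cross′ r

    reach-merged : ∀ {i j} → Joined i → Joined j → Reach (σ ∙ swap x y) i j
    reach-merged u v = reach-trans (reach-sym pσ′ (from-x u)) (from-x v)

    reach-unmerged : ∀ {i j} → Reach σ i j → Reach (σ ∙ swap x y) i j
    reach-unmerged {i} {j} r with reach? pσ x i | reach? pσ y i
    ... | yes u | _     = reach-merged (inj₁ u) (inj₁ (reach-trans u r))
    ... | no _  | yes u = reach-merged (inj₂ u) (inj₂ (reach-trans u r))
    ... | no ¬u | no ¬v with reach k refl ← r = go k
      where
      go : ∀ k → Reach (σ ∙ swap x y) i (iter σ k i)
      go zero = reach-refl
      go (suc k) = reach-trans (go k) (reach 1 (at-≢ (λ eq → ¬u (reach-sym pσ (reach k eq)))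
                                                     (λ eq → ¬v (reach-sym pσ (reach k eq)))))

    len-merged : ∀ {i} → Joined i → len (σ ∙ swap x y) i ≡ len σ x + len σ y
    len-merged {i} u = begin
      len σ′ i ≡⟨ len-∑ pσ′ i ⟨
      ∑ᶠ (λ j → ⟦ reach? pσ′ i j ⟧) ≡⟨ ∑-cong (L.allFin N) each ⟩
      ∑ᶠ (λ j → ⟦ reach? pσ x j ⟧ + ⟦ reach? pσ y j ⟧) ≡⟨ ∑-+ (L.allFin N) _ _ ⟩
      ∑ᶠ (λ j → ⟦ reach? pσ x j ⟧) + ∑ᶠ (λ j → ⟦ reach? pσ y j ⟧) ≡⟨ cong₂ _+_ (len-∑ pσ x) (len-∑ pσ y) ⟩
      len σ x + len σ y ∎
      where
      open ≡-Reasoning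
      each : ∀ j → ⟦ reach? pσ′ i j ⟧ ≡ ⟦ reach? pσ x j ⟧ + ⟦ reach? pσ y j ⟧
      each j with reach? pσ x j | reach? pσ y j
      ... | yes r | yes s = contradiction (reach-trans r (reach-sym pσ s)) x≁y
      ... | yes r | no _  = ⟦⟧-yes (reach? pσ′ i j) (reach-merged u (inj₁ r))
      ... | no _  | yes s = ⟦⟧-yes (reach? pσ′ i j) (reach-merged u (inj₂ s))
      ... | no ¬r | no ¬s = ⟦⟧-no (reach? pσ′ i j) λ r → absurd (reach-swap r)
        where
        absurd : ¬ (Reach σ i j ⊎ (Joined i × Joined j))
        absurd (inj₁ r) with joined-trans u r
        ... | inj₁ s = ¬r s
        ... | inj₂ s = ¬s s
        absurd (inj₂ (_ , inj₁ s)) = ¬r s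
        absurd (inj₂ (_ , inj₂ s)) = ¬s s

    len-unmerged : ∀ {i} → ¬ Joined i → len (σ ∙ swap x y) i ≡ len σ i
    len-unmerged {i} ¬u = len-cong pσ′ pσ (λ j r → ok (reach-swap r)) (λ j r → reach-unmerged r)
      where
      ok : ∀ {j} → Reach σ i j ⊎ (Joined i × Joined j) → Reach σ i j
      ok (inj₁ r)       = r
      ok (inj₂ (u , _)) = contradiction u ¬u

  reach-swap-within : Reach σ x y → ∀ {i j} → Reach (σ ∙ swap x y) i j → Reach σ i j
  reach-swap-within x~y r with reach-swap r
  ... | inj₁ s       = s
  ... | inj₂ (u , v) = reach-trans (reach-sym pσ (from u)) (from v)
    where
    from : ∀ {i} → Joined i → Reach σ x i
    from (inj₁ s) = s
    from (inj₂ s) = reach-trans x~y s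

-- Cycle types

∑ᶠ-perm : {γ : Word N} → Perm γ → (f : Fin N → ℕ) → ∑ᶠ (λ i → f (lookup γ i)) ≡ ∑ᶠ f
∑ᶠ-perm {N} {γ} pγ f = begin
  ∑ᶠ (λ i → f (lookup γ i)) ≡⟨ ∑-cong (L.allFin N) (λ i → sym (+-identityʳ _)) ⟩
  ∑ᶠ (λ i → ⟦ true? i ⟧ * f (lookup γ i)) ≡⟨ ∑-reindex (fin N) (fin N) true? true? (lookup γ) (lookup (inv γ))
                                                    _ _ (λ i _ → lookup-inverseˡ pγ i) (λ i _ → lookup-inverseʳ pγ i)
                                                    {g = f} (λ _ _ → refl) ⟩
  ∑ᶠ (λ i → ⟦ true? i ⟧ * f i) ≡⟨ ∑-cong (L.allFin N) (λ i → +-identityʳ _) ⟩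
  ∑ᶠ f ∎
  where
  open ≡-Reasoning
  true? : Fin N → Dec ⊤
  true? _ = yes tt

∑ᶠ-const : (c : ℕ) → ∑ᶠ {N} (λ _ → c) ≡ N * c
∑ᶠ-const {N} c = trans (∑-const (L.allFin N) c) (cong (_* c) (L.length-tabulate {n = N} id))

-- Cycle lengths 1, …, N are indexed from 0.
∑-δ⁺ : {p : ℕ} → 0 < p → p ≤ N → (f : ℕ → ℕ) → ∑ (upTo N) (λ k → ⟦ p ℕ.≟ suc k ⟧ * f (suc k)) ≡ f p
∑-δ⁺ {N} {suc q} _ q<N f = trans
  (∑-cong (upTo N) (λ k → cong (_* f (suc k)) (⟦⟧-cong (suc q ℕ.≟ suc k) (q ℕ.≟ k) suc-injective (cong suc))))
  (∑-δ ℕ._≟_ (Unique.upTo⁺ N) (∈-upTo⁺ q<N) (λ k → f (suc k)))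

∑-δ⁺1 : {p : ℕ} → 0 < p → p ≤ N → ∑ (upTo N) (λ k → ⟦ p ℕ.≟ suc k ⟧) ≡ 1
∑-δ⁺1 {N} p>0 p≤N = trans (∑-cong (upTo N) (λ k → sym (*-identityʳ _))) (∑-δ⁺ p>0 p≤N (λ _ → 1))

∏-δ⁺ : {p : ℕ} → 0 < p → p ≤ N → (f : ℕ → ℕ) → ∏ (upTo N) (λ k → f (suc k) ^ ⟦ p ℕ.≟ suc k ⟧) ≡ f p
∏-δ⁺ {N} {suc q} _ q<N f = trans
  (∏-cong (upTo N) (λ k → cong (f (suc k) ^_) (⟦⟧-cong (suc q ℕ.≟ suc k) (q ℕ.≟ k) suc-injective (cong suc))))
  (∏-δ ℕ._≟_ (Unique.upTo⁺ N) (∈-upTo⁺ q<N) (λ k → f (suc k)))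

*-δ : ∀ p q → p * ⟦ p ℕ.≟ q ⟧ ≡ q * ⟦ p ℕ.≟ q ⟧
*-δ p q = trans (*-comm p _) (trans (⟦⟧-guard (p ℕ.≟ q) id) (*-comm _ q))

-- Points on cycles of length `L`, not cycles: points can be summed over directly, and the division
-- by `L` waits for `cnt-∣`.
cnt : Word N → ℕ → ℕ
cnt σ L = ∑ᶠ (λ i → ⟦ len σ i ℕ.≟ L ⟧)

-- Only the points of the two merged orbits change their length. What they leave behind is added on
-- the left instead of being subtracted on the right.
cnt-merge : {σ : Word N} (pσ : Perm σ) {x y : Fin N} → ¬ Reach σ x y → ∀ L →
            cnt (σ ∙ swap x y) L + (len σ x * ⟦ len σ x ℕ.≟ L ⟧ + len σ y * ⟦ len σ y ℕ.≟ L ⟧)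
            ≡ cnt σ L + (len σ x + len σ y) * ⟦ len σ x + len σ y ℕ.≟ L ⟧
cnt-merge {N} {σ} pσ {x} {y} x≁y L = begin
  cnt σ′ L + (px * δ px + py * δ py)
    ≡⟨ cong₂ (λ a b → cnt σ′ L + (a * δ px + b * δ py)) (len-∑ pσ x) (len-∑ pσ y) ⟨
  cnt σ′ L + (∑ᶠ inX * δ px + ∑ᶠ inY * δ py)
    ≡⟨ cong (cnt σ′ L +_) (cong₂ _+_ (∑-*ʳ (L.allFin N) inX _) (∑-*ʳ (L.allFin N) inY _)) ⟨
  cnt σ′ L + (∑ᶠ (λ i → inX i * δ px) + ∑ᶠ (λ i → inY i * δ py))
    ≡⟨ cong (cnt σ′ L +_) (∑-+ (L.allFin N) _ _) ⟨
  cnt σ′ L + ∑ᶠ (λ i → inX i * δ px + inY i * δ py)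
    ≡⟨ ∑-+ (L.allFin N) _ _ ⟨
  ∑ᶠ (λ i → δ (len σ′ i) + (inX i * δ px + inY i * δ py))
    ≡⟨ ∑-cong (L.allFin N) each ⟩
  ∑ᶠ (λ i → δ (len σ i) + (inX i + inY i) * δ (px + py))
    ≡⟨ ∑-+ (L.allFin N) _ _ ⟩
  cnt σ L + ∑ᶠ (λ i → (inX i + inY i) * δ (px + py))
    ≡⟨ cong (cnt σ L +_) (trans (∑-*ʳ (L.allFin N) _ _) (cong (_* δ (px + py)) (trans (∑-+ (L.allFin N) inX inY)
         (cong₂ _+_ (len-∑ pσ x) (len-∑ pσ y))))) ⟩
  cnt σ L + (px + py) * δ (px + py) ∎
  where
  open ≡-Reasoning
  σ′ = σ ∙ swap x y
  px = len σ x
  py = len σ y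
  inX inY : Fin N → ℕ
  inX i = ⟦ reach? pσ x i ⟧
  inY i = ⟦ reach? pσ y i ⟧
  δ : ℕ → ℕ
  δ p = ⟦ p ℕ.≟ L ⟧
  each : ∀ i → δ (len σ′ i) + (inX i * δ px + inY i * δ py) ≡ δ (len σ i) + (inX i + inY i) * δ (px + py)
  each i with reach? pσ x i | reach? pσ y i
  ... | yes r | yes s = contradiction (reach-trans r (reach-sym pσ s)) x≁y
  ... | yes r | no _  rewrite len-merged pσ x≁y (inj₁ r) | sym (len-reach pσ r) =
    (λ a b → trans (cong (b +_) (trans (+-identityʳ (a + 0)) (+-identityʳ a))) (trans (+-comm b a) (cong (a +_) (sym (+-identityʳ b))))) (δ px) (δ (px + py))
  ... | no _  | yes s rewrite len-merged pσ x≁y (inj₂ s) | sym (len-reach pσ s) =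
    (λ a b → trans (cong (b +_) (+-identityʳ a)) (trans (+-comm b a) (cong (a +_) (sym (+-identityʳ b))))) (δ py) (δ (px + py))
  ... | no ¬r | no ¬s rewrite len-unmerged pσ x≁y {i} (λ { (inj₁ r) → ¬r r ; (inj₂ s) → ¬s s }) = refl

fixed-≁ : {σ : Word N} {x y : Fin N} → lookup σ x ≡ x → ¬ x ≡ y → ¬ Reach σ x y
fixed-≁ {σ = σ} fix x≢y (reach k eq) = x≢y (trans (sym (iter-fixed {σ = σ} fix k)) eq)

lookup-∙-swap-x : (σ : Word N) (x y : Fin N) → lookup (σ ∙ swap x y) x ≡ lookup σ y
lookup-∙-swap-x σ x y = trans (lookup-∙ σ _ x) (cong (lookup σ) (lookup-swap-x x y))

lookup-∙-swap-≢ : (σ : Word N) (x y : Fin N) {z : Fin N} → ¬ z ≡ x → ¬ z ≡ y →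
                  lookup (σ ∙ swap x y) z ≡ lookup σ z
lookup-∙-swap-≢ σ x y z≢x z≢y = trans (lookup-∙ σ _ _) (cong (lookup σ) (lookup-swap-≢ x y z≢x z≢y))

-- In every step `x` is still fixed, so `swap x y` merges two cycles. Inductions by this principle
-- never meet a splitting.
perm-induction : (P : Word N → Set) → P ε →
                 (∀ {σ x y} → Perm σ → lookup σ x ≡ x → ¬ x ≡ y → P σ → P (σ ∙ swap x y)) →
                 ∀ {σ} → Perm σ → P σ
perm-induction {N} P base step {σ} pσ = go (L.allFin N) pσ (λ i i∉ → contradiction (∈-allFin i) i∉)
  where
  go : (xs : List (Fin N)) → ∀ {σ} → Perm σ → (∀ i → ¬ i ∈ xs → lookup σ i ≡ i) → P σ
  go [] {σ} pσ fix = subst P (word-ext _ _ (λ i → trans (lookup-id i) (sym (fix i λ ())))) base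
  go (x ∷ xs) {σ} pσ fix with lookup σ x ≟ᶠ x
  ... | yes x-fixed = go xs pσ fix′
    where
    fix′ : ∀ i → ¬ i ∈ xs → lookup σ i ≡ i
    fix′ i i∉ with i ≟ᶠ x
    ... | yes refl = x-fixed
    ... | no i≢x   = fix i λ { (here eq) → i≢x eq ; (there i∈) → i∉ i∈ }
  -- Redirecting the predecessor `y` of `x` makes `x` fixed and moves no point that was fixed
  -- before, so only the points of `xs` can remain moved.
  ... | no x-moved with y , σy≡x ← perm-surjective pσ x =
    subst P (∙-swap-swap σ x y) (step pτ τx≡x x≢y (go xs pτ fix′))
    where
    x≢y : ¬ x ≡ y
    x≢y refl = x-moved σy≡x
    τ = σ ∙ swap x y
    pτ : Perm τ
    pτ = perm-∙ pσ (perm-swap x y)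
    τx≡x : lookup τ x ≡ x
    τx≡x = trans (lookup-∙-swap-x σ x y) σy≡x
    fix′ : ∀ i → ¬ i ∈ xs → lookup τ i ≡ i
    fix′ i i∉ with i ≟ᶠ x
    ... | yes refl = τx≡x
    ... | no i≢x   = trans (lookup-∙-swap-≢ σ x y i≢x (λ { refl → x≢y (trans (sym σy≡x) σi≡i) })) σi≡i
      where
      σi≡i : lookup σ i ≡ i
      σi≡i = fix i λ { (here eq) → i≢x eq ; (there i∈) → i∉ i∈ }

-- Each merge changes the count by multiples of `L`. The induction avoids choosing a representative
-- in every cycle.
cnt-∣ : {σ : Word N} → Perm σ → ∀ L → L ∣ cnt σ L
cnt-∣ {N} = perm-induction (λ (σ : Word N) → ∀ L → L ∣ cnt σ L) base step
  where
  ∣δ : ∀ p L → L ∣ p * ⟦ p ℕ.≟ L ⟧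
  ∣δ p L = subst (L ∣_) (sym (*-δ p L)) (∣m⇒∣m*n ⟦ p ℕ.≟ L ⟧ ∣-refl)
  base : ∀ L → L ∣ cnt {N} ε L
  base L = subst (L ∣_) (sym (trans (∑-cong (L.allFin N) (λ i → trans (cong (λ p → ⟦ p ℕ.≟ L ⟧) (len-fixed perm-id (lookup-id i)))
                                                              (sym (+-identityʳ _)))) (∑ᶠ-const {N} (1 * ⟦ 1 ℕ.≟ L ⟧))))
                  (∣n⇒∣m*n N (∣δ 1 L))
  step : ∀ {σ : Word N} {x y} → Perm σ → lookup σ x ≡ x → ¬ x ≡ y → (∀ L → L ∣ cnt σ L) → ∀ L → L ∣ cnt (σ ∙ swap x y) L
  step {σ} {x} {y} pσ fix x≢y ih L = ∣m+n∣m⇒∣n {m = len σ x * ⟦ len σ x ℕ.≟ L ⟧ + len σ y * ⟦ len σ y ℕ.≟ L ⟧}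
    (subst (L ∣_) (trans (sym (cnt-merge pσ (fixed-≁ {σ = σ} fix x≢y) L)) (+-comm (cnt (σ ∙ swap x y) L) _)) (∣m∣n⇒∣m+n (ih L) (∣δ (len σ x + len σ y) L)))
    (∣m∣n⇒∣m+n (∣δ (len σ x) L) (∣δ (len σ y) L))

opaque
  mult : Word N → ℕ → ℕ
  mult σ k = cnt σ (suc k) ℕ./ suc k

  mult-def : (σ : Word N) (k : ℕ) → mult σ k ≡ cnt σ (suc k) ℕ./ suc k
  mult-def σ k = refl

  cnt-mult : {σ : Word N} → Perm σ → ∀ k → cnt σ (suc k) ≡ suc k * mult σ k
  cnt-mult pσ k = sym (m*[n/m]≡n (cnt-∣ pσ (suc k)))

mult-merge : {σ : Word N} → Perm σ → {x y : Fin N} → ¬ Reach σ x y → ∀ k →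
             mult (σ ∙ swap x y) k + (⟦ len σ x ℕ.≟ suc k ⟧ + ⟦ len σ y ℕ.≟ suc k ⟧)
             ≡ mult σ k + ⟦ len σ x + len σ y ℕ.≟ suc k ⟧
mult-merge {σ = σ} pσ {x} {y} x≁y k = *-cancelˡ-≡ _ _ (suc k) (begin
  suc k * (mult σ′ k + (δ px + δ py)) ≡⟨ expand (suc k) (mult σ′ k) (δ px) (δ py) ⟩
  suc k * mult σ′ k + (suc k * δ px + suc k * δ py) ≡⟨ cong₂ _+_ (cnt-mult (perm-∙ pσ (perm-swap x y)) k) (cong₂ _+_ (*-δ px (suc k)) (*-δ py (suc k))) ⟨
  cnt σ′ (suc k) + (px * δ px + py * δ py) ≡⟨ cnt-merge pσ x≁y (suc k) ⟩
  cnt σ (suc k) + (px + py) * δ (px + py) ≡⟨ cong₂ _+_ (cnt-mult pσ k) (*-δ (px + py) (suc k)) ⟩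
  suc k * mult σ k + suc k * δ (px + py) ≡⟨ *-distribˡ-+ (suc k) (mult σ k) _ ⟨
  suc k * (mult σ k + δ (px + py)) ∎)
  where
  open ≡-Reasoning
  σ′ = σ ∙ swap x y
  px = len σ x
  py = len σ y
  δ : ℕ → ℕ
  δ p = ⟦ p ℕ.≟ suc k ⟧
  expand : ∀ a b c d → a * (b + (c + d)) ≡ a * b + (a * c + a * d)
  expand = solve-∀

cyc : Word N → ℕ
cyc {N} σ = ∑ (upTo N) (mult σ)

cycleProduct : Word N → ℕ
cycleProduct {N} σ = ∏ (upTo N) (λ k → suc k ^ mult σ k)

mult-cong : {σ τ : Word N} → (∀ i → len σ i ≡ len τ i) → ∀ k → mult σ k ≡ mult τ k
mult-cong {N} {σ} {τ} h k = trans (mult-def σ k) (trans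
  (cong (ℕ._/ suc k) (∑-cong (L.allFin N) (λ i → cong (λ p → ⟦ p ℕ.≟ suc k ⟧) (h i)))) (sym (mult-def τ k)))

cyc-cong : {σ τ : Word N} → (∀ k → mult σ k ≡ mult τ k) → cyc σ ≡ cyc τ
cyc-cong {N} h = ∑-cong (upTo N) h

module _ {σ : Word N} (pσ : Perm σ) {x y : Fin N} (x≁y : ¬ Reach σ x y) where

  private
    px = len σ x
    py = len σ y
    σ′ = σ ∙ swap x y

    px+py≤N : px + py ≤ N
    px+py≤N = subst (_≤ N) (len-merged pσ x≁y {x} (inj₁ reach-refl)) (len≤N (perm-∙ pσ (perm-swap x y)) x)

    px+py>0 : 0 < px + py
    px+py>0 = ≤-trans (len-positive pσ x) (m≤m+n px py)

  cyc-merge : suc (cyc (σ ∙ swap x y)) ≡ cyc σ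
  cyc-merge = +-cancelʳ-≡ 1 _ _ (begin
    suc (cyc σ′) + 1 ≡⟨ +-suc (cyc σ′) 1 ⟨
    cyc σ′ + (1 + 1) ≡⟨ cong (cyc σ′ +_) (cong₂ _+_ (∑-δ⁺1 (len-positive pσ x) (len≤N pσ x)) (∑-δ⁺1 (len-positive pσ y) (len≤N pσ y))) ⟨
    cyc σ′ + (∑ (upTo N) (δ px) + ∑ (upTo N) (δ py)) ≡⟨ cong (cyc σ′ +_) (∑-+ (upTo N) (δ px) (δ py)) ⟨
    cyc σ′ + ∑ (upTo N) (λ k → δ px k + δ py k) ≡⟨ ∑-+ (upTo N) (mult σ′) _ ⟨
    ∑ (upTo N) (λ k → mult σ′ k + (δ px k + δ py k)) ≡⟨ ∑-cong (upTo N) (mult-merge pσ x≁y) ⟩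
    ∑ (upTo N) (λ k → mult σ k + δ (px + py) k) ≡⟨ ∑-+ (upTo N) (mult σ) _ ⟩
    cyc σ + ∑ (upTo N) (δ (px + py)) ≡⟨ cong (cyc σ +_) (∑-δ⁺1 px+py>0 px+py≤N) ⟩
    cyc σ + 1 ∎)
    where
    open ≡-Reasoning
    δ : ℕ → ℕ → ℕ
    δ p k = ⟦ p ℕ.≟ suc k ⟧

  cycleProduct-merge : cycleProduct (σ ∙ swap x y) * (px * py) ≡ cycleProduct σ * (px + py)
  cycleProduct-merge = begin
    cycleProduct σ′ * (px * py)
      ≡⟨ cong (cycleProduct σ′ *_) (cong₂ _*_ (∏-δ⁺ (len-positive pσ x) (len≤N pσ x) id) (∏-δ⁺ (len-positive pσ y) (len≤N pσ y) id)) ⟨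
    cycleProduct σ′ * (∏ (upTo N) (e px) * ∏ (upTo N) (e py))
      ≡⟨ cong (cycleProduct σ′ *_) (∏-* (upTo N) (e px) (e py)) ⟨
    cycleProduct σ′ * ∏ (upTo N) (λ k → e px k * e py k)
      ≡⟨ ∏-* (upTo N) _ _ ⟨
    ∏ (upTo N) (λ k → suc k ^ mult σ′ k * (e px k * e py k))
      ≡⟨ ∏-cong (upTo N) each ⟩
    ∏ (upTo N) (λ k → suc k ^ mult σ k * e (px + py) k)
      ≡⟨ ∏-* (upTo N) _ _ ⟩
    cycleProduct σ * ∏ (upTo N) (e (px + py))
      ≡⟨ cong (cycleProduct σ *_) (∏-δ⁺ px+py>0 px+py≤N id) ⟩
    cycleProduct σ * (px + py) ∎
    where
    open ≡-Reasoning
    δ : ℕ → ℕ → ℕ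
    δ p k = ⟦ p ℕ.≟ suc k ⟧
    e : ℕ → ℕ → ℕ
    e p k = suc k ^ δ p k
    each : ∀ k → suc k ^ mult σ′ k * (e px k * e py k) ≡ suc k ^ mult σ k * e (px + py) k
    each k = begin
      suc k ^ mult σ′ k * (e px k * e py k) ≡⟨ cong (suc k ^ mult σ′ k *_) (^-distribˡ-+-* (suc k) (δ px k) (δ py k)) ⟨
      suc k ^ mult σ′ k * suc k ^ (δ px k + δ py k) ≡⟨ ^-distribˡ-+-* (suc k) (mult σ′ k) _ ⟨
      suc k ^ (mult σ′ k + (δ px k + δ py k)) ≡⟨ cong (suc k ^_) (mult-merge pσ x≁y k) ⟩
      suc k ^ (mult σ k + δ (px + py) k) ≡⟨ ^-distribˡ-+-* (suc k) (mult σ k) _ ⟩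
      suc k ^ mult σ k * e (px + py) k ∎

-- If the product separates `x` and `y`, then `σ` arises from it by a merge and has one cycle less.
-- Otherwise two uses of `reach-swap-within` show that both have the same orbits; this covers
-- `x = y`.
cyc-swap-within : {σ : Word N} → Perm σ → {x y : Fin N} → Reach σ x y → cyc σ ≤ cyc (σ ∙ swap x y)
cyc-swap-within {σ = σ} pσ {x} {y} x~y with reach? (perm-∙ pσ (perm-swap x y)) x y
... | no x≁′y = <⇒≤ (≤-reflexive (trans (cong (suc ∘ cyc) (sym (∙-swap-swap σ x y)))
                                        (cyc-merge (perm-∙ pσ (perm-swap x y)) x≁′y)))
... | yes x~′y = ≤-reflexive (cyc-cong (mult-cong λ i → len-cong pσ pσ′
    (λ j r → reach-swap-within pσ′ x~′y (subst (λ τ → Reach τ i j) (sym (∙-swap-swap σ x y)) r))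
    (λ j → reach-swap-within pσ x~y)))
  where
  pσ′ : Perm (σ ∙ swap x y)
  pσ′ = perm-∙ pσ (perm-swap x y)

cyc-swap : {σ : Word N} → Perm σ → (x y : Fin N) → cyc σ ≤ suc (cyc (σ ∙ swap x y))
cyc-swap pσ x y with reach? pσ x y
... | yes x~y = m≤n⇒m≤1+n (cyc-swap-within pσ x~y)
... | no x≁y  = ≤-reflexive (sym (cyc-merge pσ x≁y))

iter-conj : {γ : Word N} → Perm γ → (σ : Word N) (k : ℕ) (i : Fin N) →
            iter (conj γ σ) k (lookup γ i) ≡ lookup γ (iter σ k i)
iter-conj pγ σ zero    i = refl
iter-conj {γ = γ} pγ σ (suc k) i = trans (cong (lookup (conj γ σ)) (iter-conj pγ σ k i)) (lookup-conj pγ σ _)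

len-conj : {γ σ : Word N} → Perm γ → Perm σ → ∀ i → len (conj γ σ) (lookup γ i) ≡ len σ i
len-conj {N} {γ} {σ} pγ pσ i = begin
  len (conj γ σ) (lookup γ i) ≡⟨ len-∑ pσ′ (lookup γ i) ⟨
  ∑ᶠ (λ j → ⟦ reach? pσ′ (lookup γ i) j ⟧) ≡⟨ ∑ᶠ-perm pγ _ ⟨
  ∑ᶠ (λ j → ⟦ reach? pσ′ (lookup γ i) (lookup γ j) ⟧) ≡⟨ ∑-cong (L.allFin N) (λ j → ⟦⟧-cong (reach? pσ′ _ _) (reach? pσ i j)
      (λ (reach k eq) → reach k (injective pγ _ _ (trans (sym (iter-conj pγ σ k i)) eq)))
      (λ (reach k eq) → reach k (trans (iter-conj pγ σ k i) (cong (lookup γ) eq)))) ⟩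
  ∑ᶠ (λ j → ⟦ reach? pσ i j ⟧) ≡⟨ len-∑ pσ i ⟩
  len σ i ∎
  where
  open ≡-Reasoning
  pσ′ : Perm (conj γ σ)
  pσ′ = perm-conj pγ pσ

mult-conj : {γ σ : Word N} → Perm γ → Perm σ → ∀ k → mult (conj γ σ) k ≡ mult σ k
mult-conj {N} {γ} {σ} pγ pσ k = trans (mult-def (conj γ σ) k) (trans (cong (ℕ._/ suc k)
  (trans (sym (∑ᶠ-perm pγ _)) (∑-cong (L.allFin N) (λ i → cong (λ p → ⟦ p ℕ.≟ suc k ⟧) (len-conj pγ pσ i)))))
  (sym (mult-def σ k)))

cyc-conj : {γ σ : Word N} → Perm γ → Perm σ → cyc (conj γ σ) ≡ cyc σ
cyc-conj pγ pσ = cyc-cong (mult-conj pγ pσ)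

∑-mult : {σ : Word N} → Perm σ → ∑ (upTo N) (λ k → suc k * mult σ k) ≡ N
∑-mult {N} {σ} pσ = begin
  ∑ (upTo N) (λ k → suc k * mult σ k) ≡⟨ ∑-cong (upTo N) (cnt-mult pσ) ⟨
  ∑ (upTo N) (λ k → ∑ᶠ (λ i → ⟦ len σ i ℕ.≟ suc k ⟧)) ≡⟨ ∑-swap (upTo N) (L.allFin N) _ ⟩
  ∑ᶠ (λ i → ∑ (upTo N) (λ k → ⟦ len σ i ℕ.≟ suc k ⟧)) ≡⟨ ∑-cong (L.allFin N) (λ i → ∑-δ⁺1 (len-positive pσ i) (len≤N pσ i)) ⟩
  ∑ᶠ {N} (λ _ → 1) ≡⟨ trans (∑ᶠ-const {N} 1) (*-identityʳ N) ⟩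
  N ∎
  where open ≡-Reasoning

-- A sum over cycles spread over points: each of the `p` points of a cycle carries the share
-- `h p / p`, which the hypothesis expresses without division.
∑-cycles : {σ : Word N} → Perm σ → (f : Fin N → ℕ) (h : ℕ → ℕ) → (∀ i → len σ i * f i ≡ h (len σ i)) →
           ∑ᶠ f ≡ ∑ (upTo N) (λ k → mult σ k * h (suc k))
∑-cycles {N} {σ} pσ f h eq = begin
  ∑ᶠ f ≡⟨ ∑-cong (L.allFin N) (λ i → ∑-δ⁺ (len-positive pσ i) (len≤N pσ i) (λ _ → f i)) ⟨
  ∑ᶠ (λ i → ∑ (upTo N) (λ k → ⟦ len σ i ℕ.≟ suc k ⟧ * f i)) ≡⟨ ∑-swap (L.allFin N) (upTo N) _ ⟩
  ∑ (upTo N) (λ k → ∑ᶠ (λ i → ⟦ len σ i ℕ.≟ suc k ⟧ * f i)) ≡⟨ ∑-cong (upTo N) each ⟩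
  ∑ (upTo N) (λ k → mult σ k * h (suc k)) ∎
  where
  open ≡-Reasoning
  at : ∀ k i → suc k * (⟦ len σ i ℕ.≟ suc k ⟧ * f i) ≡ ⟦ len σ i ℕ.≟ suc k ⟧ * h (suc k)
  at k i = trans (*-swapˡ (suc k) ⟦ len σ i ℕ.≟ suc k ⟧ (f i)) (⟦⟧-guard (len σ i ℕ.≟ suc k)
    (λ e → trans (cong (_* f i) (sym e)) (trans (eq i) (cong h e))))
  each : ∀ k → ∑ᶠ (λ i → ⟦ len σ i ℕ.≟ suc k ⟧ * f i) ≡ mult σ k * h (suc k)
  each k = *-cancelˡ-≡ _ _ (suc k) (begin
    suc k * ∑ᶠ (λ i → ⟦ len σ i ℕ.≟ suc k ⟧ * f i) ≡⟨ ∑-*ˡ (L.allFin N) (suc k) _ ⟨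
    ∑ᶠ (λ i → suc k * (⟦ len σ i ℕ.≟ suc k ⟧ * f i)) ≡⟨ ∑-cong (L.allFin N) (at k) ⟩
    ∑ᶠ (λ i → ⟦ len σ i ℕ.≟ suc k ⟧ * h (suc k)) ≡⟨ ∑-*ʳ (L.allFin N) _ (h (suc k)) ⟩
    cnt σ (suc k) * h (suc k) ≡⟨ cong (_* h (suc k)) (cnt-mult pσ k) ⟩
    suc k * mult σ k * h (suc k) ≡⟨ *-assoc (suc k) (mult σ k) _ ⟩
    suc k * (mult σ k * h (suc k)) ∎)

cyc≤N : {σ : Word N} → Perm σ → cyc σ ≤ N
cyc≤N {N} {σ} pσ = subst (cyc σ ≤_) (∑-mult pσ) (∑-mono (upTo N) (λ k → m≤n*m (mult σ k) (suc k)))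

cyc-positive : {σ : Word (suc N)} → Perm σ → 0 < cyc σ
cyc-positive {N} {σ} pσ with cyc σ in eq
... | suc _ = s≤s z≤n
... | zero  = contradiction (trans (sym (∑-mult pσ)) (trans (∑-cong-∈ (upTo (suc N)) (λ k k∈ →
    trans (cong (suc k *_) (n≤0⇒n≡0 (subst (mult σ k ≤_) eq (∑-term≤ (mult σ) k∈)))) (*-zeroʳ (suc k))))
    (∑-zero (upTo (suc N)) {λ _ → 0} (λ _ → refl)))) λ ()

-- Counting the completions of a permutation to a single cycle, by cycle type

Subset : ℕ → Set
Subset N = Fin N → Bool

in? : (X : Subset N) (i : Fin N) → Dec (X i ≡ true)
in? X i = X i Bool.≟ true

size : Subset N → ℕ
size X = ∑ᶠ (λ i → ⟦ in? X i ⟧)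

remove : Subset N → Fin N → Subset N
remove X x i = if does (i ≟ᶠ x) then false else X i

remove-self : (X : Subset N) (x : Fin N) → remove X x x ≡ false
remove-self X x with x ≟ᶠ x
... | yes _  = refl
... | no x≢x = contradiction refl x≢x

remove-≢ : (X : Subset N) (x : Fin N) {i : Fin N} → ¬ i ≡ x → remove X x i ≡ X i
remove-≢ X x {i} i≢x with i ≟ᶠ x
... | yes eq = contradiction eq i≢x
... | no _   = refl

remove-∈ : (X : Subset N) (x : Fin N) {i : Fin N} → remove X x i ≡ true → ¬ i ≡ x × X i ≡ true
remove-∈ X x {i} eq with i ≟ᶠ x
... | no i≢x = i≢x , eq

true≢false : ∀ {b} → b ≡ true → ¬ b ≡ false
true≢false refl ()

in-true : {X : Subset N} {i : Fin N} → X i ≡ true → ⟦ in? X i ⟧ ≡ 1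
in-true {X = X} {i} = ⟦⟧-yes (in? X i)

in-false : {X : Subset N} {i : Fin N} → X i ≡ false → ⟦ in? X i ⟧ ≡ 0
in-false {X = X} {i} eq = ⟦⟧-no (in? X i) (λ t → true≢false t eq)

size-remove : (X : Subset N) (x : Fin N) → X x ≡ true → size X ≡ suc (size (remove X x))
size-remove {N} X x x∈X = begin
  size X ≡⟨ ∑-cong (L.allFin N) each ⟩
  ∑ᶠ (λ i → ⟦ x ≟ᶠ i ⟧ * 1 + ⟦ in? (remove X x) i ⟧) ≡⟨ ∑-+ (L.allFin N) _ _ ⟩
  ∑ᶠ (λ i → ⟦ x ≟ᶠ i ⟧ * 1) + size (remove X x) ≡⟨ cong (_+ size (remove X x)) (∑-δF (fin N) x (λ _ → 1)) ⟩
  suc (size (remove X x)) ∎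
  where
  open ≡-Reasoning
  each : ∀ i → ⟦ in? X i ⟧ ≡ ⟦ x ≟ᶠ i ⟧ * 1 + ⟦ in? (remove X x) i ⟧
  each i with x ≟ᶠ i
  ... | yes refl = trans (in-true {X = X} x∈X) (cong suc (sym (in-false {X = remove X x} (remove-self X x))))
  ... | no x≢i   = cong (λ b → ⟦ b Bool.≟ true ⟧) (sym (remove-≢ X x (x≢i ∘ sym)))

size-zero : (X : Subset N) → size X ≡ 0 → ∀ i → X i ≡ false
size-zero X eq i with X i in e
... | false = refl
... | true  = contradiction (subst₂ _≤_ (in-true {X = X} e) eq (∑-term≤ (λ i → ⟦ in? X i ⟧) (∈-allFin i))) λ ()

size-suc : (X : Subset N) {q : ℕ} → size X ≡ suc q → ∃[ x ] X x ≡ true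
size-suc {N} X eq with Fin.any? (in? X)
... | yes found = found
... | no none   = contradiction (trans (sym eq) (∑-zero (L.allFin N) (λ i → ⟦⟧-no (in? X i) (λ e → none (i , e))))) λ ()

size-complement : (X : Subset N) {q j : ℕ} → size X ≡ q → q + j ≡ N → ∑ᶠ (λ i → ⟦ ¬? (in? X i) ⟧) ≡ j
size-complement {N} X {q} {j} eq q+j = +-cancelˡ-≡ q _ _ (begin
  q + ∑ᶠ (λ i → ⟦ ¬? (in? X i) ⟧) ≡⟨ cong (_+ ∑ᶠ (λ i → ⟦ ¬? (in? X i) ⟧)) eq ⟨
  size X + ∑ᶠ (λ i → ⟦ ¬? (in? X i) ⟧) ≡⟨ ∑-+ (L.allFin N) _ _ ⟨
  ∑ᶠ (λ i → ⟦ in? X i ⟧ + ⟦ ¬? (in? X i) ⟧) ≡⟨ ∑-cong (L.allFin N) (λ i → one (in? X i)) ⟩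
  ∑ᶠ {N} (λ _ → 1) ≡⟨ trans (∑ᶠ-const {N} 1) (*-identityʳ N) ⟩
  N ≡⟨ q+j ⟨
  q + j ∎)
  where
  open ≡-Reasoning
  one : {P : Set} (d : Dec P) → ⟦ d ⟧ + ⟦ ¬? d ⟧ ≡ 1
  one (yes _) = refl
  one (no _)  = refl

Fixes : Subset N → Word N → Set
Fixes X σ = ∀ i → X i ≡ false → lookup σ i ≡ i

opaque
  fixes? : (X : Subset N) (σ : Word N) → Dec (Fixes X σ)
  fixes? X σ = Fin.all? λ i → (X i Bool.≟ false) →-dec (lookup σ i ≟ᶠ i)

fixes-remove : (X : Subset N) (x : Fin N) (σ : Word N) → Fixes X σ → lookup σ x ≡ x → Fixes (remove X x) σ
fixes-remove X x σ fix σx≡x i i∉X′ with i ≟ᶠ x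
... | yes refl = σx≡x
... | no i≢x   = fix i i∉X′

fixes-removed : (X : Subset N) (x : Fin N) (σ : Word N) → Fixes (remove X x) σ → lookup σ x ≡ x
fixes-removed X x σ fix = fix x (remove-self X x)

fixes-superset : (X : Subset N) (x : Fin N) (σ : Word N) → X x ≡ true → Fixes (remove X x) σ → Fixes X σ
fixes-superset X x σ x∈X fix i i∉X = fix i (trans (remove-≢ X x (λ { refl → true≢false x∈X i∉X })) i∉X)

HasMult : Word N → (ℕ → ℕ) → Set
HasMult {N} σ f = ∀ k → k < N → mult σ k ≡ f k

opaque
  hasMult? : (σ : Word N) (f : ℕ → ℕ) → Dec (HasMult σ f)
  hasMult? {N} σ f = map′ (λ h k k<N → h k<N) (λ h {k} k<N → h k k<N) (allUpTo? (λ k → mult σ k ℕ.≟ f k) N)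

-- Turns a cycle type on `X` into one on all points: the `j` points outside `X` are further fixed
-- points.
shift : ℕ → (ℕ → ℕ) → ℕ → ℕ
shift j μ zero    = μ 0 + j
shift j μ (suc k) = μ (suc k)

shift-δ : (j : ℕ) (μ : ℕ → ℕ) (k : ℕ) → shift (suc j) μ k ≡ shift j μ k + ⟦ 1 ℕ.≟ suc k ⟧
shift-δ j μ zero    = trans (+-suc (μ 0) j) (+-comm 1 (μ 0 + j))
shift-δ j μ (suc k) = sym (+-identityʳ _)

fixed-points≤ : {ρ : Word N} → Perm ρ → (X : Subset N) {q j : ℕ} → size X ≡ q → q + j ≡ N → Fixes X ρ → j ≤ mult ρ 0
fixed-points≤ {N} {ρ} pρ X {j = j} |X| q+j fix = begin
  j ≡⟨ size-complement X |X| q+j ⟨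
  ∑ᶠ (λ i → ⟦ ¬? (in? X i) ⟧) ≤⟨ ∑-mono (L.allFin N) each ⟩
  cnt ρ 1 ≡⟨ trans (cnt-mult pρ 0) (*-identityˡ _) ⟩
  mult ρ 0 ∎
  where
  open ≤-Reasoning
  each : ∀ i → ⟦ ¬? (in? X i) ⟧ ≤ ⟦ len ρ i ℕ.≟ 1 ⟧
  each i with X i in e
  ... | true  = z≤n
  ... | false = ≤-reflexive (sym (⟦⟧-yes (len ρ i ℕ.≟ 1) (len-fixed pρ (fix i e))))

-- The `j` points outside `X` are cycles by themselves and `X` carries at least one more. Otherwise
-- all cycles would be fixed points, at most `j` in number, too few to cover `N` points.
fixing-cyc : {ρ : Word N} → Perm ρ → (X : Subset N) {q j : ℕ} → size X ≡ suc q → suc q + j ≡ N →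
             Fixes X ρ → j < cyc ρ
fixing-cyc {suc n} {ρ} pρ X {q} {j} |X| q+j fix with j <? cyc ρ
... | yes j<cyc = j<cyc
... | no j≮cyc  = contradiction (begin-strict
    j <⟨ m<n+m j {suc q} (s≤s z≤n) ⟩
    suc q + j ≡⟨ trans q+j (sym (∑-mult pρ)) ⟩
    1 * mult ρ 0 + ∑ rest (λ k → suc k * mult ρ k) ≡⟨ cong₂ _+_ (*-identityˡ (mult ρ 0)) (∑-rest rest rest≡0) ⟩
    mult ρ 0 + 0 ≤⟨ +-monoʳ-≤ (mult ρ 0) z≤n ⟩
    cyc ρ ≤⟨ ≮⇒≥ j≮cyc ⟩
    j ∎) (<-irrefl refl)
  where
  open ≤-Reasoning
  rest = L.applyUpTo suc n
  rest≡0 : ∑ rest (mult ρ) ≡ 0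
  rest≡0 = n≤0⇒n≡0 (+-cancelˡ-≤ (mult ρ 0) _ _ (begin
    cyc ρ ≤⟨ ≮⇒≥ j≮cyc ⟩
    j ≤⟨ fixed-points≤ pρ X |X| q+j fix ⟩
    mult ρ 0 ≡⟨ +-identityʳ _ ⟨
    mult ρ 0 + 0 ∎))
  ∑-rest : ∀ xs → ∑ xs (mult ρ) ≡ 0 → ∑ xs (λ k → suc k * mult ρ k) ≡ 0
  ∑-rest xs eq = trans (∑-cong-∈ xs (λ k k∈ → trans (cong (suc k *_) (n≤0⇒n≡0 (subst (mult ρ k ≤_) eq (∑-term≤ (mult ρ) k∈))))
                                                     (*-zeroʳ (suc k))))
                         (∑-zero xs {λ _ → 0} (λ _ → refl))

fixing-∙ : {X : Subset N} {σ τ : Word N} → Fixes X σ → Fixes X τ → Fixes X (σ ∙ τ)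
fixing-∙ {σ = σ} {τ} f g i i∉X = trans (lookup-∙ σ τ i) (trans (cong (lookup σ) (g i i∉X)) (f i i∉X))

-- Only parts of size one, counted by `f 0`, weigh less than two. Applied to vertex degrees this is
-- what forces a leaf.
double≤ : (f : ℕ → ℕ) → 0 < N → 2 * ∑ (upTo N) f ≤ ∑ (upTo N) (λ k → suc k * f k) + f 0
double≤ {suc n} f _ = begin
  2 * (f 0 + ∑ rest f) ≡⟨ *-distribˡ-+ 2 (f 0) _ ⟩
  2 * f 0 + 2 * ∑ rest f ≤⟨ +-monoʳ-≤ (2 * f 0) (tail (L.applyUpTo suc n) λ k k∈ → positive n suc (λ _ → s≤s z≤n) k∈) ⟩
  2 * f 0 + ∑ rest (λ k → suc k * f k) ≡⟨ move (f 0) _ ⟩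
  1 * f 0 + ∑ rest (λ k → suc k * f k) + f 0 ∎
  where
  open ≤-Reasoning
  rest = L.applyUpTo suc n
  move : ∀ a b → 2 * a + b ≡ 1 * a + b + a
  move = solve-∀
  positive : ∀ n (g : ℕ → ℕ) → (∀ i → 1 ≤ g i) → ∀ {k} → k ∈ L.applyUpTo g n → 1 ≤ k
  positive (suc n) g h (here refl) = h 0
  positive (suc n) g h (there k∈)  = positive n (g ∘ suc) (h ∘ suc) k∈
  tail : ∀ xs → (∀ k → k ∈ xs → 1 ≤ k) → 2 * ∑ xs f ≤ ∑ xs (λ k → suc k * f k)
  tail []       _ = z≤n
  tail (x ∷ xs) h = subst (_≤ ∑ (x ∷ xs) (λ k → suc k * f k)) (sym (*-distribˡ-+ 2 (f x) (∑ xs f)))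
    (+-mono-≤ (*-monoˡ-≤ (f x) (s≤s (h x (here refl)))) (tail xs (λ k k∈ → h k (there k∈))))

mult-ε : ∀ k → mult (ε {N}) k ≡ N * ⟦ 1 ℕ.≟ suc k ⟧
mult-ε {N} k = *-cancelˡ-≡ _ _ (suc k) (begin
  suc k * mult (ε {N}) k ≡⟨ cnt-mult perm-id k ⟨
  cnt (ε {N}) (suc k) ≡⟨ ∑-cong (L.allFin N) (λ i → cong (λ p → ⟦ p ℕ.≟ suc k ⟧) (len-fixed perm-id (lookup-id i))) ⟩
  ∑ᶠ {N} (λ _ → ⟦ 1 ℕ.≟ suc k ⟧) ≡⟨ ∑ᶠ-const {N} _ ⟩
  N * ⟦ 1 ℕ.≟ suc k ⟧ ≡⟨ cong (N *_) (trans (sym (*-identityˡ _)) (*-δ 1 (suc k))) ⟩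
  N * (suc k * ⟦ 1 ℕ.≟ suc k ⟧) ≡⟨ *-swapˡ N (suc k) _ ⟩
  suc k * (N * ⟦ 1 ℕ.≟ suc k ⟧) ∎)
  where open ≡-Reasoning

cyc-ε : 0 < N → cyc (ε {N}) ≡ N
cyc-ε {N} N>0 = trans (∑-cong (upTo N) mult-ε) (trans (∑-*ˡ (upTo N) N _)
  (trans (cong (N *_) (∑-δ⁺1 ≤-refl N>0)) (*-identityʳ N)))

cycleProduct-ε : cycleProduct (ε {N}) ≡ 1
cycleProduct-ε {N} = ∏-one (upTo N) λ { zero → ^-zeroˡ (mult (ε {N}) 0) ; (suc k) → cong (suc (suc k) ^_) (trans (mult-ε (suc k)) (*-zeroʳ N)) }

∑-δ1 : {p : ℕ} → p < N → ∑ (upTo N) (λ k → ⟦ p ℕ.≟ k ⟧) ≡ 1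
∑-δ1 {N} p<N = trans (∑-cong (upTo N) (λ k → sym (*-identityʳ _))) (∑-δ ℕ._≟_ (Unique.upTo⁺ N) (∈-upTo⁺ p<N) (λ _ → 1))

∑-applyUpTo : (g : ℕ → A) (n : ℕ) (f : A → ℕ) → ∑ (L.applyUpTo g n) f ≡ ∑ (upTo n) (f ∘ g)
∑-applyUpTo g zero    f = refl
∑-applyUpTo g (suc n) f = cong (f (g 0) +_) (trans (∑-applyUpTo (g ∘ suc) n f) (sym (∑-applyUpTo suc n (f ∘ g))))

∑-upTo-suc : (n : ℕ) (f : ℕ → ℕ) → ∑ (upTo (suc n)) f ≡ f 0 + ∑ (upTo n) (f ∘ suc)
∑-upTo-suc n f = cong (f 0 +_) (∑-applyUpTo suc n f)

∑-upTo-shift : (n : ℕ) (f : ℕ → ℕ) → ∑ (upTo n) (f ∘ suc) + f 0 ≡ ∑ (upTo n) f + f n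
∑-upTo-shift zero    f = refl
∑-upTo-shift (suc n) f = begin
  ∑ (upTo (suc n)) (f ∘ suc) + f 0 ≡⟨ cong (_+ f 0) (∑-upTo-suc n (f ∘ suc)) ⟩
  f 1 + ∑ (upTo n) (λ k → f (2 + k)) + f 0 ≡⟨ rotate (f 1) _ (f 0) ⟩
  f 0 + (∑ (upTo n) (λ k → f (2 + k)) + f 1) ≡⟨ cong (f 0 +_) (∑-upTo-shift n (f ∘ suc)) ⟩
  f 0 + (∑ (upTo n) (f ∘ suc) + f (suc n)) ≡⟨ +-assoc (f 0) _ _ ⟨
  f 0 + ∑ (upTo n) (f ∘ suc) + f (suc n) ≡⟨ cong (_+ f (suc n)) (∑-upTo-suc n f) ⟨
  ∑ (upTo (suc n)) f + f (suc n) ∎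
  where
  open ≡-Reasoning
  rotate : ∀ a b c → (a + b) + c ≡ c + (b + a)
  rotate = solve-∀

⟦⟧-≤ : {P : Set} (d : Dec P) {y : ℕ} → (P → 1 ≤ y) → ⟦ d ⟧ ≤ y
⟦⟧-≤ (yes p) f = f p
⟦⟧-≤ (no _)  f = z≤n

-- Number of σ supported in X with μ k cycles of length k + 1 inside X such that τ σ is a single cycle
-- on X; j counts the points outside X, which contribute j fixed points.
goodCount : Subset N → Word N → (ℕ → ℕ) → ℕ → ℕ
goodCount X τ μ j =
  ∑ᵖ (λ σ → ⟦ fixes? X σ ⟧ * (⟦ hasMult? σ (shift j μ) ⟧ * ⟦ cyc (τ ∙ σ) ℕ.≟ suc j ⟧))

factorials : ℕ → (ℕ → ℕ) → ℕ
factorials N μ = ∏ (upTo N) (λ k → μ k !)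

-- The tree situation inside `X`: `a + 1` cycles of `σ` and `b + 1` cycles of `τ` as vertices,
-- `q + 1` points as edges. The field `balance` says that there is one vertex more than there are
-- edges.
record Setup (X : Subset N) (τ : Word N) (μ : ℕ → ℕ) (q j a b : ℕ) : Set where
  field
    size-X  : size X ≡ suc q
    total   : suc q + j ≡ N
    perm-τ  : Perm τ
    fixes-τ : Fixes X τ
    support : ∀ k → N ≤ k → μ k ≡ 0
    parts   : ∑ (upTo N) μ ≡ suc a
    weight  : ∑ (upTo N) (λ k → suc k * μ k) ≡ suc q
    cycles  : cyc τ ≡ suc b + j
    balance : a + b ≡ q

GoodCount : Subset N → Word N → (ℕ → ℕ) → (j a b : ℕ) → Set
GoodCount {N} X τ μ j a b = goodCount X τ μ j * factorials N μ ≡ a ! * b ! * cycleProduct τ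

fixing-one : {X : Subset N} {σ : Word N} → size X ≡ 1 → Perm σ → Fixes X σ → σ ≡ ε
fixing-one {X = X} {σ} |X| pσ fix with x , x∈X ← size-suc X |X| = word-ext σ ε λ i → trans (go i) (sym (lookup-id i))
  where
  off : ∀ i → ¬ i ≡ x → lookup σ i ≡ i
  off i i≢x = fix i (trans (sym (remove-≢ X x i≢x))
    (size-zero (remove X x) (suc-injective (trans (sym (size-remove X x x∈X)) |X|)) i))
  go : ∀ i → lookup σ i ≡ i
  go i with i ≟ᶠ x
  ... | no i≢x   = off i i≢x
  ... | yes refl with lookup σ x ≟ᶠ x
  ...   | yes eq = eq
  -- A value `lookup σ x` other than `x` would itself be fixed, hence have two preimages.
  ...   | no neq = contradiction (injective pσ _ _ (off (lookup σ x) neq)) neq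

fixing-ε : {X : Subset N} → Fixes X ε
fixing-ε i _ = lookup-id i

goodCount-base : {X : Subset N} {τ : Word N} {μ : ℕ → ℕ} {j : ℕ} → Setup X τ μ 0 j 0 0 → GoodCount X τ μ j 0 0
goodCount-base {N} {X} {τ} {μ} {j} S = begin
  goodCount X τ μ j * factorials N μ ≡⟨ cong₂ _*_ only-ε (∏-one (upTo N) μ!≡1) ⟩
  (⟦ hasMult? (ε {N}) (shift j μ) ⟧ * ⟦ cyc (τ ∙ ε {N}) ℕ.≟ suc j ⟧) * 1
    ≡⟨ cong (_* 1) (cong₂ _*_ (⟦⟧-yes (hasMult? (ε {N}) (shift j μ)) ε-mult)
         (⟦⟧-yes (cyc (τ ∙ ε {N}) ℕ.≟ suc j) (trans (cong cyc (∙-identityʳ τ)) cycles))) ⟩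
  1 ≡⟨ cycleProduct-ε {N} ⟨
  cycleProduct (ε {N}) ≡⟨ cong cycleProduct (fixing-one size-X perm-τ fixes-τ) ⟨
  cycleProduct τ ≡⟨ +-identityʳ _ ⟨
  1 * cycleProduct τ ∎
  where
  open ≡-Reasoning
  open Setup S
  only-ε : goodCount X τ μ j ≡ ⟦ hasMult? (ε {N}) (shift j μ) ⟧ * ⟦ cyc (τ ∙ ε {N}) ℕ.≟ suc j ⟧
  only-ε = trans (∑ᵖ-cong (λ σ pσ → cong (_* (⟦ hasMult? σ (shift j μ) ⟧ * ⟦ cyc (τ ∙ σ) ℕ.≟ suc j ⟧))
    (⟦⟧-cong (fixes? X σ) (Finite.decEq (words N) ε σ) (λ fix → sym (fixing-one size-X pσ fix)) (λ { refl → fixing-ε {X = X} }))))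
    (∑ᵖ-δ perm-id (λ σ → ⟦ hasMult? σ (shift j μ) ⟧ * ⟦ cyc (τ ∙ σ) ℕ.≟ suc j ⟧))
  N>0 : 0 < N
  N>0 = subst (0 <_) total (s≤s z≤n)
  term : ∀ k → suc k * μ k ≤ 1
  term k with k <? N
  ... | yes k<N = subst (suc k * μ k ≤_) weight (∑-term≤ (λ k → suc k * μ k) (∈-upTo⁺ k<N))
  ... | no k≮N  = subst (_≤ 1) (sym (trans (cong (suc k *_) (support k (≮⇒≥ k≮N))) (*-zeroʳ (suc k)))) z≤n
  μ≤1 : ∀ k → μ k ≤ 1
  μ≤1 k = ≤-trans (m≤n*m (μ k) (suc k)) (term k)
  μ!≡1 : ∀ k → μ k ! ≡ 1
  μ!≡1 k with μ k | μ≤1 k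
  ... | 0 | _ = refl
  ... | 1 | _ = refl
  ... | suc (suc _) | s≤s ()
  μ0≡1 : μ 0 ≡ 1
  -- For one part of total weight one, `double≤` reads `2 ≤ 1 + μ 0`.
  μ0≡1 = ≤-antisym (μ≤1 0) (+-cancelˡ-≤ 1 _ _ (subst₂ _≤_ (cong (2 *_) parts) (cong (_+ μ 0) weight) (double≤ μ N>0)))
  μ-suc : ∀ k → μ (suc k) ≡ 0
  μ-suc k with μ (suc k) | term (suc k)
  ... | zero  | _ = refl
  ... | suc m | s≤s le = contradiction (≤-trans (m≤n+m (suc (m + k * suc m)) m) le) λ ()
  ε-mult : HasMult ε (shift j μ)
  ε-mult zero    _ = trans (mult-ε 0) (trans (*-identityʳ N) (trans (sym total) (cong (_+ j) (sym μ0≡1))))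
  ε-mult (suc k) _ = trans (mult-ε {N} (suc k)) (trans (*-zeroʳ N) (sym (μ-suc k)))

-- Splitting one point off a cycle of length k + 2 and forgetting it turns the cycle type μ into grown μ k.
grown : (ℕ → ℕ) → ℕ → ℕ → ℕ
grown μ k i = (μ i + ⟦ k ℕ.≟ i ⟧) ∸ ⟦ suc k ℕ.≟ i ⟧

grown-eq : (μ : ℕ → ℕ) (k : ℕ) → 0 < μ (suc k) → ∀ i → grown μ k i + ⟦ suc k ℕ.≟ i ⟧ ≡ μ i + ⟦ k ℕ.≟ i ⟧
grown-eq μ k pos i = m∸n+n≡m (⟦⟧-≤ (suc k ℕ.≟ i) (λ { refl → ≤-trans pos (m≤m+n (μ (suc k)) _) }))

-- Two factorials change: the one at `suc k` loses its top factor `μ (suc k)`, the one at `k` gains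
-- the factor `grown μ k k`.
grown-factorials : (N : ℕ) (μ : ℕ → ℕ) (k : ℕ) → 0 < μ (suc k) → suc k < N →
                   factorials N (grown μ k) * μ (suc k) ≡ factorials N μ * grown μ k k
grown-factorials N μ k pos k<N = begin
  factorials N ν * μ (suc k)
    ≡⟨ cong (factorials N ν *_) (∏-δ ℕ._≟_ (Unique.upTo⁺ N) (∈-upTo⁺ k<N) μ) ⟨
  factorials N ν * ∏ (upTo N) (λ i → μ i ^ ⟦ suc k ℕ.≟ i ⟧)
    ≡⟨ ∏-* (upTo N) (λ i → ν i !) _ ⟨
  ∏ (upTo N) (λ i → ν i ! * μ i ^ ⟦ suc k ℕ.≟ i ⟧)
    ≡⟨ ∏-cong (upTo N) each ⟩
  ∏ (upTo N) (λ i → μ i ! * ν i ^ ⟦ k ℕ.≟ i ⟧)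
    ≡⟨ ∏-* (upTo N) (λ i → μ i !) _ ⟩
  factorials N μ * ∏ (upTo N) (λ i → ν i ^ ⟦ k ℕ.≟ i ⟧)
    ≡⟨ cong (factorials N μ *_) (∏-δ ℕ._≟_ (Unique.upTo⁺ N) (∈-upTo⁺ (<-trans (n<1+n k) k<N)) ν) ⟩
  factorials N μ * ν k ∎
  where
  open ≡-Reasoning
  ν = grown μ k
  one-more : ∀ {m n} → m + 1 ≡ n → n ! * 1 ≡ m ! * (n * 1)
  one-more {m} refl = trans (*-identityʳ _) (trans (cong _! (+-comm m 1))
    (trans (*-comm (suc m) (m !)) (cong (m ! *_) (trans (+-comm 1 m) (sym (*-identityʳ _))))))
  cases : ∀ {m n} {P Q : Set} (d : Dec P) (e : Dec Q) → ¬ (P × Q) → m + ⟦ d ⟧ ≡ n + ⟦ e ⟧ →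
          m ! * n ^ ⟦ d ⟧ ≡ n ! * m ^ ⟦ e ⟧
  cases (yes p) (yes q) ¬pq _  = contradiction (p , q) ¬pq
  cases (yes _) (no _)  _   eq = sym (one-more (trans eq (+-identityʳ _)))
  cases (no _)  (yes _) _   eq = one-more (sym (trans (sym (+-identityʳ _)) eq))
  cases (no _)  (no _)  _   eq = cong (λ m → m ! * 1) (trans (sym (+-identityʳ _)) (trans eq (+-identityʳ _)))
  each : ∀ i → ν i ! * μ i ^ ⟦ suc k ℕ.≟ i ⟧ ≡ μ i ! * ν i ^ ⟦ k ℕ.≟ i ⟧
  each i = cases (suc k ℕ.≟ i) (k ℕ.≟ i) (λ { (refl , ()) }) (grown-eq μ k pos i)

∑-in : {X : Subset N} {σ : Word N} {q j : ℕ} → Perm σ → size X ≡ q → q + j ≡ N → Fixes X σ →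
       {ν : ℕ → ℕ} {k : ℕ} → k < N → HasMult σ (shift j ν) →
       ∑ᶠ (λ y → ⟦ in? X y ⟧ * ⟦ len σ y ℕ.≟ suc k ⟧) ≡ suc k * ν k
∑-in {N} {X} {σ} {q} {j} pσ |X| total fix {ν} {k} k<N has = +-cancelʳ-≡ (j * ⟦ 1 ℕ.≟ suc k ⟧) _ _ (begin
  inside + j * ⟦ 1 ℕ.≟ suc k ⟧
    ≡⟨ cong (inside +_) (trans (cong (_* ⟦ 1 ℕ.≟ suc k ⟧) (sym (size-complement X |X| total))) (sym (∑-*ʳ (L.allFin N) _ _))) ⟩
  inside + ∑ᶠ (λ y → ⟦ ¬? (in? X y) ⟧ * ⟦ 1 ℕ.≟ suc k ⟧)
    ≡⟨ ∑-+ (L.allFin N) _ _ ⟨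
  ∑ᶠ (λ y → ⟦ in? X y ⟧ * ⟦ len σ y ℕ.≟ suc k ⟧ + ⟦ ¬? (in? X y) ⟧ * ⟦ 1 ℕ.≟ suc k ⟧)
    ≡⟨ ∑-cong (L.allFin N) each ⟩
  cnt σ (suc k)
    ≡⟨ trans (cnt-mult pσ k) (cong (suc k *_) (has k k<N)) ⟩
  suc k * shift j ν k
    ≡⟨ expand k ⟩
  suc k * ν k + j * ⟦ 1 ℕ.≟ suc k ⟧ ∎)
  where
  open ≡-Reasoning
  inside = ∑ᶠ (λ y → ⟦ in? X y ⟧ * ⟦ len σ y ℕ.≟ suc k ⟧)
  expand : ∀ k → suc k * shift j ν k ≡ suc k * ν k + j * ⟦ 1 ℕ.≟ suc k ⟧
  expand zero    = trans (+-identityʳ _) (cong₂ _+_ (sym (+-identityʳ (ν 0))) (sym (*-identityʳ j)))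
  expand (suc k) = trans (sym (+-identityʳ _)) (cong (suc (suc k) * ν (suc k) +_) (sym (*-zeroʳ j)))
  each : ∀ y → ⟦ in? X y ⟧ * ⟦ len σ y ℕ.≟ suc k ⟧ + ⟦ ¬? (in? X y) ⟧ * ⟦ 1 ℕ.≟ suc k ⟧ ≡ ⟦ len σ y ℕ.≟ suc k ⟧
  each y with X y in e
  ... | true  = trans (+-identityʳ _) (+-identityʳ _)
  ... | false = trans (+-identityʳ _) (cong (λ p → ⟦ p ℕ.≟ suc k ⟧) (sym (len-fixed pσ (fix y e))))

-- Recursion at a fixed point of `τ`

module FixedPoint {X : Subset N} {q j : ℕ} (size-X : size X ≡ suc (suc q)) (total : suc (suc q) + j ≡ N)
                  {τ : Word N} (pτ : Perm τ) (τ-fix : Fixes X τ)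
                  {x : Fin N} (x∈X : X x ≡ true) (τx≡x : lookup τ x ≡ x) where

  X′ : Subset N
  X′ = remove X x

  size-X′ : size X′ ≡ suc q
  size-X′ = suc-injective (trans (sym (size-remove X x x∈X)) size-X)

  total′ : suc q + suc j ≡ N
  total′ = trans (+-suc (suc q) j) total

  τ-fix′ : Fixes X′ τ
  τ-fix′ = fixes-remove X x τ τ-fix τx≡x

  -- Deleting `x` from its cycle leaves a permutation supported in `X′`, and the predecessor `y` of
  -- `x` records where to put it back. Permutations that fix `x` have no such `y` in `X′`; on them
  -- `g` vanishes.
  insert-x : (g : Word N → ℕ) → (∀ σ → Perm σ → Fixes X σ → lookup σ x ≡ x → g σ ≡ 0) →
             ∑ᵖ (λ σ → ⟦ fixes? X σ ⟧ * g σ) ≡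
             ∑ᵖ (λ σ → ⟦ fixes? X′ σ ⟧ * ∑ᶠ (λ y → ⟦ in? X′ y ⟧ * g (σ ∙ swap x y)))
  insert-x g vanish = begin
    ∑ᵖ (λ σ → ⟦ fixes? X σ ⟧ * g σ)
      ≡⟨ ∑ᵖ-def _ ⟩
    ∑ (elems (words N)) (λ σ → ⟦ perm? σ ⟧ * (⟦ fixes? X σ ⟧ * g σ))
      ≡⟨ ∑-cong (elems (words N)) only-moved ⟩
    ∑ (elems (words N)) (λ σ → ⟦ moved? σ ⟧ * g σ)
      ≡⟨ ∑-reindex (words N) (pair (words N) (fin N)) moved? spread? φ ψ PQ QP ψφ φψ {g = λ (σ , y) → g (σ ∙ swap x y)} (λ σ p → cong g (sym (ψφ σ p))) ⟩
    ∑ (elems (pair (words N) (fin N))) (λ s → ⟦ spread? s ⟧ * g (proj₁ s ∙ swap x (proj₂ s)))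
      ≡⟨ ∑-pair (words N) (fin N) _ ⟩
    ∑ (elems (words N)) (λ σ → ∑ᶠ (λ y → ⟦ spread? (σ , y) ⟧ * g (σ ∙ swap x y)))
      ≡⟨ ∑-cong (elems (words N)) factor ⟩
    ∑ (elems (words N)) (λ σ → ⟦ perm? σ ⟧ * (⟦ fixes? X′ σ ⟧ * ∑ᶠ (λ y → ⟦ in? X′ y ⟧ * g (σ ∙ swap x y))))
      ≡⟨ ∑ᵖ-def _ ⟨
    ∑ᵖ (λ σ → ⟦ fixes? X′ σ ⟧ * ∑ᶠ (λ y → ⟦ in? X′ y ⟧ * g (σ ∙ swap x y))) ∎
    where
    open ≡-Reasoning
    Moved : Word N → Set
    Moved σ = (Perm σ × Fixes X σ) × ¬ lookup σ x ≡ x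
    moved? : ∀ σ → Dec (Moved σ)
    moved? σ = (perm? σ ×-dec fixes? X σ) ×-dec ¬? (lookup σ x ≟ᶠ x)
    Spread : Word N × Fin N → Set
    Spread (σ , y) = Perm σ × Fixes X′ σ × X′ y ≡ true
    spread? : ∀ s → Dec (Spread s)
    spread? (σ , y) = perm? σ ×-dec (fixes? X′ σ ×-dec in? X′ y)
    φ : Word N → Word N × Fin N
    φ σ = σ ∙ swap x (lookup (inv σ) x) , lookup (inv σ) x
    ψ : Word N × Fin N → Word N
    ψ (σ , y) = σ ∙ swap x y
    only-moved : ∀ σ → ⟦ perm? σ ⟧ * (⟦ fixes? X σ ⟧ * g σ) ≡ ⟦ moved? σ ⟧ * g σ
    only-moved σ = cases (perm? σ) (fixes? X σ) (lookup σ x ≟ᶠ x) (vanish σ)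
      where
      cases : ∀ {P Q R : Set} {m} (d : Dec P) (e : Dec Q) (f : Dec R) → (P → Q → R → m ≡ 0) →
              ⟦ d ⟧ * (⟦ e ⟧ * m) ≡ ⟦ (d ×-dec e) ×-dec ¬? f ⟧ * m
      cases (yes p) (yes q) (yes r) h = trans (+-identityʳ _) (trans (+-identityʳ _) (h p q r))
      cases (yes _) (yes _) (no _)  h = +-identityʳ _
      cases (yes _) (no _)  _       h = refl
      cases (no _)  _       _       h = refl
    PQ : ∀ σ → Moved σ → Spread (φ σ)
    PQ σ ((pσ , fix) , σx≢x) = perm-∙ pσ (perm-swap x y) , fix′ , trans (remove-≢ X x (x≢y ∘ sym)) y∈X
      where
      y = lookup (inv σ) x
      σy≡x : lookup σ y ≡ x
      σy≡x = lookup-inverseʳ pσ x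
      x≢y : ¬ x ≡ y
      x≢y eq = σx≢x (trans (cong (lookup σ) eq) σy≡x)
      y∈X : X y ≡ true
      y∈X with X y in e
      ... | true  = refl
      ... | false = contradiction (trans (sym σy≡x) (fix y e)) x≢y
      fix′ : Fixes X′ (σ ∙ swap x y)
      fix′ i i∉X′ with i ≟ᶠ x
      ... | yes refl = trans (lookup-∙-swap-x σ x y) σy≡x
      ... | no i≢x   = trans (lookup-∙-swap-≢ σ x y i≢x (λ { eq → true≢false y∈X (trans (cong X (sym eq)) i∉X′) })) (fix i i∉X′)
    QP : ∀ s → Spread s → Moved (ψ s)
    QP (σ , y) (pσ , fix , y∈X′) with remove-∈ X x {y} y∈X′
    ... | y≢x , y∈X = (perm-∙ pσ (perm-swap x y) , fix′) ,
        λ eq → y≢x (injective pσ _ _ (trans (sym (lookup-∙-swap-x σ x y)) (trans eq (sym (fixes-removed X x σ fix)))))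
      where
      fix′ : Fixes X (σ ∙ swap x y)
      fix′ i i∉X = trans (lookup-∙-swap-≢ σ x y (λ { refl → true≢false x∈X i∉X }) (λ { refl → true≢false y∈X i∉X }))
                         (fixes-superset X x σ x∈X fix i i∉X)
    ψφ : ∀ σ → Moved σ → ψ (φ σ) ≡ σ
    ψφ σ _ = ∙-swap-swap σ x _
    φψ : ∀ s → Spread s → φ (ψ s) ≡ s
    φψ (σ , y) (pσ , fix , _) = trans (cong (λ z → (σ ∙ swap x y) ∙ swap x z , z) inv-x) (cong (_, y) (∙-swap-swap σ x y))
      where
      inv-x : lookup (inv (σ ∙ swap x y)) x ≡ y
      inv-x = trans (cong (lookup (inv (σ ∙ swap x y)))
                      (sym (trans (lookup-∙ σ _ y) (trans (cong (lookup σ) (lookup-swap-y x y)) (fixes-removed X x σ fix)))))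
                    (lookup-inverseˡ (perm-∙ pσ (perm-swap x y)) y)
    factor : ∀ σ → ∑ᶠ (λ y → ⟦ spread? (σ , y) ⟧ * g (σ ∙ swap x y)) ≡
                   ⟦ perm? σ ⟧ * (⟦ fixes? X′ σ ⟧ * ∑ᶠ (λ y → ⟦ in? X′ y ⟧ * g (σ ∙ swap x y)))
    factor σ = trans (∑-cong (L.allFin N) (λ y → trans
        (cong (_* g (σ ∙ swap x y)) (trans (⟦⟧-× (perm? σ) (fixes? X′ σ ×-dec in? X′ y)) (cong (⟦ perm? σ ⟧ *_) (⟦⟧-× (fixes? X′ σ) (in? X′ y)))))
        (assoc ⟦ perm? σ ⟧ ⟦ fixes? X′ σ ⟧ ⟦ in? X′ y ⟧ (g (σ ∙ swap x y)))))
      (trans (∑-*ˡ (L.allFin N) ⟦ perm? σ ⟧ _) (cong (⟦ perm? σ ⟧ *_) (∑-*ˡ (L.allFin N) ⟦ fixes? X′ σ ⟧ _)))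
      where
      assoc : ∀ a b c d → a * (b * c) * d ≡ a * (b * (c * d))
      assoc = solve-∀

  -- The point `x` would be a cycle of the product by itself, besides the `j` points outside `X` and
  -- at least one cycle in `X′`.
  not-single : ∀ {σ} → Perm σ → Fixes X σ → lookup σ x ≡ x → ¬ cyc (τ ∙ σ) ≡ suc j
  not-single {σ} pσ fix σx≡x eq = <-irrefl (sym eq)
    (fixing-cyc (perm-∙ pτ pσ) X′ size-X′ total′ (fixing-∙ {X = X′} {τ} {σ} τ-fix′ (fixes-remove X x σ fix σx≡x)))

  cyc-insert-x : ∀ {σ y} → Perm σ → Fixes X′ σ → X′ y ≡ true → suc (cyc (τ ∙ (σ ∙ swap x y))) ≡ cyc (τ ∙ σ)
  cyc-insert-x {σ} {y} pσ fix y∈X′ = trans (cong (suc ∘ cyc) (sym (∙-assoc τ σ (swap x y))))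
    (cyc-merge (perm-∙ pτ pσ) (fixed-≁ {σ = τ ∙ σ} (trans (lookup-∙ τ σ x) (trans (cong (lookup τ) (fixes-removed X x σ fix)) τx≡x))
      (proj₁ (remove-∈ X x y∈X′) ∘ sym)))

  module _ (μ : ℕ → ℕ) where

    private
      Good : ℕ → Word N → ℕ
      Good k σ = ⟦ fixes? X′ σ ⟧ * (⟦ hasMult? σ (shift (suc j) (grown μ k)) ⟧ * ⟦ cyc (τ ∙ σ) ℕ.≟ suc (suc j) ⟧)

    -- Insertion merges the fixed point `x` with a cycle of length `k + 1` into one of length
    -- `k + 2`. The resulting type must therefore contain such a cycle, and the bracket for
    -- `0 <? μ (suc k)` also keeps the truncated subtraction in `grown` exact.
    type-insert-x : ∀ {σ y k} → Perm σ → Fixes X′ σ → X′ y ≡ true → len σ y ≡ suc k →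
                    ⟦ hasMult? (σ ∙ swap x y) (shift j μ) ⟧ ≡ ⟦ 0 <? μ (suc k) ⟧ * ⟦ hasMult? σ (shift (suc j) (grown μ k)) ⟧
    type-insert-x {σ} {y} {k} pσ fix y∈X′ len≡ = trans
      (⟦⟧-cong (hasMult? (σ ∙ swap x y) (shift j μ)) (0 <? μ (suc k) ×-dec hasMult? σ (shift (suc j) (grown μ k)))
        (λ h → pos h , λ i i<N → forward i (pos h) (h i i<N)) (λ (p , h) i i<N → backward i p (h i i<N)))
      (⟦⟧-× (0 <? μ (suc k)) (hasMult? σ (shift (suc j) (grown μ k))))
      where
      open ≡-Reasoning
      σ′ = σ ∙ swap x y
      σx≡x = fixes-removed X x σ fix
      x≁y : ¬ Reach σ x y
      x≁y = fixed-≁ {σ = σ} σx≡x (proj₁ (remove-∈ X x y∈X′) ∘ sym)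
      merge : ∀ i → mult σ′ i + (⟦ 1 ℕ.≟ suc i ⟧ + ⟦ k ℕ.≟ i ⟧) ≡ mult σ i + ⟦ suc k ℕ.≟ i ⟧
      merge i = subst₂ (λ p q → mult σ′ i + (⟦ p ℕ.≟ suc i ⟧ + ⟦ q ℕ.≟ suc i ⟧) ≡ mult σ i + ⟦ p + q ℕ.≟ suc i ⟧)
        (len-fixed pσ σx≡x) len≡ (mult-merge pσ x≁y i)
      1+k<N : suc k < N
      1+k<N = subst (_≤ N) (trans (len-merged pσ x≁y {x} (inj₁ reach-refl)) (cong₂ _+_ (len-fixed pσ σx≡x) len≡))
                (len≤N (perm-∙ pσ (perm-swap x y)) x)
      pos : HasMult σ′ (shift j μ) → 0 < μ (suc k)
      pos h = subst (0 <_) (begin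
        mult σ (suc k) + 1 ≡⟨ cong (mult σ (suc k) +_) (⟦⟧-yes (suc k ℕ.≟ suc k) refl) ⟨
        mult σ (suc k) + ⟦ suc k ℕ.≟ suc k ⟧ ≡⟨ merge (suc k) ⟨
        mult σ′ (suc k) + (0 + ⟦ k ℕ.≟ suc k ⟧) ≡⟨ cong₂ _+_ (h (suc k) 1+k<N) (⟦⟧-no (k ℕ.≟ suc k) (λ ())) ⟩
        μ (suc k) + 0 ≡⟨ +-identityʳ _ ⟩
        μ (suc k) ∎) (subst (0 <_) (+-comm 1 _) (s≤s z≤n))
      swap-ends : ∀ a b c → a + b + c ≡ a + c + b
      swap-ends = solve-∀
      ν = grown μ k
      target : ∀ i → 0 < μ (suc k) → shift (suc j) ν i + ⟦ suc k ℕ.≟ i ⟧ ≡ shift j μ i + (⟦ 1 ℕ.≟ suc i ⟧ + ⟦ k ℕ.≟ i ⟧)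
      target i p = begin
        shift (suc j) ν i + ⟦ suc k ℕ.≟ i ⟧ ≡⟨ cong (_+ ⟦ suc k ℕ.≟ i ⟧) (shift-δ j ν i) ⟩
        shift j ν i + ⟦ 1 ℕ.≟ suc i ⟧ + ⟦ suc k ℕ.≟ i ⟧ ≡⟨ swap-ends (shift j ν i) ⟦ 1 ℕ.≟ suc i ⟧ ⟦ suc k ℕ.≟ i ⟧ ⟩
        shift j ν i + ⟦ suc k ℕ.≟ i ⟧ + ⟦ 1 ℕ.≟ suc i ⟧ ≡⟨ cong (_+ ⟦ 1 ℕ.≟ suc i ⟧) (unshifted i) ⟩
        shift j μ i + ⟦ k ℕ.≟ i ⟧ + ⟦ 1 ℕ.≟ suc i ⟧ ≡⟨ trans (+-assoc (shift j μ i) _ _) (cong (shift j μ i +_) (+-comm ⟦ k ℕ.≟ i ⟧ _)) ⟩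
        shift j μ i + (⟦ 1 ℕ.≟ suc i ⟧ + ⟦ k ℕ.≟ i ⟧) ∎
        where
        unshifted : ∀ i → shift j ν i + ⟦ suc k ℕ.≟ i ⟧ ≡ shift j μ i + ⟦ k ℕ.≟ i ⟧
        unshifted zero    = trans (swap-ends (ν 0) j _) (trans (cong (_+ j) (grown-eq μ k p 0)) (swap-ends (μ 0) _ j))
        unshifted (suc i) = grown-eq μ k p (suc i)
      forward : ∀ i → 0 < μ (suc k) → mult σ′ i ≡ shift j μ i → mult σ i ≡ shift (suc j) ν i
      forward i p h = +-cancelʳ-≡ ⟦ suc k ℕ.≟ i ⟧ _ _ (trans (sym (merge i)) (trans (cong (_+ _) h) (sym (target i p))))
      backward : ∀ i → 0 < μ (suc k) → mult σ i ≡ shift (suc j) ν i → mult σ′ i ≡ shift j μ i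
      backward i p h = +-cancelʳ-≡ (⟦ 1 ℕ.≟ suc i ⟧ + ⟦ k ℕ.≟ i ⟧) _ _
        (trans (merge i) (trans (cong (_+ ⟦ suc k ℕ.≟ i ⟧) h) (target i p)))

    -- A permutation of type `grown μ k` on `X′` has `grown μ k k` cycles of length `k + 1`, hence
    -- `suc k * grown μ k k` points after which the insertion of `x` yields type `μ`.
    goodCount-insert : goodCount X τ μ j ≡
      ∑ (upTo N) (λ k → ⟦ 0 <? μ (suc k) ⟧ * (suc k * grown μ k k * goodCount X′ τ (grown μ k) (suc j)))
    goodCount-insert = begin
      goodCount X τ μ j
        ≡⟨ insert-x g (λ σ pσ fix σx≡x → trans (cong (⟦ hasMult? σ (shift j μ) ⟧ *_)
             (⟦⟧-no (cyc (τ ∙ σ) ℕ.≟ suc j) (not-single pσ fix σx≡x))) (*-zeroʳ ⟦ hasMult? σ (shift j μ) ⟧)) ⟩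
      ∑ᵖ (λ σ → ⟦ fixes? X′ σ ⟧ * ∑ᶠ (λ y → ⟦ in? X′ y ⟧ * g (σ ∙ swap x y)))
        ≡⟨ ∑ᵖ-cong (λ σ pσ → ⟦⟧-guard (fixes? X′ σ) (λ fix → per-σ pσ fix)) ⟩
      ∑ᵖ (λ σ → ⟦ fixes? X′ σ ⟧ * ∑ (upTo N) (λ k → H k σ * (suc k * grown μ k k)))
        ≡⟨ ∑ᵖ-cong (λ σ pσ → trans (sym (∑-*ˡ (upTo N) ⟦ fixes? X′ σ ⟧ _)) (∑-cong (upTo N) (λ k →
             rearrange ⟦ fixes? X′ σ ⟧ ⟦ 0 <? μ (suc k) ⟧ ⟦ hasMult? σ (shift (suc j) (grown μ k)) ⟧
                       ⟦ cyc (τ ∙ σ) ℕ.≟ suc (suc j) ⟧ (suc k * grown μ k k)))) ⟩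
      ∑ᵖ (λ σ → ∑ (upTo N) (λ k → ⟦ 0 <? μ (suc k) ⟧ * (suc k * grown μ k k * Good k σ)))
        ≡⟨ ∑ᵖ-∑ (upTo N) _ ⟩
      ∑ (upTo N) (λ k → ∑ᵖ (λ σ → ⟦ 0 <? μ (suc k) ⟧ * (suc k * grown μ k k * Good k σ)))
        ≡⟨ ∑-cong (upTo N) (λ k → trans (∑ᵖ-*ˡ ⟦ 0 <? μ (suc k) ⟧ (λ σ → suc k * grown μ k k * Good k σ))
             (cong (⟦ 0 <? μ (suc k) ⟧ *_) (∑ᵖ-*ˡ (suc k * grown μ k k) (Good k)))) ⟩
      ∑ (upTo N) (λ k → ⟦ 0 <? μ (suc k) ⟧ * (suc k * grown μ k k * goodCount X′ τ (grown μ k) (suc j))) ∎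
      where
      open ≡-Reasoning
      g : Word N → ℕ
      g σ = ⟦ hasMult? σ (shift j μ) ⟧ * ⟦ cyc (τ ∙ σ) ℕ.≟ suc j ⟧
      H : ℕ → Word N → ℕ
      H k σ = ⟦ 0 <? μ (suc k) ⟧ * (⟦ hasMult? σ (shift (suc j) (grown μ k)) ⟧ * ⟦ cyc (τ ∙ σ) ℕ.≟ suc (suc j) ⟧)
      rearrange : ∀ f p h c s → f * (p * (h * c) * s) ≡ p * (s * (f * (h * c)))
      rearrange = solve-∀
      move : ∀ a b c → a * (b * c) ≡ c * (a * b)
      move = solve-∀
      per-point : ∀ {σ y} → Perm σ → Fixes X′ σ → X′ y ≡ true →
                  g (σ ∙ swap x y) ≡ ∑ (upTo N) (λ k → ⟦ len σ y ℕ.≟ suc k ⟧ * H k σ)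
      per-point {σ} {y} pσ fix y∈X′ = trans (sym (∑-δ⁺ (len-positive pσ y) (len≤N pσ y) (λ _ → g (σ ∙ swap x y))))
        (∑-cong (upTo N) (λ k → ⟦⟧-guard (len σ y ℕ.≟ suc k) (λ len≡ →
          trans (cong₂ _*_ (type-insert-x pσ fix y∈X′ len≡)
                  (⟦⟧-cong (cyc (τ ∙ (σ ∙ swap x y)) ℕ.≟ suc j) (cyc (τ ∙ σ) ℕ.≟ suc (suc j))
                    (λ e → trans (sym (cyc-insert-x pσ fix y∈X′)) (cong suc e))
                    (λ e → suc-injective (trans (cyc-insert-x pσ fix y∈X′) e))))
                (*-assoc ⟦ 0 <? μ (suc k) ⟧ ⟦ hasMult? σ (shift (suc j) (grown μ k)) ⟧ _))))
      per-σ : ∀ {σ} → Perm σ → Fixes X′ σ → ∑ᶠ (λ y → ⟦ in? X′ y ⟧ * g (σ ∙ swap x y)) ≡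
              ∑ (upTo N) (λ k → H k σ * (suc k * grown μ k k))
      per-σ {σ} pσ fix = begin
        ∑ᶠ (λ y → ⟦ in? X′ y ⟧ * g (σ ∙ swap x y))
          ≡⟨ ∑-cong (L.allFin N) (λ y → trans (⟦⟧-guard (in? X′ y) (per-point pσ fix)) (sym (∑-*ˡ (upTo N) ⟦ in? X′ y ⟧ _))) ⟩
        ∑ᶠ (λ y → ∑ (upTo N) (λ k → ⟦ in? X′ y ⟧ * (⟦ len σ y ℕ.≟ suc k ⟧ * H k σ)))
          ≡⟨ ∑-swap (L.allFin N) (upTo N) _ ⟩
        ∑ (upTo N) (λ k → ∑ᶠ (λ y → ⟦ in? X′ y ⟧ * (⟦ len σ y ℕ.≟ suc k ⟧ * H k σ)))
          ≡⟨ ∑-cong-∈ (upTo N) (λ k k∈ → trans (∑-cong (L.allFin N) (λ y → move ⟦ in? X′ y ⟧ _ (H k σ)))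
               (trans (∑-*ˡ (L.allFin N) (H k σ) _) (restrict k (∈-upTo⁻ k∈)))) ⟩
        ∑ (upTo N) (λ k → H k σ * (suc k * grown μ k k)) ∎
        where
        restrict : ∀ k → k < N → H k σ * ∑ᶠ (λ y → ⟦ in? X′ y ⟧ * ⟦ len σ y ℕ.≟ suc k ⟧) ≡ H k σ * (suc k * grown μ k k)
        restrict k k<N = trans (shuffle p h c _) (trans
          (⟦⟧-guard (hasMult? σ (shift (suc j) (grown μ k))) (λ has → cong (λ m → p * c * m) (∑-in {X = X′} pσ size-X′ total′ fix k<N has)))
          (sym (shuffle p h c _)))
          where
          p = ⟦ 0 <? μ (suc k) ⟧
          h = ⟦ hasMult? σ (shift (suc j) (grown μ k)) ⟧
          c = ⟦ cyc (τ ∙ σ) ℕ.≟ suc (suc j) ⟧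
          shuffle : ∀ p h c m → p * (h * c) * m ≡ h * (p * c * m)
          shuffle = solve-∀

∑-weight-split : (n : ℕ) (f : ℕ → ℕ) → ∑ (upTo n) (λ k → suc k * f k) ≡ ∑ (upTo n) f + ∑ (upTo n) (λ k → k * f k)
∑-weight-split n f = ∑-+ (upTo n) f (λ k → k * f k)

∑-weight-δ : {p : ℕ} → p < N → ∑ (upTo N) (λ k → suc k * ⟦ p ℕ.≟ k ⟧) ≡ suc p
∑-weight-δ {N} p<N = trans (∑-cong (upTo N) (λ k → *-comm (suc k) _)) (∑-δ ℕ._≟_ (Unique.upTo⁺ N) (∈-upTo⁺ p<N) suc)

module _ {X : Subset N} {τ : Word N} {μ : ℕ → ℕ} {q j a b : ℕ} (S : Setup X τ μ (suc q) j a b) where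
  open Setup S

  private
    N>0 : 0 < N
    N>0 = subst (0 <_) total (s≤s z≤n)

  module _ {x : Fin N} (x∈X : X x ≡ true) (τx≡x : lookup τ x ≡ x)
           (ih : ∀ {μ′ b′} → Setup (remove X x) τ μ′ q (suc j) a b′ → GoodCount (remove X x) τ μ′ (suc j) a b′) where
    open FixedPoint size-X total perm-τ fixes-τ x∈X τx≡x

    private
      -- Inside `X` the permutation `τ` has the cycle of `x` and at least one cycle in `X′`.
      b-positive : ∃[ b′ ] b ≡ suc b′
      b-positive = go b cycles
        where
        go : ∀ b → cyc τ ≡ suc b + j → ∃[ b′ ] b ≡ suc b′
        go (suc b′) _ = b′ , refl
        go zero    eq = contradiction (fixing-cyc perm-τ X′ size-X′ total′ τ-fix′) (<-irrefl (sym eq))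

      b′ : ℕ
      b′ = proj₁ b-positive

      1+k<N : ∀ {k} → 0 < μ (suc k) → suc k < N
      1+k<N {k} pos with suc k <? N
      ... | yes lt = lt
      ... | no ≮   = contradiction pos (<-irrefl (sym (support (suc k) (≮⇒≥ ≮))))

      setup : ∀ {k} → 0 < μ (suc k) → Setup X′ τ (grown μ k) q (suc j) a b′
      setup {k} pos = record
        { size-X  = size-X′
        ; total   = total′
        ; perm-τ  = perm-τ
        ; fixes-τ = τ-fix′
        ; support = λ i N≤i → trans (cong₂ (λ m d → (m + d) ∸ ⟦ suc k ℕ.≟ i ⟧) (support i N≤i)
                      (⟦⟧-no (k ℕ.≟ i) (λ { refl → <⇒≱ k<N N≤i }))) (0∸n≡0 ⟦ suc k ℕ.≟ i ⟧)
        ; parts   = trans (+-cancelʳ-≡ 1 _ _ (begin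
            ∑ (upTo N) ν + 1 ≡⟨ cong (∑ (upTo N) ν +_) (∑-δ1 (1+k<N pos)) ⟨
            ∑ (upTo N) ν + ∑ (upTo N) (λ i → ⟦ suc k ℕ.≟ i ⟧) ≡⟨ ∑-+ (upTo N) ν _ ⟨
            ∑ (upTo N) (λ i → ν i + ⟦ suc k ℕ.≟ i ⟧) ≡⟨ ∑-cong (upTo N) (grown-eq μ k pos) ⟩
            ∑ (upTo N) (λ i → μ i + ⟦ k ℕ.≟ i ⟧) ≡⟨ ∑-+ (upTo N) μ _ ⟩
            ∑ (upTo N) μ + ∑ (upTo N) (λ i → ⟦ k ℕ.≟ i ⟧) ≡⟨ cong (∑ (upTo N) μ +_) (∑-δ1 k<N) ⟩
            ∑ (upTo N) μ + 1 ∎)) parts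
        ; weight  = +-cancelʳ-≡ (suc (suc k)) _ _ (begin
            w ν + suc (suc k) ≡⟨ cong (w ν +_) (∑-weight-δ (1+k<N pos)) ⟨
            w ν + w (λ i → ⟦ suc k ℕ.≟ i ⟧) ≡⟨ w-+ ν _ ⟨
            w (λ i → ν i + ⟦ suc k ℕ.≟ i ⟧) ≡⟨ ∑-cong (upTo N) (λ i → cong (suc i *_) (grown-eq μ k pos i)) ⟩
            w (λ i → μ i + ⟦ k ℕ.≟ i ⟧) ≡⟨ w-+ μ _ ⟩
            w μ + w (λ i → ⟦ k ℕ.≟ i ⟧) ≡⟨ cong₂ _+_ weight (∑-weight-δ k<N) ⟩
            suc (suc q) + suc k ≡⟨ +-suc (suc q) (suc k) ⟨
            suc q + suc (suc k) ∎)
        ; cycles  = trans cycles (trans (cong (λ m → suc m + j) (proj₂ b-positive)) (sym (+-suc (suc b′) j)))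
        ; balance = suc-injective (trans (sym (+-suc a b′)) (trans (cong (a +_) (sym (proj₂ b-positive))) balance))
        }
        where
        open ≡-Reasoning
        ν = grown μ k
        k<N : k < N
        k<N = <-trans (n<1+n k) (1+k<N pos)
        w : (ℕ → ℕ) → ℕ
        w f = ∑ (upTo N) (λ i → suc i * f i)
        w-+ : ∀ f g → w (λ i → f i + g i) ≡ w f + w g
        w-+ f g = trans (∑-cong (upTo N) (λ i → *-distribˡ-+ (suc i) (f i) (g i))) (∑-+ (upTo N) _ _)

      -- This sum is the weight minus the number of parts, which `balance` makes `b`: the factor
      -- that turns `b′ !` into `b !`.
      shifted-weight : ∑ (upTo N) (λ k → suc k * μ (suc k)) ≡ b
      shifted-weight = begin
        ∑ (upTo N) (λ k → suc k * μ (suc k)) ≡⟨ +-identityʳ _ ⟨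
        ∑ (upTo N) (λ k → suc k * μ (suc k)) + 0 ≡⟨ ∑-upTo-shift N (λ k → k * μ k) ⟩
        ∑ (upTo N) (λ k → k * μ k) + N * μ N ≡⟨ cong (∑ (upTo N) (λ k → k * μ k) +_) (trans (cong (N *_) (support N ≤-refl)) (*-zeroʳ N)) ⟩
        ∑ (upTo N) (λ k → k * μ k) + 0 ≡⟨ +-identityʳ _ ⟩
        ∑ (upTo N) (λ k → k * μ k) ≡⟨ +-cancelˡ-≡ (suc a) _ _ (trans (cong (_+ ∑ (upTo N) (λ k → k * μ k)) (sym parts))
                                                          (trans (sym (∑-weight-split N μ)) (trans weight (cong suc (sym balance))))) ⟩
        b ∎
        where open ≡-Reasoning

      each : ∀ k → ⟦ 0 <? μ (suc k) ⟧ * (suc k * grown μ k k * goodCount X′ τ (grown μ k) (suc j)) * factorials N μ ≡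
                   suc k * μ (suc k) * (a ! * b′ ! * cycleProduct τ)
      each k = go (0 <? μ (suc k))
        where
        D = goodCount X′ τ (grown μ k) (suc j)
        ν = grown μ k
        shuffle₁ : ∀ s v D F → (s * v * D + 0) * F ≡ s * D * (F * v)
        shuffle₁ = solve-∀
        shuffle₂ : ∀ s m D F → s * D * (F * m) ≡ s * m * (D * F)
        shuffle₂ = solve-∀
        go : (d : Dec (0 < μ (suc k))) → ⟦ d ⟧ * (suc k * ν k * D) * factorials N μ ≡ suc k * μ (suc k) * (a ! * b′ ! * cycleProduct τ)
        go (yes pos) = begin
          (suc k * ν k * D + 0) * factorials N μ ≡⟨ shuffle₁ (suc k) (ν k) D (factorials N μ) ⟩
          suc k * D * (factorials N μ * ν k) ≡⟨ cong (suc k * D *_) (grown-factorials N μ k pos (1+k<N pos)) ⟨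
          suc k * D * (factorials N ν * μ (suc k)) ≡⟨ shuffle₂ (suc k) (μ (suc k)) D (factorials N ν) ⟩
          suc k * μ (suc k) * (D * factorials N ν) ≡⟨ cong (suc k * μ (suc k) *_) (ih (setup pos)) ⟩
          suc k * μ (suc k) * (a ! * b′ ! * cycleProduct τ) ∎
          where open ≡-Reasoning
        go (no ¬pos) = sym (cong (_* (a ! * b′ ! * cycleProduct τ)) (trans (cong (suc k *_) (n≤0⇒n≡0 (≮⇒≥ ¬pos))) (*-zeroʳ (suc k))))

    -- Only `X` shrinks while `τ` stays, so `cycleProduct τ` is common to all terms and just the
    -- weights `suc k * μ (suc k)` are summed.
    goodCount-fixedPoint : GoodCount X τ μ j a b
    goodCount-fixedPoint = begin
      goodCount X τ μ j * factorials N μ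
        ≡⟨ cong (_* factorials N μ) (goodCount-insert μ) ⟩
      ∑ (upTo N) _ * factorials N μ
        ≡⟨ ∑-*ʳ (upTo N) _ (factorials N μ) ⟨
      ∑ (upTo N) (λ k → ⟦ 0 <? μ (suc k) ⟧ * (suc k * grown μ k k * goodCount X′ τ (grown μ k) (suc j)) * factorials N μ)
        ≡⟨ ∑-cong (upTo N) each ⟩
      ∑ (upTo N) (λ k → suc k * μ (suc k) * (a ! * b′ ! * cycleProduct τ))
        ≡⟨ ∑-*ʳ (upTo N) _ _ ⟩
      ∑ (upTo N) (λ k → suc k * μ (suc k)) * (a ! * b′ ! * cycleProduct τ)
        ≡⟨ cong (_* (a ! * b′ ! * cycleProduct τ)) (trans shifted-weight (proj₂ b-positive)) ⟩
      suc b′ * (a ! * b′ ! * cycleProduct τ)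
        ≡⟨ shuffle (suc b′) (a !) (b′ !) (cycleProduct τ) ⟩
      a ! * (suc b′) ! * cycleProduct τ
        ≡⟨ cong (λ m → a ! * m ! * cycleProduct τ) (proj₂ b-positive) ⟨
      a ! * b ! * cycleProduct τ ∎
      where
      open ≡-Reasoning
      shuffle : ∀ s f g p → s * (f * g * p) ≡ f * (s * g) * p
      shuffle = solve-∀

  module _ (deranged : ∀ {x} → X x ≡ true → ¬ lookup τ x ≡ x) where

    private
      τ-fixed-count : mult τ 0 ≡ j
      τ-fixed-count = begin
        mult τ 0 ≡⟨ +-identityʳ _ ⟨
        1 * mult τ 0 ≡⟨ cnt-mult perm-τ 0 ⟨
        cnt τ 1 ≡⟨ ∑-cong (L.allFin N) each ⟩
        ∑ᶠ (λ i → ⟦ ¬? (in? X i) ⟧) ≡⟨ size-complement X size-X total ⟩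
        j ∎
        where
        open ≡-Reasoning
        each : ∀ i → ⟦ len τ i ℕ.≟ 1 ⟧ ≡ ⟦ ¬? (in? X i) ⟧
        each i with X i in e
        ... | true  = ⟦⟧-no (len τ i ℕ.≟ 1) (λ eq → deranged e (fixed-len perm-τ eq))
        ... | false = ⟦⟧-yes (len τ i ℕ.≟ 1) (len-fixed perm-τ (fixes-τ i e))

    -- Without parts of size one on either side, all `|X| + 1` vertices would have degree at least
    -- two. But the degrees on each side add up to `|X|`.
    μ0-positive : 0 < μ 0
    μ0-positive with μ 0 in eq
    ... | suc _ = s≤s z≤n
    ... | zero  = contradiction (+-mono-≤ bound-μ bound-τ) (<⇒≱ (subst (Q + Q <_) (sym twice) (m<n+m (Q + Q) {2} (s≤s z≤n))))
      where
      Q = suc (suc q)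
      expand : ∀ a b → 2 * suc a + 2 * suc b ≡ 2 + (suc (a + b) + suc (a + b))
      expand = solve-∀
      twice : 2 * suc a + 2 * suc b ≡ 2 + (Q + Q)
      twice = trans (expand a b) (cong (λ m → 2 + (suc m + suc m)) balance)
      bound-μ : 2 * suc a ≤ suc (suc q)
      bound-μ = subst₂ _≤_ (cong (2 *_) parts) (trans (cong₂ _+_ weight eq) (+-identityʳ _)) (double≤ μ N>0)
      bound-τ : 2 * suc b ≤ suc (suc q)
      bound-τ = +-cancelʳ-≤ (2 * j) _ _ (subst₂ _≤_ (trans (cong (2 *_) cycles) (*-distribˡ-+ 2 (suc b) j))
        (trans (cong₂ _+_ (trans (∑-mult perm-τ) (sym total)) τ-fixed-count) (two-j (suc (suc q)) j)) (double≤ (mult τ) N>0))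
        where
        two-j : ∀ m j → m + j + j ≡ m + 2 * j
        two-j = solve-∀

-- Recursion at a fixed point of `σ`

decrement : (ℕ → ℕ) → ℕ → ℕ
decrement μ zero    = μ 0 ∸ 1
decrement μ (suc k) = μ (suc k)

decrement-δ : (μ : ℕ → ℕ) → 0 < μ 0 → ∀ k → μ k ≡ decrement μ k + ⟦ 0 ℕ.≟ k ⟧
decrement-δ μ pos zero    = sym (m∸n+n≡m pos)
decrement-δ μ pos (suc k) = sym (+-identityʳ _)

shift-decrement : (μ : ℕ → ℕ) (j : ℕ) → 0 < μ 0 → ∀ k → shift (suc j) (decrement μ) k ≡ shift j μ k
shift-decrement μ j pos zero    = trans (+-suc (μ 0 ∸ 1) j) (cong (_+ j) (trans (+-comm 1 (μ 0 ∸ 1)) (m∸n+n≡m pos)))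
shift-decrement μ j pos (suc k) = refl

decrement-factorials : (μ : ℕ → ℕ) → 0 < N → 0 < μ 0 → factorials N μ ≡ μ 0 * factorials N (decrement μ)
decrement-factorials {suc n} μ _ pos with μ 0
... | suc m = trans (cong (suc m * m ! *_) (tail (L.applyUpTo suc n) (positive n suc (λ _ → s≤s z≤n)))) (*-assoc (suc m) (m !) _)
  where
  positive : ∀ n (g : ℕ → ℕ) → (∀ i → 1 ≤ g i) → Allₗ (1 ≤_) (L.applyUpTo g n)
  positive zero    g h = []
  positive (suc n) g h = h 0 ∷ positive n (g ∘ suc) (h ∘ suc)
  tail : ∀ xs → Allₗ (1 ≤_) xs → ∏ xs (λ k → μ k !) ≡ ∏ xs (λ k → decrement μ k !)
  tail []           []       = refl
  tail (suc x ∷ xs) (_ ∷ ps) = cong (μ (suc x) ! *_) (tail xs ps)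

-- The shortcut past `x`: the predecessor of `x` goes straight to `lookup τ x`, and `x` becomes
-- fixed.
bypass : Word N → Fin N → Word N
bypass τ x = swap x (lookup τ x) ∙ τ

module Bypass {τ : Word N} (pτ : Perm τ) (x : Fin N) (τx≢x : ¬ lookup τ x ≡ x) where

  perm-bypass : Perm (bypass τ x)
  perm-bypass = perm-∙ (perm-swap x _) pτ

  bypass-x : lookup (bypass τ x) x ≡ x
  bypass-x = trans (lookup-∙ _ τ x) (lookup-swap-y x (lookup τ x))

  bypass-fixes : {X : Subset N} → Fixes X τ → X x ≡ true → Fixes (remove X x) (bypass τ x)
  bypass-fixes {X} fix x∈X = fixes-remove X x (bypass τ x) fix′ bypass-x
    where
    fix′ : Fixes X (bypass τ x)
    fix′ i i∉X = trans (lookup-∙ _ τ i) (trans (cong (lookup (swap x (lookup τ x))) (fix i i∉X))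
      (lookup-swap-≢ x (lookup τ x) i≢x (λ i≡τx → i≢x (injective pτ _ _ (trans (fix i i∉X) i≡τx)))))
      where
      i≢x : ¬ i ≡ x
      i≢x refl = true≢false x∈X i∉X

  private
    y = lookup τ x

  -- Left multiplication by a transposition at the fixed point x is an insertion of x.
  bypass-insert : {σ : Word N} → Perm σ → lookup σ x ≡ x →
                  ∃[ z ] ¬ x ≡ z × τ ∙ σ ≡ (bypass τ x ∙ σ) ∙ swap x z
  bypass-insert {σ} pσ σx≡x with z , ρz≡y ← perm-surjective (perm-∙ perm-bypass pσ) y = z , x≢z , sym (begin
    ρ ∙ swap x z ≡⟨ swap-push (perm-∙ perm-bypass pσ) x z ⟩
    swap (lookup ρ x) (lookup ρ z) ∙ ρ ≡⟨ cong₂ (λ u v → swap u v ∙ ρ) ρx≡x ρz≡y ⟩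
    swap x y ∙ ((swap x y ∙ τ) ∙ σ) ≡⟨ cong (swap x y ∙_) (∙-assoc (swap x y) τ σ) ⟩
    swap x y ∙ (swap x y ∙ (τ ∙ σ)) ≡⟨ swap-swap-∙ x y (τ ∙ σ) ⟩
    τ ∙ σ ∎)
    where
    open ≡-Reasoning
    ρ = bypass τ x ∙ σ
    ρx≡x : lookup ρ x ≡ x
    ρx≡x = trans (lookup-∙ _ σ x) (trans (cong (lookup (bypass τ x)) σx≡x) bypass-x)
    x≢z : ¬ x ≡ z
    x≢z refl = τx≢x (trans (sym ρz≡y) ρx≡x)

  cyc-bypass : {σ : Word N} → Perm σ → lookup σ x ≡ x → suc (cyc (τ ∙ σ)) ≡ cyc (bypass τ x ∙ σ)
  cyc-bypass {σ} pσ σx≡x with z , x≢z , eq ← bypass-insert pσ σx≡x = trans (cong (suc ∘ cyc) eq)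
    (cyc-merge (perm-∙ perm-bypass pσ) (fixed-≁ {σ = bypass τ x ∙ σ}
      (trans (lookup-∙ _ σ x) (trans (cong (lookup (bypass τ x)) σx≡x) bypass-x)) x≢z))

  cyc-bypass-ε : suc (cyc τ) ≡ cyc (bypass τ x)
  cyc-bypass-ε = trans (cong (suc ∘ cyc) (sym (∙-identityʳ τ))) (trans (cyc-bypass perm-id (lookup-id x)) (cong (cyc {N}) (∙-identityʳ (bypass τ x))))

  -- A cycle of length `p` is replaced by cycles of lengths `p - 1` and `1`.
  cycleProduct-bypass : cycleProduct τ * (len τ x ∸ 1) ≡ len τ x * cycleProduct (bypass τ x)
  cycleProduct-bypass with z , x≢z , eq ← bypass-insert perm-id (lookup-id x) = begin
    cycleProduct τ * (len τ x ∸ 1) ≡⟨ cong (λ m → cycleProduct τ * (m ∸ 1)) len-x ⟩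
    cycleProduct τ * len τ′ z ≡⟨ cong (cycleProduct τ *_) (trans (cong (_* len τ′ z) len-one) (*-identityˡ _)) ⟨
    cycleProduct τ * (len τ′ x * len τ′ z) ≡⟨ cong (λ ρ → cycleProduct ρ * (len τ′ x * len τ′ z)) τ≡ ⟩
    cycleProduct (τ′ ∙ swap x z) * (len τ′ x * len τ′ z) ≡⟨ cycleProduct-merge perm-bypass x≁z ⟩
    cycleProduct τ′ * (len τ′ x + len τ′ z) ≡⟨ cong (λ m → cycleProduct τ′ * (m + len τ′ z)) len-one ⟩
    cycleProduct τ′ * (1 + len τ′ z) ≡⟨ cong (cycleProduct τ′ *_) len-x ⟨
    cycleProduct τ′ * len τ x ≡⟨ *-comm (cycleProduct τ′) _ ⟩
    len τ x * cycleProduct τ′ ∎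
    where
    open ≡-Reasoning
    τ′ = bypass τ x
    τ≡ : τ ≡ τ′ ∙ swap x z
    τ≡ = trans (sym (∙-identityʳ τ)) (trans eq (cong (_∙ swap x z) (∙-identityʳ τ′)))
    x≁z : ¬ Reach τ′ x z
    x≁z = fixed-≁ {σ = τ′} bypass-x x≢z
    len-one : len τ′ x ≡ 1
    len-one = len-fixed perm-bypass bypass-x
    len-x : len τ x ≡ 1 + len τ′ z
    len-x = trans (cong (λ ρ → len ρ x) τ≡) (trans (len-merged perm-bypass x≁z (inj₁ reach-refl)) (cong (_+ len τ′ z) len-one))

module _ {X : Subset N} {τ : Word N} {μ : ℕ → ℕ} {q j a b : ℕ} (S : Setup X τ μ (suc q) j a b)
         (deranged : ∀ {x} → X x ≡ true → ¬ lookup τ x ≡ x)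
         (ih : ∀ {x τ′ μ′ a′} → Setup (remove X x) τ′ μ′ q (suc j) a′ b → GoodCount (remove X x) τ′ μ′ (suc j) a′ b) where
  open Setup S

  private
    N>0 : 0 < N
    N>0 = subst (0 <_) total (s≤s z≤n)

    pos : 0 < μ 0
    pos = μ0-positive S deranged

    μ′ : ℕ → ℕ
    μ′ = decrement μ

    weight′ : ∑ (upTo N) (λ k → suc k * μ′ k) ≡ suc q
    weight′ = +-cancelʳ-≡ 1 _ _ (begin
      ∑ (upTo N) (λ k → suc k * μ′ k) + 1
        ≡⟨ cong (∑ (upTo N) (λ k → suc k * μ′ k) +_) (∑-weight-δ N>0) ⟨
      ∑ (upTo N) (λ k → suc k * μ′ k) + ∑ (upTo N) (λ k → suc k * ⟦ 0 ℕ.≟ k ⟧)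
        ≡⟨ ∑-+ (upTo N) _ _ ⟨
      ∑ (upTo N) (λ k → suc k * μ′ k + suc k * ⟦ 0 ℕ.≟ k ⟧)
        ≡⟨ ∑-cong (upTo N) (λ k → trans (sym (*-distribˡ-+ (suc k) (μ′ k) _)) (cong (suc k *_) (sym (decrement-δ μ pos k)))) ⟩
      ∑ (upTo N) (λ k → suc k * μ k)
        ≡⟨ trans weight (+-comm 1 (suc q)) ⟩
      suc q + 1 ∎)
      where open ≡-Reasoning

    parts′ : ∑ (upTo N) μ′ ≡ a
    parts′ = +-cancelʳ-≡ 1 _ _ (begin
      ∑ (upTo N) μ′ + 1 ≡⟨ cong (∑ (upTo N) μ′ +_) (∑-δ1 N>0) ⟨
      ∑ (upTo N) μ′ + ∑ (upTo N) (λ k → ⟦ 0 ℕ.≟ k ⟧) ≡⟨ ∑-+ (upTo N) μ′ _ ⟨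
      ∑ (upTo N) (λ k → μ′ k + ⟦ 0 ℕ.≟ k ⟧) ≡⟨ ∑-cong (upTo N) (λ k → sym (decrement-δ μ pos k)) ⟩
      ∑ (upTo N) μ ≡⟨ trans parts (+-comm 1 a) ⟩
      a + 1 ∎)
      where open ≡-Reasoning

    -- The remaining parts carry the positive weight `suc q`, so at least one is left.
    a-positive : ∃[ a′ ] a ≡ suc a′
    a-positive = go a parts′
      where
      go : ∀ a → ∑ (upTo N) μ′ ≡ a → ∃[ a′ ] a ≡ suc a′
      go (suc a′) _ = a′ , refl
      go zero    eq = contradiction (trans (sym weight′) (trans (∑-cong-∈ (upTo N) (λ k k∈ →
        trans (cong (suc k *_) (n≤0⇒n≡0 (subst (μ′ k ≤_) eq (∑-term≤ μ′ k∈)))) (*-zeroʳ (suc k))))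
        (∑-zero (upTo N) {λ _ → 0} (λ _ → refl)))) λ ()

    a′ : ℕ
    a′ = proj₁ a-positive

    setup : ∀ {x} → X x ≡ true → Setup (remove X x) (bypass τ x) μ′ q (suc j) a′ b
    setup {x} x∈X = record
      { size-X  = suc-injective (trans (sym (size-remove X x x∈X)) size-X)
      ; total   = trans (+-suc (suc q) j) total
      ; perm-τ  = perm-bypass
      ; fixes-τ = bypass-fixes {X} fixes-τ x∈X
      ; support = support′
      ; parts   = trans parts′ (proj₂ a-positive)
      ; weight  = weight′
      ; cycles  = trans (sym cyc-bypass-ε) (trans (cong suc cycles) (sym (+-suc (suc b) j)))
      ; balance = suc-injective (trans (cong (_+ b) (sym (proj₂ a-positive))) balance)
      }
      where
      open Bypass perm-τ x (deranged x∈X)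
      support′ : ∀ k → N ≤ k → μ′ k ≡ 0
      support′ zero    N≤0 = contradiction N>0 (≤⇒≯ N≤0)
      support′ (suc k) N≤k = support (suc k) N≤k

    good : Word N → ℕ
    good σ = ⟦ fixes? X σ ⟧ * (⟦ hasMult? σ (shift j μ) ⟧ * ⟦ cyc (τ ∙ σ) ℕ.≟ suc j ⟧)

    -- A point fixed by `σ` is a leaf: its removal keeps `σ` and only shortens one cycle of `τ`. The
    -- product then has one cycle more, `x` itself, which moves to the outside.
    good-fixing : ∀ {x} → X x ≡ true → ∑ᵖ (λ σ → ⟦ lookup σ x ≟ᶠ x ⟧ * good σ) ≡ goodCount (remove X x) (bypass τ x) μ′ (suc j)
    good-fixing {x} x∈X = ∑ᵖ-cong λ σ pσ → begin
      ⟦ lookup σ x ≟ᶠ x ⟧ * (⟦ fixes? X σ ⟧ * rest σ)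
        ≡⟨ trans (sym (*-assoc ⟦ lookup σ x ≟ᶠ x ⟧ ⟦ fixes? X σ ⟧ (rest σ))) (cong (_* rest σ) (sym (⟦⟧-× (lookup σ x ≟ᶠ x) (fixes? X σ)))) ⟩
      ⟦ (lookup σ x ≟ᶠ x) ×-dec fixes? X σ ⟧ * rest σ
        ≡⟨ cong (_* rest σ) (⟦⟧-cong ((lookup σ x ≟ᶠ x) ×-dec fixes? X σ) (fixes? (remove X x) σ)
             (λ (σx≡x , fix) → fixes-remove X x σ fix σx≡x)
             (λ fix → fixes-removed X x σ fix , fixes-superset X x σ x∈X fix)) ⟩
      ⟦ fixes? (remove X x) σ ⟧ * rest σ
        ≡⟨ ⟦⟧-guard (fixes? (remove X x) σ) (λ fix → cong₂ _*_
             (⟦⟧-cong (hasMult? σ (shift j μ)) (hasMult? σ (shift (suc j) μ′))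
               (λ h k k<N → trans (h k k<N) (sym (shift-decrement μ j pos k)))
               (λ h k k<N → trans (h k k<N) (shift-decrement μ j pos k)))
             (⟦⟧-cong (cyc (τ ∙ σ) ℕ.≟ suc j) (cyc (bypass τ x ∙ σ) ℕ.≟ suc (suc j))
               (λ e → trans (sym (cyc-bypass pσ (fixes-removed X x σ fix))) (cong suc e))
               (λ e → suc-injective (trans (cyc-bypass pσ (fixes-removed X x σ fix)) e)))) ⟩
      ⟦ fixes? (remove X x) σ ⟧ * (⟦ hasMult? σ (shift (suc j) μ′) ⟧ * ⟦ cyc (bypass τ x ∙ σ) ℕ.≟ suc (suc j) ⟧) ∎
      where
      open ≡-Reasoning
      open Bypass perm-τ x (deranged x∈X)
      rest : Word N → ℕ
      rest σ = ⟦ hasMult? σ (shift j μ) ⟧ * ⟦ cyc (τ ∙ σ) ℕ.≟ suc j ⟧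

    fixed-in : ∀ {σ} → Perm σ → Fixes X σ → HasMult σ (shift j μ) → ∑ᶠ (λ x → ⟦ in? X x ⟧ * ⟦ lookup σ x ≟ᶠ x ⟧) ≡ μ 0
    fixed-in {σ} pσ fix has = begin
      ∑ᶠ (λ x → ⟦ in? X x ⟧ * ⟦ lookup σ x ≟ᶠ x ⟧)
        ≡⟨ ∑-cong (L.allFin N) (λ x → cong (⟦ in? X x ⟧ *_) (⟦⟧-cong (lookup σ x ≟ᶠ x) (len σ x ℕ.≟ 1) (len-fixed pσ) (fixed-len pσ))) ⟩
      ∑ᶠ (λ x → ⟦ in? X x ⟧ * ⟦ len σ x ℕ.≟ 1 ⟧)
        ≡⟨ ∑-in {X = X} pσ size-X total fix N>0 has ⟩
      1 * μ 0
        ≡⟨ *-identityˡ (μ 0) ⟩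
      μ 0 ∎
      where open ≡-Reasoning

    -- The fixed points depend on `σ`, so no leaf can be singled out beforehand. Instead the pairs
    -- of a good `σ` and one of its `μ 0` fixed points in `X` are counted.
    double-count : μ 0 * goodCount X τ μ j ≡ ∑ᶠ (λ x → ⟦ in? X x ⟧ * goodCount (remove X x) (bypass τ x) μ′ (suc j))
    double-count = begin
      μ 0 * goodCount X τ μ j
        ≡⟨ ∑ᵖ-*ˡ (μ 0) good ⟨
      ∑ᵖ (λ σ → μ 0 * good σ)
        ≡⟨ ∑ᵖ-cong count-fixed ⟩
      ∑ᵖ (λ σ → ∑ᶠ (λ x → ⟦ in? X x ⟧ * (⟦ lookup σ x ≟ᶠ x ⟧ * good σ)))
        ≡⟨ ∑ᵖ-∑ (L.allFin N) _ ⟩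
      ∑ᶠ (λ x → ∑ᵖ (λ σ → ⟦ in? X x ⟧ * (⟦ lookup σ x ≟ᶠ x ⟧ * good σ)))
        ≡⟨ ∑-cong (L.allFin N) (λ x → trans (∑ᵖ-*ˡ ⟦ in? X x ⟧ _) (⟦⟧-guard (in? X x) good-fixing)) ⟩
      ∑ᶠ (λ x → ⟦ in? X x ⟧ * goodCount (remove X x) (bypass τ x) μ′ (suc j)) ∎
      where
      open ≡-Reasoning
      shuffle : ∀ m f h c → m * (f * (h * c)) ≡ f * (h * (m * c))
      shuffle = solve-∀
      count-fixed : ∀ σ → Perm σ → μ 0 * good σ ≡ ∑ᶠ (λ x → ⟦ in? X x ⟧ * (⟦ lookup σ x ≟ᶠ x ⟧ * good σ))
      count-fixed σ pσ = begin
        μ 0 * (f * (h * c)) ≡⟨ shuffle (μ 0) f h c ⟩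
        f * (h * (μ 0 * c)) ≡⟨ ⟦⟧-guard (fixes? X σ) (λ fix → ⟦⟧-guard (hasMult? σ (shift j μ)) (λ has → cong (_* c) (fixed-in pσ fix has))) ⟨
        f * (h * (inside * c)) ≡⟨ shuffle inside f h c ⟨
        inside * good σ ≡⟨ ∑-*ʳ (L.allFin N) _ (good σ) ⟨
        ∑ᶠ (λ x → ⟦ in? X x ⟧ * ⟦ lookup σ x ≟ᶠ x ⟧ * good σ) ≡⟨ ∑-cong (L.allFin N) (λ x → *-assoc ⟦ in? X x ⟧ _ (good σ)) ⟩
        ∑ᶠ (λ x → ⟦ in? X x ⟧ * (⟦ lookup σ x ≟ᶠ x ⟧ * good σ)) ∎
        where
        f = ⟦ fixes? X σ ⟧
        h = ⟦ hasMult? σ (shift j μ) ⟧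
        c = ⟦ cyc (τ ∙ σ) ℕ.≟ suc j ⟧
        inside = ∑ᶠ (λ x → ⟦ in? X x ⟧ * ⟦ lookup σ x ≟ᶠ x ⟧)

    -- Bypassing a point of a cycle of length `p` multiplies the product by `(p - 1) / p`, so the
    -- cycle contributes `cycleProduct τ * (p - 1)` in all. The numbers `p - 1` add up to
    -- `N - cyc τ = a`.
    ∑-bypass : ∑ᶠ (λ x → ⟦ in? X x ⟧ * cycleProduct (bypass τ x)) ≡ cycleProduct τ * a
    ∑-bypass = begin
      ∑ᶠ (λ x → ⟦ in? X x ⟧ * cycleProduct (bypass τ x)) ≡⟨ ∑-cycles perm-τ _ (λ p → cycleProduct τ * (p ∸ 1)) (λ x → at x) ⟩
      ∑ (upTo N) (λ k → mult τ k * (cycleProduct τ * k)) ≡⟨ ∑-cong (upTo N) (λ k → shuffle (mult τ k) (cycleProduct τ) k) ⟩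
      ∑ (upTo N) (λ k → cycleProduct τ * (k * mult τ k)) ≡⟨ ∑-*ˡ (upTo N) (cycleProduct τ) _ ⟩
      cycleProduct τ * ∑ (upTo N) (λ k → k * mult τ k) ≡⟨ cong (cycleProduct τ *_) (+-cancelˡ-≡ (cyc τ) _ _ (begin
        cyc τ + ∑ (upTo N) (λ k → k * mult τ k) ≡⟨ ∑-weight-split N (mult τ) ⟨
        ∑ (upTo N) (λ k → suc k * mult τ k) ≡⟨ ∑-mult perm-τ ⟩
        N ≡⟨ total ⟨
        suc (suc q) + j ≡⟨ cong (λ m → suc m + j) balance ⟨
        suc (a + b) + j ≡⟨ regroup a b j ⟩
        suc b + j + a ≡⟨ cong (_+ a) cycles ⟨
        cyc τ + a ∎)) ⟩
      cycleProduct τ * a ∎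
      where
      open ≡-Reasoning
      shuffle : ∀ m c k → m * (c * k) ≡ c * (k * m)
      shuffle = solve-∀
      regroup : ∀ a b j → suc (a + b) + j ≡ suc b + j + a
      regroup = solve-∀
      at : ∀ x → len τ x * (⟦ in? X x ⟧ * cycleProduct (bypass τ x)) ≡ cycleProduct τ * (len τ x ∸ 1)
      at x with X x in e
      ... | true  = trans (cong (len τ x *_) (*-identityˡ _)) (sym (Bypass.cycleProduct-bypass perm-τ x (deranged e)))
      ... | false = trans (*-zeroʳ (len τ x)) (sym (trans (cong (λ p → cycleProduct τ * (p ∸ 1)) (len-fixed perm-τ (fixes-τ x e))) (*-zeroʳ (cycleProduct τ))))

  goodCount-deranged : GoodCount X τ μ j a b
  goodCount-deranged = begin
    goodCount X τ μ j * factorials N μ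
      ≡⟨ cong (goodCount X τ μ j *_) (decrement-factorials μ N>0 pos) ⟩
    goodCount X τ μ j * (μ 0 * F)
      ≡⟨ shuffle₁ (goodCount X τ μ j) (μ 0) F ⟩
    μ 0 * goodCount X τ μ j * F
      ≡⟨ cong (_* F) double-count ⟩
    ∑ᶠ (λ x → ⟦ in? X x ⟧ * goodCount (remove X x) (bypass τ x) μ′ (suc j)) * F
      ≡⟨ ∑-*ʳ (L.allFin N) _ F ⟨
    ∑ᶠ (λ x → ⟦ in? X x ⟧ * goodCount (remove X x) (bypass τ x) μ′ (suc j) * F)
      ≡⟨ ∑-cong (L.allFin N) (λ x → trans (*-assoc ⟦ in? X x ⟧ _ F) (trans (⟦⟧-guard (in? X x) (λ x∈X → ih (setup x∈X)))
           (*-swapˡ ⟦ in? X x ⟧ (a′ ! * b !) _))) ⟩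
    ∑ᶠ (λ x → a′ ! * b ! * (⟦ in? X x ⟧ * cycleProduct (bypass τ x)))
      ≡⟨ ∑-*ˡ (L.allFin N) (a′ ! * b !) _ ⟩
    a′ ! * b ! * ∑ᶠ (λ x → ⟦ in? X x ⟧ * cycleProduct (bypass τ x))
      ≡⟨ cong (a′ ! * b ! *_) ∑-bypass ⟩
    a′ ! * b ! * (cycleProduct τ * a)
      ≡⟨ cong (λ m → a′ ! * b ! * (cycleProduct τ * m)) (proj₂ a-positive) ⟩
    a′ ! * b ! * (cycleProduct τ * suc a′)
      ≡⟨ shuffle₂ (a′ !) (b !) (cycleProduct τ) (suc a′) ⟩
    (suc a′) ! * b ! * cycleProduct τ
      ≡⟨ cong (λ m → m ! * b ! * cycleProduct τ) (proj₂ a-positive) ⟨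
    a ! * b ! * cycleProduct τ ∎
    where
    open ≡-Reasoning
    F = factorials N μ′
    shuffle₁ : ∀ g m F → g * (m * F) ≡ m * g * F
    shuffle₁ = solve-∀
    shuffle₂ : ∀ f g p s → f * g * (p * s) ≡ s * f * g * p
    shuffle₂ = solve-∀

goodCount-formula : ∀ q {X : Subset N} {τ : Word N} {μ : ℕ → ℕ} {j a b} → Setup X τ μ q j a b → GoodCount X τ μ j a b
goodCount-formula zero {a = zero} {zero} S = goodCount-base S
goodCount-formula zero {a = zero} {suc b} S with () ← Setup.balance S
goodCount-formula zero {a = suc a} S with () ← Setup.balance S
goodCount-formula (suc q) {X} {τ} S with Fin.any? (λ x → in? X x ×-dec (lookup τ x ≟ᶠ x))
... | yes (x , x∈X , τx≡x) = goodCount-fixedPoint S x∈X τx≡x (goodCount-formula q)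
... | no none = goodCount-deranged S (λ {x} x∈X τx≡x → none (x , x∈X , τx≡x)) (goodCount-formula q)

-- Counting completions by number of cycles

mult-support : {σ : Word N} → Perm σ → ∀ k → N ≤ k → mult σ k ≡ 0
mult-support {N} {σ} pσ k N≤k = m*n≡0⇒n≡0 (trans (sym (cnt-mult pσ k))
  (∑-zero (L.allFin N) (λ i → ⟦⟧-no (len σ i ℕ.≟ suc k) (λ eq → <-irrefl refl (≤-trans (subst (_≤ N) eq (len≤N pσ i)) N≤k)))))
  where
  m*n≡0⇒n≡0 : ∀ {n} → suc k * n ≡ 0 → n ≡ 0
  m*n≡0⇒n≡0 {zero} _ = refl

-- The difference `N - cyc σ` is the total excess of the cycle lengths over one.
cyc-full : {σ : Word N} → Perm σ → cyc σ ≡ N → σ ≡ ε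
cyc-full {N} {σ} pσ eq = word-ext σ ε (λ i → trans (fixed-len pσ (len≡1 i)) (sym (lookup-id i)))
  where
  excess : ∑ (upTo N) (λ k → k * mult σ k) ≡ 0
  excess = +-cancelˡ-≡ (cyc σ) _ _ (trans (sym (∑-weight-split N (mult σ))) (trans (∑-mult pσ) (trans (sym eq) (sym (+-identityʳ _)))))
  len≡1 : ∀ i → len σ i ≡ 1
  len≡1 i with len σ i in e | len-positive pσ i | len≤N pσ i
  ... | suc zero    | _ | _  = refl
  ... | suc (suc k) | _ | le = contradiction
    (≤-trans (≤-trans (≤-reflexive (sym (⟦⟧-yes (len σ i ℕ.≟ suc (suc k)) e))) (∑-term≤ (λ i → ⟦ len σ i ℕ.≟ suc (suc k) ⟧) (∈-allFin i)))
             (≤-reflexive (trans (cnt-mult pσ (suc k)) (trans (cong (suc (suc k) *_) (n≤0⇒n≡0 (≤-trans (m≤n*m (mult σ (suc k)) (suc k))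
               (subst (suc k * mult σ (suc k) ≤_) excess (∑-term≤ (λ k → k * mult σ k) (∈-upTo⁺ le)))))) (*-zeroʳ (suc (suc k)))))))
    λ ()

rankCount : Subset N → Word N → (j a : ℕ) → ℕ
rankCount X τ j a = ∑ᵖ (λ σ → ⟦ fixes? X σ ⟧ * (⟦ cyc σ ℕ.≟ suc a + j ⟧ * ⟦ cyc (τ ∙ σ) ℕ.≟ suc j ⟧))

module _ {X : Subset N} {q j : ℕ} (size-X : size X ≡ suc q) (total : suc q + j ≡ N) where

  private
    -- The cycle type of `σ` on `X`, from which `shift j` recovers the one on all points.
    inner : Word N → ℕ → ℕ
    inner σ zero    = mult σ 0 ∸ j
    inner σ (suc k) = mult σ (suc k)

    shift-inner : ∀ {σ} → Perm σ → Fixes X σ → ∀ k → shift j (inner σ) k ≡ mult σ k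
    shift-inner pσ fix zero    = m∸n+n≡m (fixed-points≤ pσ X size-X total fix)
    shift-inner pσ fix (suc k) = refl

    N>0 : 0 < N
    N>0 = subst (0 <_) total (s≤s z≤n)

    inner-δ : ∀ {σ} → Perm σ → Fixes X σ → ∀ k → mult σ k ≡ inner σ k + ⟦ 0 ℕ.≟ k ⟧ * j
    inner-δ pσ fix zero    = trans (sym (shift-inner pσ fix 0)) (cong (inner _ 0 +_) (sym (+-identityʳ j)))
    inner-δ pσ fix (suc k) = sym (+-identityʳ _)

    inner-parts : ∀ {σ} → Perm σ → Fixes X σ → ∑ (upTo N) (inner σ) + j ≡ cyc σ
    inner-parts {σ} pσ fix = begin
      ∑ (upTo N) (inner σ) + j
        ≡⟨ cong (∑ (upTo N) (inner σ) +_) (∑-δ ℕ._≟_ (Unique.upTo⁺ N) (∈-upTo⁺ N>0) (λ _ → j)) ⟨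
      ∑ (upTo N) (inner σ) + ∑ (upTo N) (λ k → ⟦ 0 ℕ.≟ k ⟧ * j)
        ≡⟨ ∑-+ (upTo N) (inner σ) _ ⟨
      ∑ (upTo N) (λ k → inner σ k + ⟦ 0 ℕ.≟ k ⟧ * j)
        ≡⟨ ∑-cong (upTo N) (inner-δ pσ fix) ⟨
      cyc σ ∎
      where open ≡-Reasoning

    inner-weight : ∀ {σ} → Perm σ → Fixes X σ → ∑ (upTo N) (λ k → suc k * inner σ k) ≡ suc q
    inner-weight {σ} pσ fix = +-cancelʳ-≡ j _ _ (begin
      w + j
        ≡⟨ cong (w +_) (trans (∑-cong (upTo N) (λ k → *-swapˡ (suc k) ⟦ 0 ℕ.≟ k ⟧ j)) (trans (∑-δ ℕ._≟_ (Unique.upTo⁺ N) (∈-upTo⁺ N>0) (λ k → suc k * j)) (*-identityˡ j))) ⟨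
      w + ∑ (upTo N) (λ k → suc k * (⟦ 0 ℕ.≟ k ⟧ * j))
        ≡⟨ ∑-+ (upTo N) _ _ ⟨
      ∑ (upTo N) (λ k → suc k * inner σ k + suc k * (⟦ 0 ℕ.≟ k ⟧ * j))
        ≡⟨ ∑-cong (upTo N) (λ k → trans (cong (suc k *_) (inner-δ pσ fix k)) (*-distribˡ-+ (suc k) (inner σ k) _)) ⟨
      ∑ (upTo N) (λ k → suc k * mult σ k)
        ≡⟨ trans (∑-mult pσ) (sym total) ⟩
      suc q + j ∎)
      where
      open ≡-Reasoning
      w = ∑ (upTo N) (λ k → suc k * inner σ k)

    inner-support : ∀ {σ} → Perm σ → ∀ k → N ≤ k → inner σ k ≡ 0
    inner-support pσ zero    N≤0 = contradiction N>0 (≤⇒≯ N≤0)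
    inner-support pσ (suc k) N≤k = mult-support pσ (suc k) N≤k

    setup : ∀ {σ τ a b} → Perm σ → Fixes X σ → Perm τ → Fixes X τ → cyc σ ≡ suc a + j → cyc τ ≡ suc b + j → a + b ≡ q →
            Setup X τ (inner σ) q j a b
    setup {a = a} pσ σ-fix pτ τ-fix cσ cτ bal = record
      { size-X = size-X ; total = total ; perm-τ = pτ ; fixes-τ = τ-fix ; support = inner-support pσ
      ; parts = +-cancelʳ-≡ j _ _ (trans (inner-parts pσ σ-fix) cσ) ; weight = inner-weight pσ σ-fix
      ; cycles = cτ ; balance = bal }

    factors : Word N → ℕ
    factors σ = factorials N (inner σ)

  module _ {a b : ℕ} (balance : a + b ≡ q) where

    private
      chosen : Word N → Word N → ℕ
      chosen τ σ = ⟦ fixes? X σ ⟧ * (⟦ cyc σ ℕ.≟ suc a + j ⟧ * ⟦ cyc (τ ∙ σ) ℕ.≟ suc j ⟧)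

      twin : Word N → Word N → Word N → ℕ
      twin τ σ σ′ = ⟦ fixes? X σ′ ⟧ * (⟦ hasMult? σ′ (mult σ) ⟧ * ⟦ cyc (τ ∙ σ′) ℕ.≟ suc j ⟧)

      -- Counted in two ways: for each σ the number of σ′ of its cycle type is known, and vice versa.
      pairs : Word N → Word N → ℕ
      pairs τ τ′ = ∑ᵖ (λ σ → ∑ᵖ (λ σ′ → chosen τ σ * factors σ * twin τ′ σ σ′))

      pairs-eq : ∀ {τ τ′} → Perm τ′ → Fixes X τ′ → cyc τ′ ≡ suc b + j →
                 pairs τ τ′ ≡ rankCount X τ j a * (a ! * b ! * cycleProduct τ′)
      pairs-eq {τ} {τ′} pτ′ τ′-fix cτ′ = trans (∑ᵖ-cong (λ σ pσ → each σ pσ)) (∑ᵖ-*ʳ (chosen τ) _)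
        where
        open ≡-Reasoning
        value = a ! * b ! * cycleProduct τ′
        each : ∀ σ → Perm σ → ∑ᵖ (λ σ′ → chosen τ σ * factors σ * twin τ′ σ σ′) ≡ chosen τ σ * value
        each σ pσ = begin
          ∑ᵖ (λ σ′ → chosen τ σ * factors σ * twin τ′ σ σ′) ≡⟨ ∑ᵖ-*ˡ (chosen τ σ * factors σ) (twin τ′ σ) ⟩
          chosen τ σ * factors σ * ∑ᵖ (twin τ′ σ) ≡⟨ shuffle f c d (factors σ) (∑ᵖ (twin τ′ σ)) ⟩
          f * (c * (d * (∑ᵖ (twin τ′ σ) * factors σ))) ≡⟨ ⟦⟧-guard (fixes? X σ) (λ fix → ⟦⟧-guard (cyc σ ℕ.≟ suc a + j) (λ cσ → cong (d *_) (begin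
            ∑ᵖ (twin τ′ σ) * factors σ ≡⟨ cong (_* factors σ) (∑ᵖ-cong (λ σ′ _ → cong (λ m → ⟦ fixes? X σ′ ⟧ * (m * ⟦ cyc (τ′ ∙ σ′) ℕ.≟ suc j ⟧))
                                                                     (⟦⟧-cong (hasMult? σ′ (mult σ)) (hasMult? σ′ (shift j (inner σ)))
                                                                       (λ h k k<N → trans (h k k<N) (sym (shift-inner pσ fix k)))
                                                                       (λ h k k<N → trans (h k k<N) (shift-inner pσ fix k))))) ⟩
            goodCount X τ′ (inner σ) j * factors σ ≡⟨ goodCount-formula q (setup pσ fix pτ′ τ′-fix cσ cτ′ balance) ⟩
            value ∎))) ⟩
          f * (c * (d * value)) ≡⟨ unshuffle f c d value ⟩
          chosen τ σ * value ∎
          where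
          f = ⟦ fixes? X σ ⟧
          c = ⟦ cyc σ ℕ.≟ suc a + j ⟧
          d = ⟦ cyc (τ ∙ σ) ℕ.≟ suc j ⟧
          shuffle : ∀ f c d F t → f * (c * d) * F * t ≡ f * (c * (d * (t * F)))
          shuffle = solve-∀
          unshuffle : ∀ f c d v → f * (c * (d * v)) ≡ f * (c * d) * v
          unshuffle = solve-∀

      -- Having the same type is a symmetric relation, and both the number of cycles and the
      -- factorials depend on the type alone.
      pairs-swap : ∀ τ τ′ → pairs τ τ′ ≡ pairs τ′ τ
      pairs-swap τ τ′ = trans (∑ᵖ-∑ᵖ _) (∑ᵖ-cong (λ σ′ pσ′ → ∑ᵖ-cong (λ σ pσ → each σ σ′)))
        where
        shuffle₁ : ∀ f c d F f′ h d′ → f * (c * d) * F * (f′ * (h * d′)) ≡ h * (c * F * (f * d * (f′ * d′)))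
        shuffle₁ = solve-∀
        shuffle₂ : ∀ f c d F f′ h d′ → f * (c * d) * F * (f′ * (h * d′)) ≡ h * (c * F * (f′ * d′ * (f * d)))
        shuffle₂ = solve-∀
        same-cyc : ∀ {σ σ′} → HasMult σ′ (mult σ) → cyc σ′ ≡ cyc σ
        same-cyc h = ∑-cong-∈ (upTo N) (λ k k∈ → h k (∈-upTo⁻ k∈))
        same-factors : ∀ {σ σ′} → HasMult σ′ (mult σ) → factors σ ≡ factors σ′
        same-factors {σ} {σ′} h = ∏-cong-∈ (upTo N) (λ k k∈ → cong _! (same k (∈-upTo⁻ k∈)))
          where
          same : ∀ k → k < N → inner σ k ≡ inner σ′ k
          same zero    k<N = cong (_∸ j) (sym (h 0 k<N))
          same (suc k) k<N = sym (h (suc k) k<N)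
        each : ∀ σ σ′ → chosen τ σ * factors σ * twin τ′ σ σ′ ≡ chosen τ′ σ′ * factors σ′ * twin τ σ′ σ
        each σ σ′ = begin
          chosen τ σ * factors σ * twin τ′ σ σ′
            ≡⟨ shuffle₁ f ⟦ cyc σ ℕ.≟ suc a + j ⟧ d (factors σ) f′ ⟦ hasMult? σ′ (mult σ) ⟧ d′ ⟩
          ⟦ hasMult? σ′ (mult σ) ⟧ * (⟦ cyc σ ℕ.≟ suc a + j ⟧ * factors σ * (f * d * (f′ * d′)))
            ≡⟨ ⟦⟧-guard (hasMult? σ′ (mult σ)) (λ h → cong₂ (λ m F → ⟦ m ℕ.≟ suc a + j ⟧ * F * (f * d * (f′ * d′))) (sym (same-cyc {σ} {σ′} h)) (same-factors {σ} {σ′} h)) ⟩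
          ⟦ hasMult? σ′ (mult σ) ⟧ * (⟦ cyc σ′ ℕ.≟ suc a + j ⟧ * factors σ′ * (f * d * (f′ * d′)))
            ≡⟨ cong (_* (⟦ cyc σ′ ℕ.≟ suc a + j ⟧ * factors σ′ * (f * d * (f′ * d′)))) (⟦⟧-cong (hasMult? σ′ (mult σ)) (hasMult? σ (mult σ′))
                 (λ h k k<N → sym (h k k<N)) (λ h k k<N → sym (h k k<N))) ⟩
          ⟦ hasMult? σ (mult σ′) ⟧ * (⟦ cyc σ′ ℕ.≟ suc a + j ⟧ * factors σ′ * (f * d * (f′ * d′)))
            ≡⟨ shuffle₂ f′ ⟦ cyc σ′ ℕ.≟ suc a + j ⟧ d′ (factors σ′) f ⟦ hasMult? σ (mult σ′) ⟧ d ⟨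
          chosen τ′ σ′ * factors σ′ * twin τ σ′ σ ∎
          where
          open ≡-Reasoning
          f  = ⟦ fixes? X σ ⟧
          f′ = ⟦ fixes? X σ′ ⟧
          d  = ⟦ cyc (τ ∙ σ) ℕ.≟ suc j ⟧
          d′ = ⟦ cyc (τ′ ∙ σ′) ℕ.≟ suc j ⟧

    -- Weighted by the factorials of its type, every `σ` has the same number of twins completing
    -- `τ′`, namely `a ! * b ! * cycleProduct τ′`. This replaces a summation over all types with
    -- `a + 1` parts.
    rankCount-proportional : ∀ {τ τ′} → Perm τ → Fixes X τ → cyc τ ≡ suc b + j → Perm τ′ → Fixes X τ′ → cyc τ′ ≡ suc b + j →
                             rankCount X τ j a * cycleProduct τ′ ≡ rankCount X τ′ j a * cycleProduct τ
    rankCount-proportional {τ} {τ′} pτ τ-fix cτ pτ′ τ′-fix cτ′ = *-cancelˡ-≡ _ _ (a ! * b !) {{m*n≢0 (a !) (b !) {{a !≢0}} {{b !≢0}}}} (begin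
      a ! * b ! * (rankCount X τ j a * cycleProduct τ′) ≡⟨ *-swapˡ (a ! * b !) (rankCount X τ j a) _ ⟩
      rankCount X τ j a * (a ! * b ! * cycleProduct τ′) ≡⟨ pairs-eq pτ′ τ′-fix cτ′ ⟨
      pairs τ τ′ ≡⟨ pairs-swap τ τ′ ⟩
      pairs τ′ τ ≡⟨ pairs-eq pτ τ-fix cτ ⟩
      rankCount X τ′ j a * (a ! * b ! * cycleProduct τ) ≡⟨ *-swapˡ (a ! * b !) (rankCount X τ′ j a) _ ⟨
      a ! * b ! * (rankCount X τ′ j a * cycleProduct τ) ∎)
      where open ≡-Reasoning

  -- With `a = q` only `ε` has enough cycles, so a single type occurs and `goodCount-formula`
  -- applies directly; its factorial is `(suc q) !`.
  rankCount-ε : ∀ {τ} → Perm τ → Fixes X τ → cyc τ ≡ suc j → rankCount X τ j q * (suc q) ! ≡ q ! * cycleProduct τ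
  rankCount-ε {τ} pτ τ-fix cτ = begin
    rankCount X τ j q * (suc q) ! ≡⟨ cong₂ _*_ (∑ᵖ-cong (λ σ pσ → ⟦⟧-guard (fixes? X σ) (λ fix → cong (_* ⟦ cyc (τ ∙ σ) ℕ.≟ suc j ⟧) (types σ pσ)))) factors-ε ⟩
    goodCount X τ (inner ε) j * factors ε ≡⟨ goodCount-formula q (setup perm-id (fixing-ε {X = X}) pτ τ-fix (trans (cyc-ε N>0) (sym total)) cτ (+-identityʳ q)) ⟩
    q ! * 1 * cycleProduct τ ≡⟨ cong (_* cycleProduct τ) (*-identityʳ (q !)) ⟩
    q ! * cycleProduct τ ∎
    where
    open ≡-Reasoning
    types : ∀ σ → Perm σ → ⟦ cyc σ ℕ.≟ suc q + j ⟧ ≡ ⟦ hasMult? σ (shift j (inner ε)) ⟧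
    types σ pσ = ⟦⟧-cong (cyc σ ℕ.≟ suc q + j) (hasMult? σ (shift j (inner ε)))
      (λ c k k<N → trans (cong (λ ρ → mult ρ k) (cyc-full pσ (trans c total))) (sym (shift-inner perm-id (fixing-ε {X = X}) k)))
      (λ h → trans (∑-cong-∈ (upTo N) (λ k k∈ → trans (h k (∈-upTo⁻ k∈)) (shift-inner perm-id (fixing-ε {X = X}) k))) (trans (cyc-ε N>0) (sym total)))
    ε-parts : ∀ k → inner ε k ! ≡ ((suc q) !) ^ ⟦ 0 ℕ.≟ k ⟧
    ε-parts zero    = trans (cong _! (trans (cong (_∸ j) (trans (mult-ε 0) (trans (*-identityʳ N) (sym total)))) (m+n∸n≡m (suc q) j))) (sym (*-identityʳ _))
    ε-parts (suc k) = cong _! (trans (mult-ε {N} (suc k)) (*-zeroʳ N))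
    factors-ε : (suc q) ! ≡ factors ε
    factors-ε = sym (trans (∏-cong (upTo N) ε-parts) (∏-δ ℕ._≟_ (Unique.upTo⁺ N) (∈-upTo⁺ N>0) (λ _ → (suc q) !)))

∃-perm : ∀ q {X : Subset N} {j c : ℕ} → size X ≡ suc q → suc q + j ≡ N → c ≤ q →
         ∃[ τ ] (Perm τ × Fixes X τ × cyc τ ≡ suc c + j)
∃-perm zero {X} {j} {zero} |X| total _ =
  ε , perm-id , fixing-ε {X = X} , trans (cyc-ε (subst (0 <_) total (s≤s z≤n))) (sym total)
∃-perm (suc q) {X} {j} {c} |X| total c≤q with x , x∈X ← size-suc X |X| = go c c≤q
  where
  X′ = remove X x
  size-X′ : size X′ ≡ suc q
  size-X′ = suc-injective (trans (sym (size-remove X x x∈X)) |X|)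
  total′ : suc q + suc j ≡ _
  total′ = trans (+-suc (suc q) j) total
  go : ∀ c → c ≤ suc q → ∃[ τ ] (Perm τ × Fixes X τ × cyc τ ≡ suc c + j)
  go (suc c) (s≤s c≤q) with τ , pτ , fix , cτ ← ∃-perm q {X′} {suc j} {c} size-X′ total′ c≤q =
    τ , pτ , fixes-superset X x τ x∈X fix , trans cτ (+-suc (suc c) j)
  go zero _ with τ , pτ , fix , cτ ← ∃-perm q {X′} {suc j} {0} size-X′ total′ z≤n
               | y , y∈X′ ← size-suc X′ size-X′
               with y≢x , y∈X ← remove-∈ X x {y} y∈X′ =
    τ ∙ swap x y , perm-∙ pτ (perm-swap x y) ,
    (λ i i∉X → trans (lookup-∙-swap-≢ τ x y (λ { refl → true≢false x∈X i∉X }) (λ { refl → true≢false y∈X i∉X }))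
                     (fixes-superset X x τ x∈X fix i i∉X)) ,
    suc-injective (trans (cyc-merge pτ (fixed-≁ {σ = τ} (fixes-removed X x τ fix) (y≢x ∘ sym))) cτ)

cycleProduct-positive : (τ : Word N) → 0 < cycleProduct τ
cycleProduct-positive {N} τ = ∏-pos (upTo N) (λ k → m^n>0 (suc k) (mult τ k))

-- Proportionality reduces the claim to one `τ₀` that fixes a point `x`. Since cycle lengths of `σ`
-- are not prescribed, `x` can be inserted at any point of `remove X x`, which gives a one-term
-- recursion.
rankCount-formula : ∀ q {X : Subset N} {τ : Word N} {j a b : ℕ} → size X ≡ suc q → suc q + j ≡ N → Perm τ → Fixes X τ →
                    cyc τ ≡ suc b + j → a + b ≡ q → rankCount X τ j a * (suc a) ! ≡ q ! * cycleProduct τ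
rankCount-formula q {X} {τ} {j} {a} {zero} |X| total pτ τ-fix cτ balance with refl ← trans (sym (+-identityʳ a)) balance =
  rankCount-ε {X = X} |X| total pτ τ-fix cτ
rankCount-formula zero {a = a} {suc b} _ _ _ _ _ balance with () ← trans (sym balance) (+-suc a b)
rankCount-formula {N} (suc q) {X} {τ} {j} {a} {suc b} |X| total pτ τ-fix cτ balance
  with x , x∈X ← size-suc X |X|
  -- Supported in `remove X x`, the witness fixes `x`; the cycle `x` makes its `b + 1` cycles into
  -- `b + 2` on `X`.
  with τ₀ , pτ₀ , fix₀ , cτ₀ ← ∃-perm q {remove X x} {suc j} {b} (suc-injective (trans (sym (size-remove X x x∈X)) |X|)) (trans (+-suc (suc q) j) total)
         (≤-trans (m≤n+m b a) (≤-reflexive (suc-injective (trans (sym (+-suc a b)) balance)))) =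
  *-cancelˡ-≡ _ _ (cycleProduct τ₀) {{>-nonZero (cycleProduct-positive τ₀)}} (begin
    cycleProduct τ₀ * (rankCount X τ j a * (suc a) !) ≡⟨ shuffle₁ (cycleProduct τ₀) (rankCount X τ j a) _ ⟩
    rankCount X τ j a * cycleProduct τ₀ * (suc a) ! ≡⟨ cong (_* (suc a) !) (rankCount-proportional {X = X} |X| total balance pτ τ-fix cτ pτ₀ τ₀-fix (trans cτ₀ (+-suc (suc b) j))) ⟩
    rankCount X τ₀ j a * cycleProduct τ * (suc a) ! ≡⟨ shuffle₂ (rankCount X τ₀ j a) (cycleProduct τ) _ ⟩
    cycleProduct τ * (rankCount X τ₀ j a * (suc a) !) ≡⟨ cong (cycleProduct τ *_) at-τ₀ ⟩
    cycleProduct τ * ((suc q) ! * cycleProduct τ₀) ≡⟨ shuffle₃ (cycleProduct τ) ((suc q) !) (cycleProduct τ₀) ⟩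
    cycleProduct τ₀ * ((suc q) ! * cycleProduct τ) ∎)
  where
  open ≡-Reasoning
  open FixedPoint |X| total pτ₀ (fixes-superset X x τ₀ x∈X fix₀) x∈X (fixes-removed X x τ₀ fix₀)
  τ₀-fix = fixes-superset X x τ₀ x∈X fix₀
  shuffle₁ : ∀ p r f → p * (r * f) ≡ r * p * f
  shuffle₁ = solve-∀
  shuffle₂ : ∀ r p f → r * p * f ≡ p * (r * f)
  shuffle₂ = solve-∀
  shuffle₃ : ∀ p f p₀ → p * (f * p₀) ≡ p₀ * (f * p)
  shuffle₃ = solve-∀
  g : Word N → ℕ
  g σ = ⟦ cyc σ ℕ.≟ suc a + j ⟧ * ⟦ cyc (τ₀ ∙ σ) ℕ.≟ suc j ⟧
  G : Word N → ℕ
  G σ = ⟦ cyc σ ℕ.≟ suc a + suc j ⟧ * ⟦ cyc (τ₀ ∙ σ) ℕ.≟ suc (suc j) ⟧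
  g-insert : ∀ {σ y} → Perm σ → Fixes X′ σ → X′ y ≡ true → g (σ ∙ swap x y) ≡ G σ
  g-insert {σ} {y} pσ fix y∈X′ = cong₂ _*_
    (⟦⟧-cong (cyc (σ ∙ swap x y) ℕ.≟ suc a + j) (cyc σ ℕ.≟ suc a + suc j)
      (λ e → trans (sym merge) (trans (cong suc e) (sym (+-suc (suc a) j))))
      (λ e → suc-injective (trans merge (trans e (+-suc (suc a) j)))))
    (⟦⟧-cong (cyc (τ₀ ∙ (σ ∙ swap x y)) ℕ.≟ suc j) (cyc (τ₀ ∙ σ) ℕ.≟ suc (suc j))
      (λ e → trans (sym (cyc-insert-x pσ fix y∈X′)) (cong suc e))
      (λ e → suc-injective (trans (cyc-insert-x pσ fix y∈X′) e)))
    where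
    merge : suc (cyc (σ ∙ swap x y)) ≡ cyc σ
    merge = cyc-merge pσ (fixed-≁ {σ = σ} (fixes-removed X x σ fix) (proj₁ (remove-∈ X x y∈X′) ∘ sym))
  recursion : rankCount X τ₀ j a ≡ suc q * rankCount X′ τ₀ (suc j) a
  recursion = begin
    rankCount X τ₀ j a
      ≡⟨ insert-x g (λ σ pσ fix σx≡x → trans (cong (⟦ cyc σ ℕ.≟ suc a + j ⟧ *_) (⟦⟧-no (cyc (τ₀ ∙ σ) ℕ.≟ suc j) (not-single pσ fix σx≡x))) (*-zeroʳ ⟦ cyc σ ℕ.≟ suc a + j ⟧)) ⟩
    ∑ᵖ (λ σ → ⟦ fixes? X′ σ ⟧ * ∑ᶠ (λ y → ⟦ in? X′ y ⟧ * g (σ ∙ swap x y)))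
      ≡⟨ ∑ᵖ-cong (λ σ pσ → ⟦⟧-guard (fixes? X′ σ) (λ fix → trans
           (∑-cong (L.allFin N) (λ y → ⟦⟧-guard (in? X′ y) (g-insert pσ fix)))
           (trans (∑-*ʳ (L.allFin N) _ (G σ)) (cong (_* G σ) size-X′)))) ⟩
    ∑ᵖ (λ σ → ⟦ fixes? X′ σ ⟧ * (suc q * G σ))
      ≡⟨ ∑ᵖ-cong (λ σ _ → *-swapˡ ⟦ fixes? X′ σ ⟧ (suc q) (G σ)) ⟩
    ∑ᵖ (λ σ → suc q * (⟦ fixes? X′ σ ⟧ * G σ))
      ≡⟨ ∑ᵖ-*ˡ (suc q) (λ σ → ⟦ fixes? X′ σ ⟧ * G σ) ⟩
    suc q * rankCount X′ τ₀ (suc j) a ∎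
  at-τ₀ : rankCount X τ₀ j a * (suc a) ! ≡ (suc q) ! * cycleProduct τ₀
  at-τ₀ = begin
    rankCount X τ₀ j a * (suc a) ! ≡⟨ cong (_* (suc a) !) recursion ⟩
    suc q * rankCount X′ τ₀ (suc j) a * (suc a) ! ≡⟨ *-assoc (suc q) (rankCount X′ τ₀ (suc j) a) ((suc a) !) ⟩
    suc q * (rankCount X′ τ₀ (suc j) a * (suc a) !) ≡⟨ cong (suc q *_) (rankCount-formula q {X′} {τ₀} {suc j} {a} {b} size-X′ total′ pτ₀ fix₀ cτ₀
                                                               (suc-injective (trans (sym (+-suc a b)) balance))) ⟩
    suc q * (q ! * cycleProduct τ₀) ≡⟨ *-assoc (suc q) (q !) _ ⟨
    (suc q) ! * cycleProduct τ₀ ∎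

-- Completions by transpositions

χ : Word N → ℕ
χ ρ = ⟦ cyc ρ ℕ.≟ 1 ⟧

-- Ordered pairs are summed, so each transposition counts twice; hence the base `2 * suc N` of the
-- powers below.
E : (Word N → ℕ) → Word N → ℕ
E {N} g π = ∑ᶠ (λ x → ∑ᶠ (λ y → ⟦ ¬? (x ≟ᶠ y) ⟧ * g (π ∙ swap x y)))

-- Up to a factor 2ᵐ, the number of ways to multiply π by m transpositions so that it becomes a single cycle.
h : ℕ → Word N → ℕ
h zero    = χ
h (suc m) = E (h m)

W : Word N → ℕ
W τ = (cyc τ ∸ 1) ! * cycleProduct τ

E-cong : {g g′ : Word N → ℕ} {π : Word N} → (∀ x y → ¬ x ≡ y → g (π ∙ swap x y) ≡ g′ (π ∙ swap x y)) → E g π ≡ E g′ π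
E-cong {N} eq = ∑-cong (L.allFin N) (λ x → ∑-cong (L.allFin N) (λ y → ⟦⟧-guard (¬? (x ≟ᶠ y)) (eq x y)))

E-*ˡ : (c : ℕ) (g : Word N → ℕ) (π : Word N) → E (λ ρ → c * g ρ) π ≡ c * E g π
E-*ˡ {N} c g π = trans (∑-cong (L.allFin N) (λ x → trans
  (∑-cong (L.allFin N) (λ y → *-swapˡ ⟦ ¬? (x ≟ᶠ y) ⟧ c _)) (∑-*ˡ (L.allFin N) c _))) (∑-*ˡ (L.allFin N) c _)

E-zero : {g : Word N → ℕ} {π : Word N} → (∀ x y → ¬ x ≡ y → g (π ∙ swap x y) ≡ 0) → E g π ≡ 0
E-zero {N} eq = ∑-zero (L.allFin N) (λ x → ∑-zero (L.allFin N) (λ y →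
  trans (⟦⟧-guard (¬? (x ≟ᶠ y)) (eq x y)) (*-zeroʳ ⟦ ¬? (x ≟ᶠ y) ⟧)))

-- By `cyc-swap`, `m` transpositions remove at most `m` cycles.
h-zero : ∀ m {π : Word N} → Perm π → suc m < cyc π → h m π ≡ 0
h-zero zero    {π} pπ lt = ⟦⟧-no (cyc π ℕ.≟ 1) (λ eq → <-irrefl (sym eq) lt)
h-zero (suc m) {π} pπ lt = E-zero {g = h m} {π} (λ x y _ → h-zero m (perm-∙ pπ (perm-swap x y)) (s≤s⁻¹ (≤-trans lt (cyc-swap pπ x y))))

-- Read off from `rankCount-ε`: the only completion with `suc N` cycles is `ε`, so the count there
-- is one.
cycleProduct-single : {π : Word (suc N)} → Perm π → cyc π ≡ 1 → cycleProduct π ≡ suc N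
cycleProduct-single {N} {π} pπ c = *-cancelˡ-≡ _ _ (N !) {{N !≢0}} (begin
  N ! * cycleProduct π ≡⟨ rankCount-ε {X = X} {N} {0} size-X (+-identityʳ (suc N)) pπ (λ i ()) c ⟨
  rankCount X π 0 N * (suc N) ! ≡⟨ cong (_* (suc N) !) count≡1 ⟩
  1 * (suc N) ! ≡⟨ trans (*-identityˡ _) (*-comm (suc N) (N !)) ⟩
  N ! * suc N ∎)
  where
  open ≡-Reasoning
  X : Subset (suc N)
  X _ = true
  size-X : size X ≡ suc N
  size-X = trans (∑ᶠ-const {suc N} 1) (*-identityʳ (suc N))
  count≡1 : rankCount X π 0 N ≡ 1
  count≡1 = trans (∑ᵖ-cong (λ σ pσ → begin
      ⟦ fixes? X σ ⟧ * (⟦ cyc σ ℕ.≟ suc N + 0 ⟧ * ⟦ cyc (π ∙ σ) ℕ.≟ 1 ⟧)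
        ≡⟨ trans (cong (_* (⟦ cyc σ ℕ.≟ suc N + 0 ⟧ * ⟦ cyc (π ∙ σ) ℕ.≟ 1 ⟧)) (⟦⟧-yes (fixes? X σ) (λ i ()))) (*-identityˡ _) ⟩
      ⟦ cyc σ ℕ.≟ suc N + 0 ⟧ * ⟦ cyc (π ∙ σ) ℕ.≟ 1 ⟧
        ≡⟨ cong (_* ⟦ cyc (π ∙ σ) ℕ.≟ 1 ⟧) (⟦⟧-cong (cyc σ ℕ.≟ suc N + 0) (Finite.decEq (words (suc N)) ε σ)
             (λ e → sym (cyc-full pσ (trans e (+-identityʳ (suc N))))) (λ { refl → trans (cyc-ε {suc N} (s≤s z≤n)) (sym (+-identityʳ (suc N))) })) ⟩
      ⟦ Finite.decEq (words (suc N)) ε σ ⟧ * ⟦ cyc (π ∙ σ) ℕ.≟ 1 ⟧ ∎))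
    (trans (∑ᵖ-δ perm-id (λ σ → ⟦ cyc (π ∙ σ) ℕ.≟ 1 ⟧)) (⟦⟧-yes (cyc (π ∙ ε) ℕ.≟ 1) (trans (cong (cyc {suc N}) (∙-identityʳ π)) c)))

module _ {π : Word N} (pπ : Perm π) where

  private
    P = cycleProduct π
    M = cyc π

    merged : Fin N → Fin N → ℕ
    merged x y = ⟦ ¬? (reach? pπ x y) ⟧ * cycleProduct (π ∙ swap x y)

  -- Let `p = len π x`. Each of the `q` points of another cycle yields the product
  -- `P * (p + q) / (p * q)`, so after multiplication by `p` that cycle contributes `P * (p + q)`.
  -- The right side sums this over all `M` cycles; `2 * P * p` is the term of the cycle of `x`,
  -- which does not merge.
  ∑-merged-x : ∀ x → len π x * ∑ᶠ (merged x) + 2 * P * len π x ≡ P * (len π x * M + N)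
  ∑-merged-x x = begin
    px * ∑ᶠ (merged x) + 2 * P * px
      ≡⟨ cong₂ _+_ (∑-*ˡ (L.allFin N) px (merged x)) (trans (∑-*ˡ (L.allFin N) (2 * P) _) (cong (2 * P *_) (len-∑ pπ x))) ⟨
    ∑ᶠ (λ y → px * merged x y) + ∑ᶠ (λ y → 2 * P * ⟦ reach? pπ x y ⟧)
      ≡⟨ ∑-+ (L.allFin N) _ _ ⟨
    ∑ᶠ (λ y → px * merged x y + 2 * P * ⟦ reach? pπ x y ⟧)
      ≡⟨ ∑-cycles pπ _ (λ p → P * (px + p)) at ⟩
    ∑ (upTo N) (λ k → mult π k * (P * (px + suc k)))
      ≡⟨ ∑-cong (upTo N) (λ k → expand (mult π k) P px (suc k)) ⟩
    ∑ (upTo N) (λ k → P * (px * mult π k + suc k * mult π k))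
      ≡⟨ trans (∑-*ˡ (upTo N) P _) (cong (P *_) (trans (∑-+ (upTo N) _ _) (cong₂ _+_ (∑-*ˡ (upTo N) px (mult π)) (∑-mult pπ)))) ⟩
    P * (px * M + N) ∎
    where
    open ≡-Reasoning
    px = len π x
    expand : ∀ m p l s → m * (p * (l + s)) ≡ p * (l * m + s * m)
    expand = solve-∀
    apart : ∀ p q c → p * (q * (1 * c) + 2 * P * 0) ≡ c * (q * p)
    apart p q c = trans (cong (p *_) (trans (cong₂ _+_ (cong (q *_) (*-identityˡ c)) (*-zeroʳ (2 * P))) (+-identityʳ _))) (reverse p q c)
      where
      reverse : ∀ p q c → p * (q * c) ≡ c * (q * p)
      reverse = solve-∀
    together : ∀ p q P → p * (q * 0 + 2 * P * 1) ≡ P * (p + p)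
    together p q P = trans (cong (p *_) (cong₂ _+_ (*-zeroʳ q) (*-identityʳ (2 * P)))) (double p P)
      where
      double : ∀ p P → p * (0 + 2 * P) ≡ P * (p + p)
      double = solve-∀
    at : ∀ y → len π y * (px * merged x y + 2 * P * ⟦ reach? pπ x y ⟧) ≡ P * (px + len π y)
    at y with reach? pπ x y
    ... | yes r = trans (together (len π y) px P) (cong (λ p → P * (p + len π y)) (sym (len-reach pπ r)))
    ... | no ¬r = trans (apart (len π y) px _) (cycleProduct-merge pπ ¬r)

  -- The source of the eigenvalue: `suc m` turns `m !` into `(suc m) !`, as `W` requires, and
  -- `2 * N` remains.
  ∑-merged : ∀ m → M ≡ suc (suc m) → ∑ᶠ (λ x → ∑ᶠ (merged x)) ≡ P * (N * (2 * suc m))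
  ∑-merged m M≡ = begin
    ∑ᶠ (λ x → ∑ᶠ (merged x)) ≡⟨ ∑-cycles pπ _ (λ p → P * (p * m + N)) at ⟩
    ∑ (upTo N) (λ k → mult π k * (P * (suc k * m + N))) ≡⟨ ∑-cong (upTo N) (λ k → expand (mult π k) P (suc k) m N) ⟩
    ∑ (upTo N) (λ k → P * (m * (suc k * mult π k) + N * mult π k))
      ≡⟨ trans (∑-*ˡ (upTo N) P _) (cong (P *_) (trans (∑-+ (upTo N) _ _)
           (cong₂ _+_ (trans (∑-*ˡ (upTo N) m _) (cong (m *_) (∑-mult pπ))) (trans (∑-*ˡ (upTo N) N _) (cong (N *_) M≡))))) ⟩
    P * (m * N + N * suc (suc m)) ≡⟨ cong (P *_) (collect m N) ⟩
    P * (N * (2 * suc m)) ∎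
    where
    open ≡-Reasoning
    expand : ∀ u P s m N → u * (P * (s * m + N)) ≡ P * (m * (s * u) + N * u)
    expand = solve-∀
    collect : ∀ m N → m * N + N * suc (suc m) ≡ N * (2 * suc m)
    collect = solve-∀
    unfold : ∀ P p m N → P * (p * suc (suc m) + N) ≡ P * (p * m + N) + 2 * P * p
    unfold = solve-∀
    at : ∀ x → len π x * ∑ᶠ (merged x) ≡ P * (len π x * m + N)
    at x = +-cancelʳ-≡ (2 * P * len π x) _ _ (trans (∑-merged-x x)
      (trans (cong (λ M → P * (len π x * M + N)) M≡) (unfold P (len π x) m N)))

h-W : ∀ m {π : Word (suc N)} → Perm π → cyc π ≡ suc m → suc N * h m π ≡ (2 * suc N) ^ m * W π
h-W {N} zero {π} pπ c = begin
  suc N * h 0 π ≡⟨ cong (suc N *_) (⟦⟧-yes (cyc π ℕ.≟ 1) c) ⟩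
  suc N * 1 ≡⟨ *-identityʳ (suc N) ⟩
  suc N ≡⟨ cycleProduct-single pπ c ⟨
  cycleProduct π ≡⟨ *-identityˡ _ ⟨
  1 * cycleProduct π ≡⟨ cong (λ m → (m ∸ 1) ! * cycleProduct π) c ⟨
  W π ≡⟨ *-identityˡ _ ⟨
  1 * W π ∎
  where open ≡-Reasoning
h-W {N} (suc m) {π} pπ c = begin
  suc N * h (suc m) π
    ≡⟨ trans (sym (∑-*ˡ (L.allFin (suc N)) (suc N) _)) (∑-cong (L.allFin (suc N)) (λ x → sym (∑-*ˡ (L.allFin (suc N)) (suc N) _))) ⟩
  ∑ᶠ (λ x → ∑ᶠ (λ y → suc N * (⟦ ¬? (x ≟ᶠ y) ⟧ * h m (π ∙ swap x y))))
    ≡⟨ ∑-cong (L.allFin (suc N)) (λ x → trans (∑-cong (L.allFin (suc N)) (λ y → each x y)) (∑-*ˡ (L.allFin (suc N)) (D ^ m * m !) _)) ⟩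
  ∑ᶠ (λ x → D ^ m * m ! * ∑ᶠ (λ y → ⟦ ¬? (reach? pπ x y) ⟧ * cycleProduct (π ∙ swap x y)))
    ≡⟨ trans (∑-*ˡ (L.allFin (suc N)) (D ^ m * m !) _) (cong (D ^ m * m ! *_) (∑-merged pπ m c)) ⟩
  D ^ m * m ! * (P * (suc N * (2 * suc m)))
    ≡⟨ shuffle (D ^ m) (m !) P (suc N) (suc m) ⟩
  D * D ^ m * (suc m * m ! * P)
    ≡⟨ cong (λ M → D ^ suc m * ((M ∸ 1) ! * P)) c ⟨
  D ^ suc m * W π ∎
  where
  open ≡-Reasoning
  D = 2 * suc N
  P = cycleProduct π
  shuffle : ∀ d f p s k → d * f * (p * (s * (2 * k))) ≡ 2 * s * d * (k * f * p)
  shuffle = solve-∀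
  each : ∀ x y → suc N * (⟦ ¬? (x ≟ᶠ y) ⟧ * h m (π ∙ swap x y)) ≡
                 D ^ m * m ! * (⟦ ¬? (reach? pπ x y) ⟧ * cycleProduct (π ∙ swap x y))
  each x y with reach? pπ x y
  -- A transposition inside one cycle does not lower the number of cycles, and the remaining `m` are
  -- too few.
  ... | yes r = trans (cong (suc N *_) (trans (⟦⟧-guard (¬? (x ≟ᶠ y)) (λ _ → h-zero m (perm-∙ pπ (perm-swap x y))
                  (≤-trans (≤-reflexive (sym c)) (cyc-swap-within pπ r)))) (*-zeroʳ ⟦ ¬? (x ≟ᶠ y) ⟧)))
                  (trans (*-zeroʳ (suc N)) (sym (*-zeroʳ (D ^ m * m !))))
  ... | no ¬r = begin
    suc N * (⟦ ¬? (x ≟ᶠ y) ⟧ * h m σ) ≡⟨ cong (λ d → suc N * (d * h m σ)) (⟦⟧-yes (¬? (x ≟ᶠ y)) (λ { refl → ¬r reach-refl })) ⟩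
    suc N * (1 * h m σ) ≡⟨ cong (suc N *_) (*-identityˡ _) ⟩
    suc N * h m σ ≡⟨ h-W m (perm-∙ pπ (perm-swap x y)) cσ ⟩
    D ^ m * W σ ≡⟨ cong (λ M → D ^ m * ((M ∸ 1) ! * cycleProduct σ)) cσ ⟩
    D ^ m * (m ! * cycleProduct σ) ≡⟨ *-assoc (D ^ m) (m !) _ ⟨
    D ^ m * m ! * cycleProduct σ ≡⟨ cong (D ^ m * m ! *_) (*-identityˡ _) ⟨
    D ^ m * m ! * (1 * cycleProduct σ) ∎
    where
    σ = π ∙ swap x y
    cσ : cyc σ ≡ suc m
    cσ = suc-injective (trans (cyc-merge pπ ¬r) c)

-- The triangle inequality for the length `N - cyc`: each induction step costs `σ` exactly one cycle
-- and the product at most one.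
cyc-subadditive : {π σ : Word N} → 0 < N → Perm π → Perm σ → cyc π + cyc σ ≤ N + cyc (π ∙ σ)
cyc-subadditive {N} {π} N>0 pπ = perm-induction (λ σ → cyc π + cyc σ ≤ N + cyc (π ∙ σ)) base step
  where
  base : cyc π + cyc (ε {N}) ≤ N + cyc (π ∙ ε)
  base = ≤-reflexive (trans (+-comm (cyc π) _) (cong₂ _+_ (cyc-ε N>0) (cong (cyc {N}) (sym (∙-identityʳ π)))))
  step : ∀ {σ x y} → Perm σ → lookup σ x ≡ x → ¬ x ≡ y → cyc π + cyc σ ≤ N + cyc (π ∙ σ) →
         cyc π + cyc (σ ∙ swap x y) ≤ N + cyc (π ∙ (σ ∙ swap x y))
  step {σ} {x} {y} pσ fix x≢y ih = s≤s⁻¹ (begin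
    suc (cyc π + cyc (σ ∙ swap x y)) ≡⟨ +-suc (cyc π) _ ⟨
    cyc π + suc (cyc (σ ∙ swap x y)) ≡⟨ cong (cyc π +_) (cyc-merge pσ (fixed-≁ {σ = σ} fix x≢y)) ⟩
    cyc π + cyc σ ≤⟨ ih ⟩
    N + cyc (π ∙ σ) ≤⟨ +-monoʳ-≤ N (cyc-swap (perm-∙ pπ pσ) x y) ⟩
    N + suc (cyc (π ∙ σ ∙ swap x y)) ≡⟨ trans (+-suc N _) (cong (λ ρ → suc (N + cyc ρ)) (∙-assoc π σ (swap x y))) ⟩
    suc (N + cyc (π ∙ (σ ∙ swap x y))) ∎)
    where open ≤-Reasoning

-- Class operators

act : (Word N → ℕ) → (Word N → ℕ) → Word N → ℕ
act w g π = ∑ᵖ (λ σ → w σ * g (π ∙ σ))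

Invariant : (Word N → ℕ) → Set
Invariant {N} w = ∀ {γ σ : Word N} → Perm γ → Perm σ → w (conj γ σ) ≡ w σ

-- Operators on functions of a permutation. Besides `ext`, which restricts attention to
-- permutations, the laws are those by which `χ` is split into indicators of single cycles and these
-- are compared under conjugation.
record Op (N : ℕ) : Set where
  field
    apply       : (Word N → ℕ) → Word N → ℕ
    ext         : ∀ {g g′ π} → Perm π → (∀ {ρ} → Perm ρ → g ρ ≡ g′ ρ) → apply g π ≡ apply g′ π
    linear      : ∀ (f : Word N → ℕ) (g : Word N → Word N → ℕ) π →
                  apply (λ ρ → ∑ᵖ (λ c → f c * g c ρ)) π ≡ ∑ᵖ (λ c → f c * apply (g c) π)
    equivariant : ∀ {γ π} (g : Word N → ℕ) → Perm γ → Perm π → apply (λ ρ → g (conj γ ρ)) π ≡ apply g (conj γ π)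
open Op public

idOp : Op N
idOp = record { apply = λ g → g ; ext = λ pπ eq → eq pπ ; linear = λ _ _ _ → refl ; equivariant = λ _ _ _ → refl }

actOp : (w : Word N → ℕ) → Invariant w → Op N → Op N
actOp {N} w inv-w O = record
  { apply = λ g → act w (apply O g)
  ; ext = λ pπ eq → ∑ᵖ-cong (λ σ pσ → cong (w σ *_) (ext O (perm-∙ pπ pσ) eq))
  ; linear = λ f g π → begin
      ∑ᵖ (λ σ → w σ * apply O (λ ρ → ∑ᵖ (λ c → f c * g c ρ)) (π ∙ σ))
        ≡⟨ ∑ᵖ-cong (λ σ _ → trans (cong (w σ *_) (linear O f g (π ∙ σ))) (sym (∑ᵖ-*ˡ (w σ) _))) ⟩
      ∑ᵖ (λ σ → ∑ᵖ (λ c → w σ * (f c * apply O (g c) (π ∙ σ))))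
        ≡⟨ ∑ᵖ-∑ᵖ _ ⟩
      ∑ᵖ (λ c → ∑ᵖ (λ σ → w σ * (f c * apply O (g c) (π ∙ σ))))
        ≡⟨ ∑ᵖ-cong (λ c _ → trans (∑ᵖ-cong (λ σ _ → *-swapˡ (w σ) (f c) _)) (∑ᵖ-*ˡ (f c) _)) ⟩
      ∑ᵖ (λ c → f c * act w (apply O (g c)) π) ∎
  ; equivariant = λ {γ} {π} g pγ pπ → begin
      ∑ᵖ (λ σ → w σ * apply O (λ ρ → g (conj γ ρ)) (π ∙ σ))
        ≡⟨ ∑ᵖ-cong (λ σ pσ → cong₂ _*_ (sym (inv-w pγ pσ)) (trans (equivariant O g pγ (perm-∙ pπ pσ)) (cong (apply O g) (conj-∙ pγ π σ)))) ⟩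
      ∑ᵖ (λ σ → w (conj γ σ) * apply O g (conj γ π ∙ conj γ σ))
        ≡⟨ ∑ᵖ-conj pγ (λ σ → w σ * apply O g (conj γ π ∙ σ)) ⟩
      ∑ᵖ (λ σ → w σ * apply O g (conj γ π ∙ σ)) ∎
  }
  where open ≡-Reasoning

sumOp : List A → (A → Op N) → Op N
sumOp xs O = record
  { apply = λ g π → ∑ xs (λ x → apply (O x) g π)
  ; ext = λ pπ eq → ∑-cong xs (λ x → ext (O x) pπ eq)
  ; linear = λ f g π → trans (∑-cong xs (λ x → linear (O x) f g π)) (trans (sym (∑ᵖ-∑ xs _))
      (∑ᵖ-cong (λ c _ → ∑-*ˡ xs (f c) _)))
  ; equivariant = λ g pγ pπ → ∑-cong xs (λ x → equivariant (O x) g pγ pπ)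
  }

inv-swap : (x y : Fin N) → inv (swap x y) ≡ swap x y
inv-swap x y = word-ext _ _ λ i → trans (cong (lookup (inv (swap x y))) (sym (lookup-swap-swap x y i)))
  (lookup-inverseˡ (perm-swap x y) _)

swap-conj : (x y : Fin N) (σ : Word N) → swap x y ∙ conj (swap x y) σ ≡ σ ∙ swap x y
swap-conj x y σ = trans (swap-swap-∙ x y (σ ∙ inv (swap x y))) (cong (σ ∙_) (inv-swap x y))

-- Invariance of w lets the transposition pass from the right of σ to its left.
act-E : {w : Word N → ℕ} → Invariant w → (g : Word N → ℕ) {π : Word N} → act w (E g) π ≡ E (act w g) π
act-E {N} {w} inv-w g {π} = begin
  ∑ᵖ (λ σ → w σ * ∑ᶠ (λ x → ∑ᶠ (λ y → D x y * g (π ∙ σ ∙ swap x y))))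
    ≡⟨ ∑ᵖ-cong (λ σ _ → trans (sym (∑-*ˡ (L.allFin N) (w σ) _)) (∑-cong (L.allFin N) (λ x → sym (∑-*ˡ (L.allFin N) (w σ) _)))) ⟩
  ∑ᵖ (λ σ → ∑ᶠ (λ x → ∑ᶠ (λ y → w σ * (D x y * g (π ∙ σ ∙ swap x y)))))
    ≡⟨ trans (∑ᵖ-∑ (L.allFin N) _) (∑-cong (L.allFin N) (λ x → ∑ᵖ-∑ (L.allFin N) _)) ⟩
  ∑ᶠ (λ x → ∑ᶠ (λ y → ∑ᵖ (λ σ → w σ * (D x y * g (π ∙ σ ∙ swap x y)))))
    ≡⟨ ∑-cong (L.allFin N) (λ x → ∑-cong (L.allFin N) (λ y → each x y)) ⟩
  ∑ᶠ (λ x → ∑ᶠ (λ y → D x y * ∑ᵖ (λ σ → w σ * g (π ∙ swap x y ∙ σ)))) ∎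
  where
  open ≡-Reasoning
  D : Fin N → Fin N → ℕ
  D x y = ⟦ ¬? (x ≟ᶠ y) ⟧
  each : ∀ x y → ∑ᵖ (λ σ → w σ * (D x y * g (π ∙ σ ∙ swap x y))) ≡ D x y * ∑ᵖ (λ σ → w σ * g (π ∙ swap x y ∙ σ))
  each x y = begin
    ∑ᵖ (λ σ → w σ * (D x y * g (π ∙ σ ∙ swap x y)))
      ≡⟨ trans (∑ᵖ-cong (λ σ _ → *-swapˡ (w σ) (D x y) _)) (∑ᵖ-*ˡ (D x y) _) ⟩
    D x y * ∑ᵖ (λ σ → w σ * g (π ∙ σ ∙ swap x y))
      ≡⟨ cong (D x y *_) (∑ᵖ-cong (λ σ pσ → cong₂ (λ m ρ → m * g ρ) (inv-w (perm-swap x y) pσ)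
           (trans (∙-assoc π (swap x y) (conj (swap x y) σ)) (trans (cong (π ∙_) (swap-conj x y σ)) (sym (∙-assoc π σ (swap x y))))))) ⟨
    D x y * ∑ᵖ (λ σ → w (conj (swap x y) σ) * g (π ∙ swap x y ∙ conj (swap x y) σ))
      ≡⟨ cong (D x y *_) (∑ᵖ-conj (perm-swap x y) (λ σ → w σ * g (π ∙ swap x y ∙ σ))) ⟩
    D x y * ∑ᵖ (λ σ → w σ * g (π ∙ swap x y ∙ σ)) ∎

-- A class function concentrated on rank `r`, whose completions to a single cycle are counted by
-- `v / u` times `W`, in the border case only.
record RankClass {n : ℕ} (w : Word (suc n) → ℕ) (r u v : ℕ) : Set where
  field
    invariant : Invariant w
    rank-r    : ∀ {σ} → Perm σ → ¬ w σ ≡ 0 → cyc σ + r ≡ suc n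
    ratio     : ∀ {τ} → Perm τ → cyc τ ≡ suc r → act w χ τ * u ≡ v * W τ

module _ {n : ℕ} {w : Word (suc n) → ℕ} {r u v : ℕ} (K : RankClass w r u v) where
  open RankClass K

  act-cyc : ∀ {π σ} q → Perm π → Perm σ → suc (q + r) ≤ cyc π → ¬ w σ ≡ 0 → suc q ≤ cyc (π ∙ σ)
  act-cyc {π} {σ} q pπ pσ le w≢0 = +-cancelʳ-≤ (r + cyc σ) _ _ (begin
    suc q + (r + cyc σ) ≡⟨ +-assoc (suc q) r (cyc σ) ⟨
    suc (q + r) + cyc σ ≤⟨ +-monoˡ-≤ (cyc σ) le ⟩
    cyc π + cyc σ ≤⟨ cyc-subadditive (s≤s z≤n) pπ pσ ⟩
    suc n + cyc (π ∙ σ) ≡⟨ cong (_+ cyc (π ∙ σ)) (trans (+-comm r (cyc σ)) (rank-r pσ w≢0)) ⟨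
    r + cyc σ + cyc (π ∙ σ) ≡⟨ +-comm (r + cyc σ) _ ⟩
    cyc (π ∙ σ) + (r + cyc σ) ∎)
    where open ≤-Reasoning

  -- A `σ` of nonzero weight has rank `r` and removes at most `r` cycles, so identities known for
  -- more than `q` cycles may be used under the sum.
  act-guard : ∀ {π σ} q → Perm π → Perm σ → suc (q + r) ≤ cyc π → {x y : ℕ} →
              (suc q ≤ cyc (π ∙ σ) → x ≡ y) → w σ * x ≡ w σ * y
  act-guard {π} {σ} q pπ pσ le eq with w σ ℕ.≟ 0
  ... | yes w≡0 rewrite w≡0 = refl
  ... | no w≢0 = cong (w σ *_) (eq (act-cyc q pπ pσ le w≢0))

  -- On the border `cyc π = suc r` both sides are multiples of `W π`, by `ratio` and `h-W`. With
  -- more cycles both vanish: neither a factor of rank `r` nor `r` transpositions suffice.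
  act-χ : ∀ {π} → Perm π → suc r ≤ cyc π → u * (2 * suc n) ^ r * act w χ π ≡ v * suc n * h r π
  act-χ {π} pπ le with cyc π ℕ.≟ suc r
  ... | yes c = *-cancelˡ-≡ _ _ (suc n) (begin
    suc n * (u * D * act w χ π) ≡⟨ shuffle₁ (suc n) u D (act w χ π) ⟩
    suc n * (D * (act w χ π * u)) ≡⟨ cong (λ x → suc n * (D * x)) (ratio pπ c) ⟩
    suc n * (D * (v * W π)) ≡⟨ shuffle₂ (suc n) D v (W π) ⟩
    suc n * v * (D * W π) ≡⟨ cong (suc n * v *_) (h-W r pπ c) ⟨
    suc n * v * (suc n * h r π) ≡⟨ shuffle₃ (suc n) v (h r π) ⟩
    suc n * (v * suc n * h r π) ∎)
    where
    open ≡-Reasoning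
    D = (2 * suc n) ^ r
    shuffle₁ : ∀ s u d x → s * (u * d * x) ≡ s * (d * (x * u))
    shuffle₁ = solve-∀
    shuffle₂ : ∀ s d v x → s * (d * (v * x)) ≡ s * v * (d * x)
    shuffle₂ = solve-∀
    shuffle₃ : ∀ s v x → s * v * (s * x) ≡ s * (v * s * x)
    shuffle₃ = solve-∀
  ... | no c = trans (trans (cong (u * (2 * suc n) ^ r *_) act≡0) (*-zeroʳ (u * (2 * suc n) ^ r)))
                     (sym (trans (cong (v * suc n *_) (h-zero r pπ r<)) (*-zeroʳ (v * suc n))))
    where
    r< : suc r < cyc π
    r< = ≤∧≢⇒< le (c ∘ sym)
    act≡0 : act w χ π ≡ 0
    act≡0 = ∑ᵖ-zero (λ σ pσ → trans (act-guard 1 pπ pσ r< (λ lt → ⟦⟧-no (cyc (π ∙ σ) ℕ.≟ 1) (λ eq → <-irrefl (sym eq) lt))) (*-zeroʳ (w σ)))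

  -- By `act-E` the transpositions are pulled out one by one until `act w` meets `χ`.
  act-h : ∀ m {π} → Perm π → suc (m + r) ≤ cyc π → u * (2 * suc n) ^ r * act w (h m) π ≡ v * suc n * h (m + r) π
  act-h zero    pπ le = act-χ pπ le
  act-h (suc m) {π} pπ le = begin
    u * D * act w (E (h m)) π ≡⟨ cong (u * D *_) (act-E invariant (h m)) ⟩
    u * D * E (act w (h m)) π ≡⟨ E-*ˡ (u * D) (act w (h m)) π ⟨
    E (λ ρ → u * D * act w (h m) ρ) π
      ≡⟨ E-cong {g = λ ρ → u * D * act w (h m) ρ} {λ ρ → v * suc n * h (m + r) ρ} {π} (λ x y _ →
           act-h m (perm-∙ pπ (perm-swap x y)) (s≤s⁻¹ (≤-trans le (cyc-swap pπ x y)))) ⟩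
    E (λ ρ → v * suc n * h (m + r) ρ) π ≡⟨ E-*ˡ (v * suc n) (h (m + r)) π ⟩
    v * suc n * h (suc m + r) π ∎
    where
    open ≡-Reasoning
    D = (2 * suc n) ^ r

-- `G` is `e / c` times `h q` as long as the rank `q` is no more than what joining the cycles of `π`
-- takes.
Scales : {n : ℕ} → (Word (suc n) → ℕ) → (q c e : ℕ) → Set
Scales {n} G q c e = ∀ {π : Word (suc n)} → Perm π → suc q ≤ cyc π → c * G π ≡ e * h q π

-- The fraction `y / x` is `v * suc n / u` in a simplified form, where the factorials of `ratio`
-- have become a binomial or multinomial coefficient.
scales-act : {n : ℕ} {w : Word (suc n) → ℕ} {r u v x y : ℕ} → RankClass w r u v → NonZero u → u * y ≡ x * (v * suc n) →
             {G : Word (suc n) → ℕ} {q c e : ℕ} → Scales G q c e → Scales (act w G) (q + r) (x * (2 * suc n) ^ r * c) (y * e)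
scales-act {n} {w} {r} {u} {v} {x} {y} K u≢0 ratio {G} {q} {c} {e} S {π} pπ le = *-cancelˡ-≡ _ _ u {{u≢0}} (begin
  u * (x * D * c * act w G π) ≡⟨ shuffle₁ u x D c (act w G π) ⟩
  x * (u * D * (c * act w G π)) ≡⟨ cong (λ a → x * (u * D * a)) inside ⟩
  x * (u * D * (e * act w (h q) π)) ≡⟨ shuffle₂ x (u * D) e (act w (h q) π) ⟩
  x * e * (u * D * act w (h q) π) ≡⟨ cong (x * e *_) (act-h K q pπ le) ⟩
  x * e * (v * suc n * h (q + r) π) ≡⟨ shuffle₃ x e (v * suc n) (h (q + r) π) ⟩
  x * (v * suc n) * (e * h (q + r) π) ≡⟨ cong (_* (e * h (q + r) π)) ratio ⟨
  u * y * (e * h (q + r) π) ≡⟨ shuffle₄ u y e (h (q + r) π) ⟩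
  u * (y * e * h (q + r) π) ∎)
  where
  open ≡-Reasoning
  D = (2 * suc n) ^ r
  shuffle₁ : ∀ u x d c a → u * (x * d * c * a) ≡ x * (u * d * (c * a))
  shuffle₁ = solve-∀
  shuffle₂ : ∀ x d e a → x * (d * (e * a)) ≡ x * e * (d * a)
  shuffle₂ = solve-∀
  shuffle₃ : ∀ x e v h → x * e * (v * h) ≡ x * v * (e * h)
  shuffle₃ = solve-∀
  shuffle₄ : ∀ u y e h → u * y * (e * h) ≡ u * (y * e * h)
  shuffle₄ = solve-∀
  inside : c * act w G π ≡ e * act w (h q) π
  inside = begin
    c * act w G π ≡⟨ ∑ᵖ-*ˡ c _ ⟨
    ∑ᵖ (λ σ → c * (w σ * G (π ∙ σ))) ≡⟨ ∑ᵖ-cong (λ σ pσ → trans (*-swapˡ c (w σ) _) (trans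
                                                    (act-guard K q pπ pσ le (λ le′ → S (perm-∙ pπ pσ) le′)) (*-swapˡ (w σ) e _))) ⟩
    ∑ᵖ (λ σ → e * (w σ * h q (π ∙ σ))) ≡⟨ ∑ᵖ-*ˡ e _ ⟩
    e * act w (h q) π ∎

-- Blocks of prescribed total length

C-factorials : ∀ {n k} → k ≤ n → (n C k) * (k ! * (n ∸ k) !) ≡ n !
C-factorials {n} {k} k≤n = trans (cong (_* (k ! * (n ∸ k) !)) (nCk≡n!/k![n-k]! k≤n)) (m/n*n≡m {{k !* (n ∸ k) !≢0}} (k![n∸k]!∣n! k≤n))

nC0≡1 : ∀ n → n C 0 ≡ 1
nC0≡1 n = *-cancelʳ-≡ (n C 0) 1 (n !) {{n !≢0}} (trans (cong ((n C 0) *_) (sym (*-identityˡ (n !)))) (trans (C-factorials {n} {0} z≤n) (sym (*-identityˡ (n !)))))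

vandermonde : ∀ a b s → ∑ (upTo (suc s)) (λ k → (a C k) * (b C (s ∸ k))) ≡ (a + b) C s
vandermonde zero b s = trans (∑-upTo-suc s _) (trans (cong₂ _+_ (*-identityˡ (b C s))
  (∑-zero (upTo s) (λ k → cong (_* (b C (s ∸ suc k))) (k>n⇒nCk≡0 {0} {suc k} (s≤s z≤n))))) (+-identityʳ _))
vandermonde (suc a) b zero = trans (+-identityʳ _) (trans (cong₂ _*_ (nC0≡1 (suc a)) (nC0≡1 b)) (sym (nC0≡1 (suc a + b))))
vandermonde (suc a) b (suc s) = begin
  ∑ (upTo (2 + s)) (λ k → (suc a C k) * (b C (suc s ∸ k)))
    ≡⟨ ∑-upTo-suc (suc s) (λ k → (suc a C k) * (b C (suc s ∸ k))) ⟩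
  (suc a C 0) * (b C suc s) + ∑ (upTo (suc s)) (λ k → (suc a C suc k) * (b C (s ∸ k)))
    ≡⟨ cong₂ _+_ (cong (_* (b C suc s)) (trans (nC0≡1 (suc a)) (sym (nC0≡1 a))))
         (trans (∑-cong (upTo (suc s)) (λ k → trans (cong (_* (b C (s ∸ k))) (sym (nCk+nC[k+1]≡[n+1]C[k+1] a k)))
                                                    (*-distribʳ-+ (b C (s ∸ k)) (a C k) (a C suc k))))
           (∑-+ (upTo (suc s)) (λ k → (a C k) * (b C (s ∸ k))) (λ k → (a C suc k) * (b C (s ∸ k))))) ⟩
  (a C 0) * (b C suc s) + (V₀ + V₁)
    ≡⟨ rotate ((a C 0) * (b C suc s)) V₀ V₁ ⟩
  V₀ + ((a C 0) * (b C suc s) + V₁)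
    ≡⟨ cong₂ _+_ (vandermonde a b s) (trans (sym (∑-upTo-suc (suc s) (λ k → (a C k) * (b C (suc s ∸ k))))) (vandermonde a b (suc s))) ⟩
  (a + b) C s + (a + b) C suc s
    ≡⟨ nCk+nC[k+1]≡[n+1]C[k+1] (a + b) s ⟩
  suc (a + b) C suc s ∎
  where
  open ≡-Reasoning
  V₀ = ∑ (upTo (suc s)) (λ k → (a C k) * (b C (s ∸ k)))
  V₁ = ∑ (upTo (suc s)) (λ k → (a C suc k) * (b C (s ∸ k)))
  rotate : ∀ x y z → x + (y + z) ≡ y + (x + z)
  rotate = solve-∀

everything : Subset N
everything _ = true

size-everything : size (everything {N}) ≡ N
size-everything {N} = trans (∑ᶠ-const {N} 1) (*-identityʳ N)

fixes-everything : (σ : Word N) → Fixes everything σ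
fixes-everything σ i ()

drop-everything : (σ : Word N) (x : ℕ) → ⟦ fixes? everything σ ⟧ * x ≡ x
drop-everything σ x = trans (cong (_* x) (⟦⟧-yes (fixes? everything σ) (fixes-everything σ))) (*-identityˡ x)

indicator≢0 : {P : Set} (d : Dec P) → ¬ ⟦ d ⟧ ≡ 0 → P
indicator≢0 (yes p) _  = p
indicator≢0 (no _)  nz = contradiction refl nz

module _ {n : ℕ} where

  rankWeight : ℕ → Word (suc n) → ℕ
  rankWeight k σ = ⟦ cyc σ + k ℕ.≟ suc n ⟧

  rankWeight-invariant : ∀ k → Invariant (rankWeight k)
  rankWeight-invariant k pγ pσ = cong (λ c → ⟦ c + k ℕ.≟ suc n ⟧) (cyc-conj pγ pσ)

  rankClass : ∀ {a k} → a + k ≡ n → RankClass (rankWeight k) k ((suc a) ! * k !) (n !)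
  rankClass {a} {k} a+k≡n = record
    { invariant = rankWeight-invariant k
    ; rank-r    = λ {σ} _ → indicator≢0 (cyc σ + k ℕ.≟ suc n)
    ; ratio     = λ {τ} pτ c → begin
        act (rankWeight k) χ τ * ((suc a) ! * k !) ≡⟨ *-assoc (act (rankWeight k) χ τ) _ _ ⟨
        act (rankWeight k) χ τ * (suc a) ! * k ! ≡⟨ cong (λ x → x * (suc a) ! * k !) (∑ᵖ-cong (λ σ _ → each σ τ)) ⟩
        rankCount everything τ 0 a * (suc a) ! * k ! ≡⟨ cong (_* k !) (rankCount-formula n {everything} {τ} {0} {a} {k} size-everything (+-identityʳ (suc n)) pτ (fixes-everything τ)
                                                                    (trans c (sym (+-identityʳ (suc k)))) a+k≡n) ⟩
        n ! * cycleProduct τ * k ! ≡⟨ trans (*-assoc (n !) _ _) (cong (n ! *_) (*-comm (cycleProduct τ) (k !))) ⟩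
        n ! * (k ! * cycleProduct τ) ≡⟨ cong (λ c → n ! * ((c ∸ 1) ! * cycleProduct τ)) c ⟨
        n ! * W τ ∎
    }
    where
    open ≡-Reasoning
    each : ∀ σ τ → rankWeight k σ * χ (τ ∙ σ) ≡ ⟦ fixes? everything σ ⟧ * (⟦ cyc σ ℕ.≟ suc a + 0 ⟧ * χ (τ ∙ σ))
    each σ τ = trans (cong (_* χ (τ ∙ σ)) (⟦⟧-cong (cyc σ + k ℕ.≟ suc n) (cyc σ ℕ.≟ suc a + 0)
      (λ e → trans (+-cancelʳ-≡ k _ _ (trans e (cong suc (sym a+k≡n)))) (sym (+-identityʳ (suc a))))
      (λ e → trans (cong (_+ k) (trans e (+-identityʳ (suc a)))) (cong suc a+k≡n)))) (sym (drop-everything σ _))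

  -- Here `v * suc n` is `(suc n) !`, so the ratio is a binomial coefficient with top `suc n`.
  scales-rank : ∀ {k} → k ≤ n → {G : Word (suc n) → ℕ} {q c e : ℕ} → Scales G q c e →
                Scales (act (rankWeight k) G) (q + k) ((2 * suc n) ^ k * c) ((suc n C k) * e)
  scales-rank {k} k≤n {G} {q} {c} {e} S = subst (λ D → Scales (act (rankWeight k) G) (q + k) (D * c) ((suc n C k) * e)) (*-identityˡ ((2 * suc n) ^ k))
    (scales-act {x = 1} {y = suc n C k} (rankClass (m∸n+n≡m k≤n)) (m*n≢0 (suc (n ∸ k) !) (k !) {{suc (n ∸ k) !≢0}} {{k !≢0}}) (begin
      suc (n ∸ k) ! * k ! * (suc n C k) ≡⟨ *-comm (suc (n ∸ k) ! * k !) _ ⟩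
      (suc n C k) * (suc (n ∸ k) ! * k !) ≡⟨ cong ((suc n C k) *_) (trans (*-comm (suc (n ∸ k) !) (k !)) (cong (λ m → k ! * m !) (sym (+-∸-assoc 1 k≤n)))) ⟩
      (suc n C k) * (k ! * (suc n ∸ k) !) ≡⟨ C-factorials (m≤n⇒m≤1+n k≤n) ⟩
      suc n * n ! ≡⟨ trans (*-comm (suc n) (n !)) (sym (*-identityˡ _)) ⟩
      1 * (n ! * suc n) ∎) {G} {q} {c} {e} S)
    where open ≡-Reasoning

  blockOp : (m s : ℕ) → Op (suc n) → Op (suc n)
  blockOp zero    zero    O = O
  -- An empty block cannot have positive length: the zero operator, as an empty sum.
  blockOp zero    (suc s) O = sumOp {A = ℕ} [] (λ _ → O)
  blockOp (suc m) s       O = sumOp (upTo (suc s)) (λ k → actOp (rankWeight k) (rankWeight-invariant k) (blockOp m (s ∸ k) O))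

  scales-block : ∀ m s {O : Op (suc n)} {g : Word (suc n) → ℕ} {q c e : ℕ} → Scales (apply O g) q c e →
                 Scales (apply (blockOp m s O) g) (q + s) ((2 * suc n) ^ s * c) (((m * suc n) C s) * e)
  scales-block zero zero {O} {g} {q} {c} {e} S {π} pπ le = begin
    1 * c * apply O g π ≡⟨ cong (_* apply O g π) (*-identityˡ c) ⟩
    c * apply O g π ≡⟨ S pπ (subst (λ q → suc q ≤ cyc π) (+-identityʳ q) le) ⟩
    e * h q π ≡⟨ cong₂ _*_ (sym (*-identityˡ e)) (cong (λ q → h q π) (sym (+-identityʳ q))) ⟩
    1 * e * h (q + 0) π ∎
    where open ≡-Reasoning
  scales-block zero (suc s) {q = q} {c} {e} S {π} pπ le =
    trans (*-zeroʳ ((2 * suc n) ^ suc s * c)) (sym (cong (λ x → x * e * h (q + suc s) π) (k>n⇒nCk≡0 {0} {suc s} (s≤s z≤n))))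
  scales-block (suc m) s {O} {g} {q} {c} {e} S {π} pπ le = begin
    D ^ s * c * ∑ (upTo (suc s)) (λ k → term k)
      ≡⟨ ∑-*ˡ (upTo (suc s)) (D ^ s * c) _ ⟨
    ∑ (upTo (suc s)) (λ k → D ^ s * c * term k)
      ≡⟨ ∑-cong-∈ (upTo (suc s)) (λ k k∈ → each k (s≤s⁻¹ (∈-upTo⁻ k∈))) ⟩
    ∑ (upTo (suc s)) (λ k → (suc n C k) * ((m * suc n) C (s ∸ k)) * (e * h (q + s) π))
      ≡⟨ ∑-*ʳ (upTo (suc s)) (λ k → (suc n C k) * ((m * suc n) C (s ∸ k))) (e * h (q + s) π) ⟩
    ∑ (upTo (suc s)) (λ k → (suc n C k) * ((m * suc n) C (s ∸ k))) * (e * h (q + s) π)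
      ≡⟨ cong (_* (e * h (q + s) π)) (vandermonde (suc n) (m * suc n) s) ⟩
    ((suc m * suc n) C s) * (e * h (q + s) π)
      ≡⟨ *-assoc ((suc m * suc n) C s) e _ ⟨
    ((suc m * suc n) C s) * e * h (q + s) π ∎
    where
    open ≡-Reasoning
    D = 2 * suc n
    term : ℕ → ℕ
    term k = act (rankWeight k) (apply (blockOp m (s ∸ k) O) g) π
    total : ∀ {k} → k ≤ s → q + (s ∸ k) + k ≡ q + s
    total {k} k≤s = trans (+-assoc q (s ∸ k) k) (cong (q +_) (m∸n+n≡m k≤s))
    each : ∀ k → k ≤ s → D ^ s * c * term k ≡ (suc n C k) * ((m * suc n) C (s ∸ k)) * (e * h (q + s) π)
    each k k≤s = begin
      D ^ s * c * term k
        ≡⟨ cong (_* term k) (trans (cong (λ s → D ^ s * c) (sym (m+[n∸m]≡n k≤s))) (trans (cong (_* c) (^-distribˡ-+-* D k (s ∸ k))) (*-assoc (D ^ k) _ c))) ⟩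
      D ^ k * (D ^ (s ∸ k) * c) * term k
        ≡⟨ scales-rank k≤n (scales-block m (s ∸ k) {O} {g} S) pπ (subst (λ q → suc q ≤ cyc π) (sym (total k≤s)) le) ⟩
      (suc n C k) * (((m * suc n) C (s ∸ k)) * e) * h (q + (s ∸ k) + k) π
        ≡⟨ cong (λ q → (suc n C k) * (((m * suc n) C (s ∸ k)) * e) * h q π) (total k≤s) ⟩
      (suc n C k) * (((m * suc n) C (s ∸ k)) * e) * h (q + s) π
        ≡⟨ shuffle (suc n C k) ((m * suc n) C (s ∸ k)) e (h (q + s) π) ⟩
      (suc n C k) * ((m * suc n) C (s ∸ k)) * (e * h (q + s) π) ∎
      where
      -- The bound comes from `le`, since `cyc π` is at most `suc n`.
      k≤n : k ≤ n
      k≤n = s≤s⁻¹ (≤-trans (s≤s (≤-trans k≤s (m≤n+m s q))) (≤-trans le (cyc≤N pπ)))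
      shuffle : ∀ a b e h → a * (b * e) * h ≡ a * b * (e * h)
      shuffle = solve-∀

-- Factors of prescribed type

entry : ∀ {n} → Vec ℕ n → ℕ → ℕ
entry []      k       = 0
entry (m ∷ T) zero    = m
entry (m ∷ T) (suc k) = entry T k

entry-lookup : ∀ {n} (T : Vec ℕ n) (k : Fin n) → entry T (toℕ k) ≡ lookup T k
entry-lookup (m ∷ T) zero    = refl
entry-lookup (m ∷ T) (suc k) = entry-lookup T k

entry-support : ∀ {n} (T : Vec ℕ n) k → n ≤ k → entry T k ≡ 0
entry-support []      k       _         = refl
entry-support (m ∷ T) (suc k) (s≤s n≤k) = entry-support T k n≤k

sum-entry : ∀ {n} (T : Vec ℕ n) → sum T ≡ ∑ (upTo n) (entry T)
sum-entry []              = refl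
sum-entry {suc n} (m ∷ T) = trans (cong (m +_) (sum-entry T)) (sym (∑-upTo-suc n (entry (m ∷ T))))

weighted-sum-entry : ∀ {n} (f : ℕ → ℕ) (T : Vec ℕ n) →
                     sum (zipWith _*_ (tabulate (f ∘ toℕ)) T) ≡ ∑ (upTo n) (λ k → f k * entry T k)
weighted-sum-entry f []              = refl
weighted-sum-entry {suc n} f (m ∷ T) = trans (cong (f 0 * m +_) (weighted-sum-entry (f ∘ suc) T))
  (sym (∑-upTo-suc n (λ k → f k * entry (m ∷ T) k)))

∏-applyUpTo : (g : ℕ → A) (n : ℕ) (f : A → ℕ) → ∏ (L.applyUpTo g n) f ≡ ∏ (upTo n) (f ∘ g)
∏-applyUpTo g zero    f = refl
∏-applyUpTo g (suc n) f = cong (f (g 0) *_) (trans (∏-applyUpTo (g ∘ suc) n f) (sym (∏-applyUpTo suc n (f ∘ g))))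

factProd-entry : ∀ {n} (T : Vec ℕ n) → factProd T ≡ ∏ (upTo n) (λ k → entry T k !)
factProd-entry []              = refl
factProd-entry {suc n} (m ∷ T) = cong (m ! *_) (trans (factProd-entry T) (sym (∏-applyUpTo suc n (λ k → entry (m ∷ T) k !))))

-- A multinomial coefficient is a binomial coefficient times a multinomial coefficient with one
-- entry fewer.
factProd-∣ : ∀ {r} M (T : Vec ℕ r) → sum T ≤ M → factProd T * (M ∸ sum T) ! ∣ M !
factProd-∣ M []      _  = subst (_∣ M !) (sym (*-identityˡ (M !))) ∣-refl
factProd-∣ M (m ∷ T) le = subst (_∣ M !) (trans (cong (λ x → m ! * (factProd T * x !)) (∸-+-assoc M m (sum T))) (sym (*-assoc (m !) (factProd T) _)))
  (∣-trans (*-monoʳ-∣ (m !) (factProd-∣ (M ∸ m) T (m+n≤o⇒m≤o∸n (sum T) (≤-trans (≤-reflexive (+-comm (sum T) m)) le))))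
           (k![n∸k]!∣n! (≤-trans (m≤m+n m (sum T)) le)))

multinomial-valid : ∀ {r} M (T : Vec ℕ r) → sum T ≤ M → multinomial M T * (factProd T * (M ∸ sum T) !) ≡ M !
multinomial-valid M T le with sum T ℕ.≤ᵇ M | ≤⇒≤ᵇ le
... | true | _ = m/n*n≡m {{m*n≢0 (factProd T) ((M ∸ sum T) !) {{factProd≢0 T}} {{(M ∸ sum T) !≢0}}}} (factProd-∣ M T le)

multinomial-invalid : ∀ {r} M (T : Vec ℕ r) → ¬ sum T ≤ M → multinomial M T ≡ 0
multinomial-invalid M T nle with sum T ℕ.≤ᵇ M | ≤ᵇ⇒≤ (sum T) M
... | true  | le = contradiction (le tt) nle
... | false | _  = refl

module _ {n : ℕ} where

  HasTail : Word (suc n) → CoxType n → Set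
  HasTail σ T = ∀ k → k < n → mult σ (suc k) ≡ entry T k

  opaque
    hasTail? : (σ : Word (suc n)) (T : CoxType n) → Dec (HasTail σ T)
    hasTail? σ T = map′ (λ h k k<n → h k<n) (λ h {k} k<n → h k k<n) (allUpTo? (λ k → mult σ (suc k) ℕ.≟ entry T k) n)

  typeWeight : CoxType n → Word (suc n) → ℕ
  typeWeight T σ = ⟦ hasTail? σ T ⟧

  typeWeight-invariant : (T : CoxType n) → Invariant (typeWeight T)
  typeWeight-invariant T {γ} {σ} pγ pσ = ⟦⟧-cong (hasTail? (conj γ σ) T) (hasTail? σ T)
    (λ t k k<n → trans (sym (mult-conj pγ pσ (suc k))) (t k k<n)) (λ t k k<n → trans (mult-conj pγ pσ (suc k)) (t k k<n))

  tail-sum : ∀ {σ T} → HasTail σ T → cyc σ ≡ mult σ 0 + sum T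
  tail-sum {σ} {T} t = trans (∑-upTo-suc n (mult σ)) (cong (mult σ 0 +_)
    (trans (∑-cong-∈ (upTo n) (λ k k∈ → t k (∈-upTo⁻ k∈))) (sym (sum-entry T))))

  tail-rank : ∀ {σ T} → Perm σ → HasTail σ T → cyc σ + rank T ≡ suc n
  tail-rank {σ} {T} pσ t = begin
    cyc σ + rank T ≡⟨ cong (cyc σ +_) (weighted-sum-entry suc T) ⟩
    cyc σ + ∑ (upTo n) (λ k → suc k * entry T k) ≡⟨ cong (cyc σ +_) (∑-cong-∈ (upTo n) (λ k k∈ → cong (suc k *_) (t k (∈-upTo⁻ k∈)))) ⟨
    cyc σ + ∑ (upTo n) (λ k → suc k * mult σ (suc k)) ≡⟨ cong (cyc σ +_) (∑-upTo-suc n (λ k → k * mult σ k)) ⟨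
    cyc σ + ∑ (upTo (suc n)) (λ k → k * mult σ k) ≡⟨ ∑-weight-split (suc n) (mult σ) ⟨
    ∑ (upTo (suc n)) (λ k → suc k * mult σ k) ≡⟨ ∑-mult pσ ⟩
    suc n ∎
    where open ≡-Reasoning

  module _ (T : CoxType n) (r≤n : rank T ≤ n) where

    private
      -- A permutation of type `T` has `M` cycles, of which `M ∸ sum T` are fixed points; the latter
      -- number completes `T` to `μ`.
      a M : ℕ
      a = n ∸ rank T
      M = suc a

      cyc≡M : ∀ {σ} → Perm σ → HasTail σ T → cyc σ ≡ M
      cyc≡M pσ t = +-cancelʳ-≡ (rank T) _ _ (trans (tail-rank {T = T} pσ t) (cong suc (sym (m∸n+n≡m r≤n))))

      μ : ℕ → ℕ
      μ zero    = M ∸ sum T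
      μ (suc k) = entry T k

    typeClass-valid : sum T ≤ M → RankClass (typeWeight T) (rank T) (factProd T * (M ∸ sum T) !) (a !)
    typeClass-valid valid = record
      { invariant = typeWeight-invariant T
      ; rank-r    = λ {σ} pσ nz → tail-rank {T = T} pσ (indicator≢0 (hasTail? σ T) nz)
      ; ratio     = λ {τ} pτ c → begin
          act (typeWeight T) χ τ * (factProd T * (M ∸ sum T) !)
            ≡⟨ cong₂ _*_ (∑ᵖ-cong (λ σ pσ → trans (cong (_* χ (τ ∙ σ)) (each pσ)) (sym (drop-everything σ _)))) factors ⟩
          goodCount everything τ μ 0 * factorials (suc n) μ
            ≡⟨ goodCount-formula n (setup pτ c) ⟩
          a ! * (rank T) ! * cycleProduct τ
            ≡⟨ *-assoc (a !) ((rank T) !) _ ⟩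
          a ! * ((rank T) ! * cycleProduct τ)
            ≡⟨ cong (λ c → a ! * ((c ∸ 1) ! * cycleProduct τ)) c ⟨
          a ! * W τ ∎
      }
      where
      open ≡-Reasoning
      shift-zero : ∀ k → shift 0 μ k ≡ μ k
      shift-zero zero    = +-identityʳ _
      shift-zero (suc k) = refl
      each : ∀ {σ} → Perm σ → typeWeight T σ ≡ ⟦ hasMult? σ (shift 0 μ) ⟧
      each {σ} pσ = ⟦⟧-cong (hasTail? σ T) (hasMult? σ (shift 0 μ)) to
        (λ m k k<n → m (suc k) (s≤s k<n))
        where
        to : HasTail σ T → HasMult σ (shift 0 μ)
        to t zero    _         = trans (trans (sym (m+n∸n≡m (mult σ 0) (sum T))) (cong (_∸ sum T) (trans (sym (tail-sum {T = T} t)) (cyc≡M pσ t)))) (sym (shift-zero 0))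
        to t (suc k) (s≤s k<n) = t k k<n
      factors : factProd T * (M ∸ sum T) ! ≡ factorials (suc n) μ
      factors = trans (*-comm (factProd T) _) (cong ((M ∸ sum T) ! *_) (trans (factProd-entry T) (sym (∏-applyUpTo suc n (λ k → μ k !)))))
      parts : ∑ (upTo (suc n)) μ ≡ M
      parts = trans (∑-upTo-suc n μ) (trans (cong ((M ∸ sum T) +_) (sym (sum-entry T))) (m∸n+n≡m valid))
      setup : ∀ {τ} → Perm τ → cyc τ ≡ suc (rank T) → Setup everything τ μ n 0 a (rank T)
      setup {τ} pτ c = record
        { size-X = size-everything ; total = +-identityʳ (suc n) ; perm-τ = pτ ; fixes-τ = fixes-everything τ
        ; support = λ { (suc k) (s≤s n≤k) → entry-support T k n≤k }
        ; parts = parts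
        ; weight = trans (∑-weight-split (suc n) μ) (trans (cong₂ _+_ parts (trans (∑-upTo-suc n (λ k → k * μ k)) (sym (weighted-sum-entry suc T))))
                     (cong suc (m∸n+n≡m r≤n)))
        ; cycles = trans c (sym (+-identityʳ _))
        ; balance = m∸n+n≡m r≤n
        }

    -- No permutation has such a type, although its rank is admissible: three disjoint
    -- transpositions have rank three but do not fit into four points.
    typeClass-invalid : ¬ sum T ≤ M → RankClass (typeWeight T) (rank T) 1 0
    typeClass-invalid invalid = record
      { invariant = typeWeight-invariant T
      ; rank-r    = λ {σ} pσ nz → tail-rank {T = T} pσ (indicator≢0 (hasTail? σ T) nz)
      ; ratio     = λ {τ} pτ c → trans (*-identityʳ _) (∑ᵖ-zero (λ σ pσ → cong (_* χ (τ ∙ σ)) (⟦⟧-no (hasTail? σ T)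
          (λ t → invalid (subst (sum T ≤_) (trans (sym (tail-sum {T = T} t)) (cyc≡M pσ t)) (m≤n+m (sum T) (mult σ 0)))))))
      }

    -- `ratio` supplies `a !` where the multinomial coefficient has `M ! = M * a !`. The factor `M`
    -- thus left over is the denominator `n ∸ rank T + 1` of the theorem.
    scales-type : {G : Word (suc n) → ℕ} {q c e : ℕ} → Scales G q c e →
                  Scales (act (typeWeight T) G) (q + rank T) (M * (2 * suc n) ^ rank T * c) (multinomial M T * suc n * e)
    scales-type {G} {q} {c} {e} S with sum T ≤? M
    ... | yes valid = scales-act {x = M} {y = multinomial M T * suc n} (typeClass-valid valid)
      (m*n≢0 (factProd T) ((M ∸ sum T) !) {{factProd≢0 T}} {{(M ∸ sum T) !≢0}})
      (begin
        U * (multinomial M T * suc n) ≡⟨ trans (sym (*-assoc U (multinomial M T) (suc n))) (cong (_* suc n) (*-comm U (multinomial M T))) ⟩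
        multinomial M T * U * suc n ≡⟨ cong (_* suc n) (multinomial-valid M T valid) ⟩
        M ! * suc n ≡⟨ *-assoc M (a !) (suc n) ⟩
        M * (a ! * suc n) ∎) {G} {q} {c} {e} S
      where
      open ≡-Reasoning
      U = factProd T * (M ∸ sum T) !
    ... | no invalid = scales-act {x = M} {y = multinomial M T * suc n} (typeClass-invalid invalid) (record { nonZero = tt })
      (trans (*-identityˡ _) (trans (cong (_* suc n) (multinomial-invalid M T invalid)) (sym (*-zeroʳ M)))) {G} {q} {c} {e} S

-- The formula for a fixed cycle

module _ {n : ℕ} where

  blocksOp : ∀ {l} → Vec ℕ l → Vec ℕ l → Op (suc n) → Op (suc n)
  blocksOp []       []       O = O
  blocksOp (m ∷ ms) (s ∷ ss) O = blockOp m s (blocksOp ms ss O)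

  mainOp : ∀ {d} → Vec (CoxType n) d → Op (suc n) → Op (suc n)
  mainOp []       O = O
  mainOp (T ∷ Ts) O = actOp (typeWeight T) (typeWeight-invariant T) (mainOp Ts O)

  private
    D : ℕ
    D = 2 * suc n

    binomials : ∀ {l} → Vec ℕ l → Vec ℕ l → ℕ
    binomials ms ss = prodV (zipWith (λ m s → (m * (n + 1)) C s) ms ss)

    parts : CoxType n → ℕ
    parts T = n ∸ rank T + 1

    arrangements : CoxType n → ℕ
    arrangements T = multinomial (parts T) T

  scales-blocks : ∀ {l} (ms ss : Vec ℕ l) {O : Op (suc n)} {g : Word (suc n) → ℕ} {q c e : ℕ} → Scales (apply O g) q c e →
                  Scales (apply (blocksOp ms ss O) g) (q + sum ss) (D ^ sum ss * c) (binomials ms ss * e)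
  scales-blocks [] [] {q = q} {c} {e} S {π} pπ le = trans (cong (_* _) (*-identityˡ c)) (trans (S pπ (subst (λ q → suc q ≤ cyc π) (+-identityʳ q) le))
    (cong₂ _*_ (sym (*-identityˡ e)) (cong (λ q → h q π) (sym (+-identityʳ q)))))
  scales-blocks (m ∷ ms) (s ∷ ss) {O} {g} {q} {c} {e} S {π} pπ le = begin
    D ^ (s + sum ss) * c * x ≡⟨ cong (_* x) (trans (cong (_* c) (^-distribˡ-+-* D s (sum ss))) (*-assoc (D ^ s) (D ^ sum ss) c)) ⟩
    D ^ s * (D ^ sum ss * c) * x ≡⟨ scales-block m s {blocksOp ms ss O} {g} {q + sum ss} {D ^ sum ss * c} {binomials ms ss * e}
                                                               (scales-blocks ms ss {O} {g} S) pπ (subst (λ q → suc q ≤ cyc π) (sym total) le) ⟩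
    ((m * suc n) C s) * (binomials ms ss * e) * h (q + sum ss + s) π
      ≡⟨ cong₂ _*_ (trans (sym (*-assoc ((m * suc n) C s) (binomials ms ss) e)) (cong (λ N → ((m * N) C s) * binomials ms ss * e) (+-comm 1 n))) (cong (λ q → h q π) total) ⟩
    ((m * (n + 1)) C s) * binomials ms ss * e * h (q + (s + sum ss)) π ∎
    where
    open ≡-Reasoning
    x = apply (blockOp m s (blocksOp ms ss O)) g π
    total : q + sum ss + s ≡ q + (s + sum ss)
    total = trans (+-assoc q (sum ss) s) (cong (q +_) (+-comm (sum ss) s))

  scales-main : ∀ {d} (Ts : Vec (CoxType n) d) {O : Op (suc n)} {g : Word (suc n) → ℕ} {q c e : ℕ} → Scales (apply O g) q c e →
                Scales (apply (mainOp Ts O) g) (q + sum (map rank Ts)) (prodV (map parts Ts) * D ^ sum (map rank Ts) * c)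
                                                                       (prodV (map arrangements Ts) * suc n ^ d * e)
  scales-main [] {q = q} {c} {e} S {π} pπ le = trans (cong (_* _) (*-identityˡ c)) (trans (S pπ (subst (λ q → suc q ≤ cyc π) (+-identityʳ q) le))
    (cong₂ _*_ (sym (*-identityˡ e)) (cong (λ q → h q π) (sym (+-identityʳ q)))))
  scales-main {suc d} (T ∷ Ts) {O} {g} {q} {c} {e} S {π} pπ le = begin
    parts T * PM * D ^ (r + R) * c * x ≡⟨ cong (_* x) (trans (cong (λ y → parts T * PM * y * c) (^-distribˡ-+-* D r R)) (shuffle₁ (parts T) PM (D ^ r) (D ^ R) c)) ⟩
    parts T * D ^ r * (PM * D ^ R * c) * x ≡⟨ cong (λ p → p * D ^ r * (PM * D ^ R * c) * x) (+-comm (n ∸ r) 1) ⟩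
    suc (n ∸ r) * D ^ r * (PM * D ^ R * c) * x ≡⟨ scales-type T r≤n {apply (mainOp Ts O) g} {q + R} {PM * D ^ R * c} {PA * suc n ^ d * e}
                                                                (scales-main Ts {O} {g} S) pπ (subst (λ q → suc q ≤ cyc π) (sym total) le) ⟩
    multinomial (suc (n ∸ r)) T * suc n * (PA * suc n ^ d * e) * h (q + R + r) π
      ≡⟨ cong₂ _*_ (trans (shuffle₂ (multinomial (suc (n ∸ r)) T) (suc n) PA (suc n ^ d) e) (cong (λ M → multinomial M T * PA * (suc n * suc n ^ d) * e) (+-comm 1 (n ∸ r)))) (cong (λ q → h q π) total) ⟩
    arrangements T * PA * suc n ^ suc d * e * h (q + (r + R)) π ∎
    where
    open ≡-Reasoning
    x = apply (mainOp (T ∷ Ts) O) g π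
    r = rank T
    R = sum (map rank Ts)
    PM = prodV (map parts Ts)
    PA = prodV (map arrangements Ts)
    total : q + R + r ≡ q + (r + R)
    total = trans (+-assoc q R r) (cong (q +_) (+-comm R r))
    r≤n : r ≤ n
    r≤n = s≤s⁻¹ (≤-trans (s≤s (≤-trans (m≤m+n r R) (m≤n+m (r + R) q))) (≤-trans le (cyc≤N pπ)))
    shuffle₁ : ∀ a b x y c → a * b * (x * y) * c ≡ a * x * (b * y * c)
    shuffle₁ = solve-∀
    shuffle₂ : ∀ m s p t e → m * s * (p * t * e) ≡ m * p * (s * t) * e
    shuffle₂ = solve-∀

  -- Joining two different orbits would leave a permutation without cycles.
  cycle-reach : {c : Word (suc n)} → Perm c → cyc c ≡ 1 → ∀ i j → Reach c i j
  cycle-reach {c} pc single i j with reach? pc i j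
  ... | yes r = r
  ... | no ¬r = contradiction (cyc-positive (perm-∙ pc (perm-swap i j))) (<-irrefl (sym (suc-injective (trans (cyc-merge pc ¬r) single))))

  cycle-len : {c : Word (suc n)} → Perm c → cyc c ≡ 1 → ∀ i → len c i ≡ suc n
  cycle-len pc single i = trans (sym (len-∑ pc i)) (trans
    (∑-cong (L.allFin (suc n)) (λ j → ⟦⟧-yes (reach? pc i j) (cycle-reach pc single i j))) (trans (∑ᶠ-const {suc n} 1) (*-identityʳ (suc n))))

  -- Both cycles are written out from `zero`, and `γ` matches the points at equal positions.
  cycles-conjugate : {c c′ : Word (suc n)} → Perm c → cyc c ≡ 1 → Perm c′ → cyc c′ ≡ 1 → ∃[ γ ] (Perm γ × conj γ c ≡ c′)
  cycles-conjugate {c} {c′} pc single pc′ single′ = γ , pγ , conj-unique pγ c c′ intertwines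
    where
    position : ∀ j → ∃[ k ] (k < len c zero × iter c k zero ≡ j)
    position j = reach-short pc (cycle-reach pc single zero j)
    pos : Fin (suc n) → ℕ
    pos j = proj₁ (position j)
    pos< : ∀ j → pos j < len c zero
    pos< j = proj₁ (proj₂ (position j))
    at-pos : ∀ j → iter c (pos j) zero ≡ j
    at-pos j = proj₂ (proj₂ (position j))
    same-len : len c zero ≡ len c′ zero
    same-len = trans (cycle-len pc single zero) (sym (cycle-len pc′ single′ zero))
    γ : Word (suc n)
    γ = tabulate (λ j → iter c′ (pos j) zero)
    lookup-γ : ∀ j → lookup γ j ≡ iter c′ (pos j) zero
    lookup-γ j = V.lookup∘tabulate (λ j → iter c′ (pos j) zero) j
    pγ : Perm γ
    pγ .injective i j eq = trans (sym (at-pos i)) (trans (cong (λ k → iter c k zero) (reach-short-unique pc′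
      (subst (pos i <_) same-len (pos< i)) (subst (pos j <_) same-len (pos< j)) (trans (sym (lookup-γ i)) (trans eq (lookup-γ j))))) (at-pos j))
    next : ∀ j → iter c′ (pos (lookup c j)) zero ≡ iter c′ (suc (pos j)) zero
    next j with suc (pos j) ℕ.≟ len c zero
    ... | no ¬last = cong (λ k → iter c′ k zero) (reach-short-unique pc (pos< (lookup c j)) (≤∧≢⇒< (pos< j) ¬last)
                       (trans (at-pos (lookup c j)) (cong (lookup c) (sym (at-pos j)))))
    -- The wrap-around: `lookup c j` is `zero`, at position `0`, and `c′` returns at the same moment
    -- by `same-len`.
    ... | yes last = trans (cong (λ k → iter c′ k zero) (reach-short-unique pc (pos< (lookup c j)) (len-positive pc zero)
                       (trans (at-pos (lookup c j)) (trans (cong (lookup c) (sym (at-pos j)))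
                         (trans (cong (λ k → iter c k zero) last) (IsPeriod.returns (len-period pc zero)))))))
                       (sym (trans (cong (λ k → iter c′ k zero) (trans last same-len)) (IsPeriod.returns (len-period pc′ zero))))
    intertwines : ∀ j → lookup c′ (lookup γ j) ≡ lookup γ (lookup c j)
    intertwines j = trans (cong (lookup c′) (lookup-γ j)) (sym (trans (lookup-γ (lookup c j)) (next j)))

  δ : Word (suc n) → Word (suc n) → ℕ
  δ c ρ = ⟦ Finite.decEq (words (suc n)) ρ c ⟧

  module _ (O : Op (suc n)) where

    -- Conjugation fixes the starting point `ε`, so it only moves the target.
    apply-δ-conj : {c γ : Word (suc n)} → Perm γ → apply O (δ (conj γ c)) ε ≡ apply O (δ c) ε
    apply-δ-conj {c} {γ} pγ = begin
      apply O (δ (conj γ c)) ε ≡⟨ cong (apply O (δ (conj γ c))) conj-ε ⟨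
      apply O (δ (conj γ c)) (conj γ ε) ≡⟨ equivariant O (δ (conj γ c)) pγ perm-id ⟨
      apply O (λ ρ → δ (conj γ c) (conj γ ρ)) ε ≡⟨ ext O perm-id (λ {ρ} _ → ⟦⟧-cong (Finite.decEq (words (suc n)) (conj γ ρ) (conj γ c)) (Finite.decEq (words (suc n)) ρ c)
                                                     (λ eq → trans (sym (conj-inverse pγ ρ)) (trans (cong (conj (inv γ)) eq) (conj-inverse pγ c))) (cong (conj γ))) ⟩
      apply O (δ c) ε ∎
      where
      open ≡-Reasoning
      conj-ε : conj γ ε ≡ ε
      conj-ε = conj-unique pγ ε ε (λ i → trans (lookup-id _) (cong (lookup γ) (sym (lookup-id i))))

    apply-χ : {c : Word (suc n)} → Perm c → cyc c ≡ 1 → apply O χ ε ≡ n ! * apply O (δ c) ε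
    apply-χ {c} pc single = begin
      apply O χ ε ≡⟨ ext O perm-id (λ {ρ} pρ → trans (sym (∑ᵖ-δ pρ χ)) (∑ᵖ-cong (λ c′ _ → *-comm (δ c′ ρ) (χ c′)))) ⟩
      apply O (λ ρ → ∑ᵖ (λ c′ → χ c′ * δ c′ ρ)) ε ≡⟨ linear O χ δ ε ⟩
      ∑ᵖ (λ c′ → χ c′ * apply O (δ c′) ε) ≡⟨ ∑ᵖ-cong (λ c′ pc′ → ⟦⟧-guard (cyc c′ ℕ.≟ 1) (λ single′ → same pc′ single′)) ⟩
      ∑ᵖ (λ c′ → χ c′ * apply O (δ c) ε) ≡⟨ ∑ᵖ-*ʳ χ _ ⟩
      ∑ᵖ χ * apply O (δ c) ε ≡⟨ cong (_* apply O (δ c) ε) number-of-cycles ⟩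
      n ! * apply O (δ c) ε ∎
      where
      open ≡-Reasoning
      same : ∀ {c′} → Perm c′ → cyc c′ ≡ 1 → apply O (δ c′) ε ≡ apply O (δ c) ε
      same pc′ single′ with γ , pγ , refl ← cycles-conjugate pc single pc′ single′ = apply-δ-conj pγ
      -- For `τ = ε` and `a = 0` the completions counted by `rankCount` are the single cycles
      -- themselves.
      number-of-cycles : ∑ᵖ (χ {suc n}) ≡ n !
      number-of-cycles = begin
        ∑ᵖ χ ≡⟨ ∑ᵖ-cong (λ σ pσ → sym (trans (drop-everything σ _) (square σ))) ⟩
        rankCount everything ε 0 0 ≡⟨ *-identityʳ _ ⟨
        rankCount everything ε 0 0 * 1 ≡⟨ rankCount-formula n {everything} {ε} {0} {0} {n} size-everything (+-identityʳ (suc n)) perm-id (fixes-everything ε)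
                                                   (trans (cyc-ε {suc n} (s≤s z≤n)) (sym (+-identityʳ (suc n)))) refl ⟩
        n ! * cycleProduct (ε {suc n}) ≡⟨ trans (cong (n ! *_) (cycleProduct-ε {suc n})) (*-identityʳ (n !)) ⟩
        n ! ∎
        where
        square : ∀ σ → ⟦ cyc σ ℕ.≟ 1 ⟧ * ⟦ cyc (ε ∙ σ) ℕ.≟ 1 ⟧ ≡ χ σ
        square σ = trans (cong (λ ρ → χ σ * χ ρ) (∙-identityˡ σ)) (idempotent (cyc σ ℕ.≟ 1))
          where
          idempotent : {P : Set} (d : Dec P) → ⟦ d ⟧ * ⟦ d ⟧ ≡ ⟦ d ⟧
          idempotent (yes _) = refl
          idempotent (no _)  = refl

  factorisationOp : ∀ {d l} → Vec (CoxType n) d → Vec ℕ l → Vec ℕ l → Op (suc n)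
  factorisationOp Ts ms ss = mainOp Ts (blocksOp ms ss idOp)

  factorisation-formula : ∀ {d l} (Ts : Vec (CoxType n) (suc d)) (ms ss : Vec ℕ l) → sum (map rank Ts) + sum ss ≡ n →
    {c : Word (suc n)} → Perm c → cyc c ≡ 1 →
    apply (factorisationOp Ts ms ss) (δ c) ε * prodV (map parts Ts) ≡ (n + 1) ^ d * prodV (map arrangements Ts) * binomials ms ss
  -- In the cancelled constant, `D ^ n` belongs to the `n` transpositions, and `n !` is both the
  -- number of long cycles and `W ε`. The `d + 1` types bring `suc n ^ suc d`; the `suc n` of `h-W`
  -- lowers the exponent to `d`.
  factorisation-formula {d} Ts ms ss total {c} pc single = *-cancelˡ-≡ _ _ (D ^ n * (suc n * n !)) {{m*n≢0 (D ^ n) (suc n * n !) {{m^n≢0 D n}} {{(suc n) !≢0}}}} (begin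
    D ^ n * (suc n * n !) * (K * PM)
      ≡⟨ shuffle₁ (D ^ n) (suc n) (n !) K PM ⟩
    suc n * (PM * D ^ n * (n ! * K))
      ≡⟨ cong₂ (λ p z → suc n * (PM * p * z)) powers (sym (apply-χ O pc single)) ⟩
    suc n * (PM * (D ^ R * D ^ S) * Z)
      ≡⟨ cong (suc n *_) (shuffle₂ PM (D ^ R) (D ^ S) Z) ⟩
    suc n * (PM * D ^ R * (D ^ S * 1) * Z)
      ≡⟨ cong (suc n *_) scaled ⟩
    suc n * (PA * suc n ^ suc d * (PB * 1) * h (S + R) ε)
      ≡⟨ cong (λ m → suc n * (PA * suc n ^ suc d * (PB * 1) * h m (ε {suc n}))) (trans (+-comm S R) total) ⟩
    suc n * (PA * suc n ^ suc d * (PB * 1) * h n ε)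
      ≡⟨ shuffle₃ (suc n) PA (suc n ^ d) PB (h n ε) ⟩
    PA * suc n ^ d * suc n * PB * (suc n * h n ε)
      ≡⟨ cong (PA * suc n ^ d * suc n * PB *_) (trans (h-W n perm-id cyc-ε′) (cong (D ^ n *_) W-ε)) ⟩
    PA * suc n ^ d * suc n * PB * (D ^ n * n !)
      ≡⟨ shuffle₄ PA (suc n ^ d) (suc n) PB (D ^ n) (n !) ⟩
    D ^ n * (suc n * n !) * (suc n ^ d * PA * PB)
      ≡⟨ cong (λ N → D ^ n * (suc n * n !) * (N ^ d * PA * PB)) (+-comm 1 n) ⟩
    D ^ n * (suc n * n !) * ((n + 1) ^ d * PA * PB) ∎)
    where
    open ≡-Reasoning
    O = factorisationOp Ts ms ss
    K = apply O (δ c) ε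
    Z = apply O χ ε
    R = sum (map rank Ts)
    S = sum ss
    PM = prodV (map parts Ts)
    PA = prodV (map arrangements Ts)
    PB = binomials ms ss
    cyc-ε′ : cyc (ε {suc n}) ≡ suc n
    cyc-ε′ = cyc-ε {suc n} (s≤s z≤n)
    W-ε : W (ε {suc n}) ≡ n !
    W-ε = trans (cong₂ (λ c p → (c ∸ 1) ! * p) cyc-ε′ (cycleProduct-ε {suc n})) (*-identityʳ (n !))
    powers : D ^ n ≡ D ^ R * D ^ S
    powers = trans (cong (D ^_) (sym total)) (^-distribˡ-+-* D R S)
    scaled : PM * D ^ R * (D ^ S * 1) * Z ≡ PA * suc n ^ suc d * (PB * 1) * h (S + R) ε
    scaled = scales-main Ts {blocksOp ms ss idOp} {χ} {S} {D ^ S * 1} {PB * 1} (scales-blocks ms ss {idOp} {χ} {0} {1} {1} (λ _ _ → refl))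
      perm-id (≤-reflexive (trans (cong suc (trans (+-comm S R) total)) (sym cyc-ε′)))
    shuffle₁ : ∀ d s f k p → d * (s * f) * (k * p) ≡ s * (p * d * (f * k))
    shuffle₁ = solve-∀
    shuffle₂ : ∀ p x y z → p * (x * y) * z ≡ p * x * (y * 1) * z
    shuffle₂ = solve-∀
    shuffle₃ : ∀ s p t b h → s * (p * (s * t) * (b * 1) * h) ≡ p * t * s * b * (s * h)
    shuffle₃ = solve-∀
    shuffle₄ : ∀ p t s b d f → p * t * s * b * (d * f) ≡ d * (s * f) * (t * p * b)
    shuffle₄ = solve-∀

-- Comparison with the definitions of the statement

count-allFin : {P : Fin N → Set} (P? : ∀ i → Dec (P i)) → V.count P? (V.allFin N) ≡ ∑ᶠ (λ i → ⟦ P? i ⟧)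
count-allFin {N} P? = go N id
  where
  go : ∀ m (f : Fin m → Fin N) → V.count P? (V.tabulate f) ≡ ∑ (L.tabulate f) (λ i → ⟦ P? i ⟧)
  go zero    f = refl
  go (suc m) f with does (P? (f zero))
  ... | true  = cong suc (go m (f ∘ suc))
  ... | false = go m (f ∘ suc)

cycleCount-mult : (σ : Word N) (k : ℕ) → cycleCount σ (suc k) ≡ mult σ k
cycleCount-mult {N} σ k = trans (cong (ℕ._/ suc k) (trans (count-allFin (λ i → orbitLen σ i ℕ.≟ suc k))
  (∑-cong (L.allFin N) (λ i → cong (λ p → ⟦ p ℕ.≟ suc k ⟧) (sym (len-def σ i)))))) (sym (mult-def σ k))

∑-squeeze : (xs : List A) {f g : A → ℕ} → (∀ x → f x ≤ g x) → ∑ xs g ≤ ∑ xs f → ∀ {x} → x ∈ xs → g x ≡ f x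
∑-squeeze (y ∷ xs) {f} {g} f≤g le (here refl) =
  ≤-antisym (+-cancelʳ-≤ (∑ xs g) (g y) (f y) (≤-trans le (+-monoʳ-≤ (f y) (∑-mono xs f≤g)))) (f≤g y)
∑-squeeze (y ∷ xs) {f} {g} f≤g le (there x∈) =
  ∑-squeeze xs f≤g (+-cancelˡ-≤ (f y) (∑ xs g) (∑ xs f) (≤-trans (+-monoˡ-≤ (∑ xs g) (f≤g y)) le)) x∈

-- One cycle of length `n + 1` uses up all points, so `∑-mult` leaves none for other lengths.
coxeter-cyc : ∀ {n} {c : Word (suc n)} → IsCoxeter c → Perm c × cyc c ≡ 1
coxeter-cyc {n} {c} (inj , one) = pc , trans (∑-cong-∈ (upTo (suc n)) (λ k k∈ → *-cancelˡ-≡ _ _ (suc k) (∑-squeeze (upTo (suc n)) below total k∈)))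
                                             (∑-δ1 (n<1+n n))
  where
  pc : Perm c
  pc = perm inj
  below : ∀ k → suc k * ⟦ n ℕ.≟ k ⟧ ≤ suc k * mult c k
  below k = *-monoʳ-≤ (suc k) (⟦⟧-≤ (n ℕ.≟ k) λ { refl → ≤-reflexive (sym (trans (sym (cycleCount-mult c n)) one)) })
  total : ∑ (upTo (suc n)) (λ k → suc k * mult c k) ≤ ∑ (upTo (suc n)) (λ k → suc k * ⟦ n ℕ.≟ k ⟧)
  total = ≤-reflexive (trans (∑-mult pc) (sym (∑-weight-δ (n<1+n n))))

module _ {n : ℕ} where

  hasType⇒ : {σ : Word (suc n)} {T : CoxType n} → HasType σ T → Perm σ × HasTail σ T
  hasType⇒ {σ} {T} (inj , type) = perm inj , λ k k<n → begin
    mult σ (suc k) ≡⟨ cong (λ k → mult σ (suc k)) (Fin.toℕ-fromℕ< k<n) ⟨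
    mult σ (suc (toℕ (fromℕ< k<n))) ≡⟨ cycleCount-mult σ (suc (toℕ (fromℕ< k<n))) ⟨
    cycleCount σ (2 + toℕ (fromℕ< k<n)) ≡⟨ type (fromℕ< k<n) ⟩
    lookup T (fromℕ< k<n) ≡⟨ entry-lookup T (fromℕ< k<n) ⟨
    entry T (toℕ (fromℕ< k<n)) ≡⟨ cong (entry T) (Fin.toℕ-fromℕ< k<n) ⟩
    entry T k ∎
    where open ≡-Reasoning

  hasType⇐ : {σ : Word (suc n)} {T : CoxType n} → Perm σ → HasTail σ T → HasType σ T
  hasType⇐ {σ} {T} pσ tail = injective pσ , λ k →
    trans (cycleCount-mult σ (suc (toℕ k))) (trans (tail (toℕ k) (Fin.toℕ<n k)) (entry-lookup T k))

  cyc-swapˡ : {ρ : Word (suc n)} → Perm ρ → (x y : Fin (suc n)) → cyc ρ ≤ suc (cyc (swap x y ∙ ρ))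
  cyc-swapˡ {ρ} pρ x y with x′ , refl ← perm-surjective pρ x | y′ , refl ← perm-surjective pρ y =
    subst (λ π → cyc ρ ≤ suc (cyc π)) (swap-push pρ x′ y′) (cyc-swap pρ x′ y′)

  opaque
    unfolding _∙_ ε swap

    -- Each transposition removes at most one of the `suc n` cycles of the identity.
    transpositions-bound : (ts : List (Word (suc n))) → Allₗ IsTransposition ts → Perm (prod ts) × suc n ≤ cyc (prod ts) + L.length ts
    transpositions-bound [] [] = perm-id , ≤-reflexive (sym (trans (+-identityʳ _) (cyc-ε {suc n} (s≤s z≤n))))
    transpositions-bound (t ∷ ts) ((x , y , x≢y , refl) ∷ all) with pρ , bound ← transpositions-bound ts all =
      perm-∙ (perm-swap x y) pρ ,
      ≤-trans bound (≤-trans (+-monoˡ-≤ (L.length ts) (cyc-swapˡ pρ x y)) (≤-reflexive (sym (+-suc (cyc (swap x y ∙ prod ts)) (L.length ts)))))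

    -- Every step of `perm-induction` removes exactly one cycle, so the bound is attained;
    -- `swap-push` moves the new transposition to the head of the list.
    transpositions-exist : {σ : Word (suc n)} → Perm σ →
                           ∃[ ts ] (Allₗ IsTransposition ts × prod ts ≡ σ × cyc σ + L.length ts ≡ suc n)
    transpositions-exist = perm-induction (λ σ → ∃[ ts ] (Allₗ IsTransposition ts × prod ts ≡ σ × cyc σ + L.length ts ≡ suc n))
      ([] , [] , refl , trans (+-identityʳ _) (cyc-ε {suc n} (s≤s z≤n)))
      (λ {σ} {x} {y} pσ fix x≢y (ts , all , product , length) →
        swap (lookup σ x) (lookup σ y) ∷ ts ,
        (lookup σ x , lookup σ y , (λ eq → x≢y (injective pσ _ _ eq)) , refl) ∷ all ,
        trans (cong (swap (lookup σ x) (lookup σ y) ∙_) product) (sym (swap-push pσ x y)) ,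
        trans (+-suc (cyc (σ ∙ swap x y)) (L.length ts)) (trans (cong (_+ L.length ts) (cyc-merge pσ (fixed-≁ {σ = σ} fix x≢y))) length))

  reflLen⇒ : {σ : Word (suc n)} {k : ℕ} → ReflLen σ k → Perm σ × cyc σ + k ≡ suc n
  reflLen⇒ {σ} {k} ((ts , all , refl , refl) , shortest) with pσ , bound ← transpositions-bound ts all = pσ , ≤-antisym upper bound
    where
    upper : cyc (prod ts) + L.length ts ≤ suc n
    upper with us , all′ , product , length ← transpositions-exist pσ =
      ≤-trans (+-monoʳ-≤ (cyc (prod ts)) (shortest us all′ product)) (≤-reflexive length)

  reflLen⇐ : {σ : Word (suc n)} {k : ℕ} → Perm σ → cyc σ + k ≡ suc n → ReflLen σ k
  reflLen⇐ {σ} {k} pσ eq with ts , all , product , length ← transpositions-exist pσ =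
    (ts , all , product , +-cancelˡ-≡ (cyc σ) _ _ (trans length (sym eq))) ,
    λ { us all′ refl → +-cancelˡ-≤ (cyc σ) _ _ (≤-trans (≤-reflexive eq) (proj₂ (transpositions-bound us all′))) }

-- Enumeration of the factorisations

lookup-injective : {xs : List A} → Unique xs → ∀ i j → L.lookup xs i ≡ L.lookup xs j → i ≡ j
lookup-injective (x∉ ∷ u) zero    zero    _  = refl
lookup-injective (x∉ ∷ u) zero    (suc j) eq = contradiction eq (Allₗ.lookup x∉ (∈-lookup j))
lookup-injective (x∉ ∷ u) (suc i) zero    eq = contradiction (sym eq) (Allₗ.lookup x∉ (∈-lookup i))
lookup-injective (x∉ ∷ u) (suc i) (suc j) eq = cong suc (lookup-injective u i j eq)

length-filter-∑ : {P : A → Set} (P? : ∀ a → Dec (P a)) (xs : List A) → L.length (L.filter P? xs) ≡ ∑ xs (λ a → ⟦ P? a ⟧)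
length-filter-∑ P? []       = refl
length-filter-∑ P? (x ∷ xs) with does (P? x)
... | true  = cong suc (length-filter-∑ P? xs)
... | false = length-filter-∑ P? xs

-- The type `B` is never listed itself: positions in the filtered list of `A` are matched with it
-- through the injective `f` and its section `build`.
enumerate : (F : Finite A) {P : A → Set} (P? : ∀ a → Dec (P a)) (f : B → A) (f-P : ∀ b → P (f b)) →
            (build : ∀ a → P a → B) → (∀ a p → f (build a p) ≡ a) → (∀ {b b′} → f b ≡ f b′ → b ≡ b′) →
            Fin (L.length (L.filter P? (elems F))) ↔ B
enumerate {B = B} F {P} P? f f-P build f-build f-injective = mk↔ₛ′ to from to-from from-to
  where
  xs = L.filter P? (elems F)
  to : Fin (L.length xs) → B
  to i = build (L.lookup xs i) (proj₂ (∈-filter⁻ P? {xs = elems F} (∈-lookup i)))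
  found : ∀ b → f b ∈ xs
  found b = ∈-filter⁺ P? (Finite.complete F (f b)) (f-P b)
  from : B → Fin (L.length xs)
  from b = Any.index (found b)
  to-from : ∀ b → to (from b) ≡ b
  to-from b = f-injective (trans (f-build _ _) (sym (lookup-index (found b))))
  from-to : ∀ i → from (to i) ≡ i
  from-to i = lookup-injective (Unique.filter⁺ P? (Finite.unique F)) _ _ (trans (sym (lookup-index (found (to i)))) (f-build _ _))

Blocks : (n : ℕ) {l : ℕ} → Vec ℕ l → Set
Blocks n = All (λ m → Vec (Word (suc n)) m)

∷-injectiveᵇ : ∀ {n l m} {ms : Vec ℕ l} {b b′ : Vec (Word (suc n)) m} {bs bs′ : Blocks n ms} →
               _≡_ {A = Blocks n (m ∷ ms)} (b ∷ bs) (b′ ∷ bs′) → b ≡ b′ × bs ≡ bs′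
∷-injectiveᵇ refl = refl , refl

blocks : ∀ n {l} (ms : Vec ℕ l) → Finite (Blocks n ms)
blocks n [] = record { elems = [] ∷ [] ; complete = λ { [] → here refl } ; unique = [] ∷ [] ; decEq = λ { [] [] → yes refl } }
blocks n (m ∷ ms) = record
  { elems    = L.cartesianProductWith _∷_ (elems F) (elems (blocks n ms))
  ; complete = λ { (b ∷ bs) → ∈-cartesianProductWith⁺ _∷_ (Finite.complete F b) (Finite.complete (blocks n ms) bs) }
  ; unique   = Unique.cartesianProductWith⁺ _∷_ ∷-injectiveᵇ (Finite.unique F) (Finite.unique (blocks n ms))
  ; decEq    = λ { (b ∷ bs) (b′ ∷ bs′) → map′ (λ { (refl , refl) → refl }) ∷-injectiveᵇ (Finite.decEq F b b′ ×-dec Finite.decEq (blocks n ms) bs bs′) }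
  }
  where
  F = vec m (words (suc n))

infixl 6 _∙∙_

-- Accumulates on the left, as nested uses of `act` do, whereas `prod` associates to the right.
_∙∙_ : ∀ {m} → Word N → Vec (Word N) m → Word N
π ∙∙ []      = π
π ∙∙ (σ ∷ v) = (π ∙ σ) ∙∙ v

perm-∙∙-prod : ∀ {m} (π : Word N) (v : Vec (Word N) m) (ws : List (Word N)) → (π ∙∙ v) ∙ prod ws ≡ π ∙ prod (toList v ++ ws)
perm-∙∙-prod π []      ws = refl
perm-∙∙-prod π (σ ∷ v) ws = trans (perm-∙∙-prod (π ∙ σ) v ws) (trans (∙-assoc π σ _) (cong (π ∙_) (∙≡· σ (prod (toList v ++ ws)))))

module _ {n : ℕ} where

  MainOK′ : ∀ {d} → Vec (Word (suc n)) d → Vec (CoxType n) d → Set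
  MainOK′ []       []       = ⊤
  MainOK′ (σ ∷ σs) (T ∷ Ts) = (Perm σ × HasTail σ T) × MainOK′ σs Ts

  mainOK? : ∀ {d} (σs : Vec (Word (suc n)) d) (Ts : Vec (CoxType n) d) → Dec (MainOK′ σs Ts)
  mainOK? []       []       = yes tt
  mainOK? (σ ∷ σs) (T ∷ Ts) = (perm? σ ×-dec hasTail? σ T) ×-dec mainOK? σs Ts

  -- `ReflLenSum` asks for a whole vector of lengths. Choosing them one at a time within a bound is
  -- decidable and follows the recursion of `blockOp`.
  BlockOK′ : ∀ {m} → Vec (Word (suc n)) m → ℕ → Set
  BlockOK′ []      s = s ≡ 0
  BlockOK′ (σ ∷ b) s = Perm σ × ∃[ k ] (k < suc s × (cyc σ + k ≡ suc n × BlockOK′ b (s ∸ k)))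

  blockOK? : ∀ {m} (b : Vec (Word (suc n)) m) (s : ℕ) → Dec (BlockOK′ b s)
  blockOK? []      s = s ℕ.≟ 0
  blockOK? (σ ∷ b) s = perm? σ ×-dec anyUpTo? (λ k → (cyc σ + k ℕ.≟ suc n) ×-dec blockOK? b (s ∸ k)) (suc s)

  BlocksOK′ : ∀ {l} {ms : Vec ℕ l} → Blocks n ms → Vec ℕ l → Set
  BlocksOK′ []       []       = ⊤
  BlocksOK′ (b ∷ bs) (s ∷ ss) = BlockOK′ b s × BlocksOK′ bs ss

  blocksOK? : ∀ {l} {ms : Vec ℕ l} (bs : Blocks n ms) (ss : Vec ℕ l) → Dec (BlocksOK′ bs ss)
  blocksOK? []       []       = yes tt
  blocksOK? (b ∷ bs) (s ∷ ss) = blockOK? b s ×-dec blocksOK? bs ss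

  _∙∙∙_ : ∀ {l} {ms : Vec ℕ l} → Word (suc n) → Blocks n ms → Word (suc n)
  π ∙∙∙ []       = π
  π ∙∙∙ (b ∷ bs) = (π ∙∙ b) ∙∙∙ bs

  ∙∙∙-prod : ∀ {l} {ms : Vec ℕ l} (π : Word (suc n)) (bs : Blocks n ms) → π ∙∙∙ bs ≡ π ∙ prod (concatBlocks bs)
  ∙∙∙-prod π []       = trans (sym (∙-identityʳ π)) (cong (π ∙_) ε≡idP)
  ∙∙∙-prod π (b ∷ bs) = trans (∙∙∙-prod (π ∙∙ b) bs) (perm-∙∙-prod π b (concatBlocks bs))

  ∑-first : ∀ {A B : Set} (F : Finite A) (G : Finite B) {P : A → Set} {Q : B → Set} (P? : ∀ a → Dec (P a)) (Q? : ∀ b → Dec (Q b)) (f : A → B → ℕ) →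
            ∑ (elems F) (λ a → ⟦ P? a ⟧ * ∑ (elems G) (λ b → ⟦ Q? b ⟧ * f a b)) ≡
            ∑ (elems F) (λ a → ∑ (elems G) (λ b → ⟦ P? a ×-dec Q? b ⟧ * f a b))
  ∑-first F G P? Q? f = ∑-cong (elems F) (λ a → trans (sym (∑-*ˡ (elems G) ⟦ P? a ⟧ _)) (∑-cong (elems G) (λ b →
    trans (sym (*-assoc ⟦ P? a ⟧ ⟦ Q? b ⟧ _)) (cong (_* f a b) (sym (⟦⟧-× (P? a) (Q? b)))))))

  apply-main : ∀ {d} (Ts : Vec (CoxType n) d) (O : Op (suc n)) (g : Word (suc n) → ℕ) (π : Word (suc n)) →
               apply (mainOp Ts O) g π ≡ ∑ (elems (vec d (words (suc n)))) (λ σs → ⟦ mainOK? σs Ts ⟧ * apply O g (π ∙∙ σs))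
  apply-main [] O g π = sym (trans (+-identityʳ _) (+-identityʳ _))
  apply-main {suc d} (T ∷ Ts) O g π = begin
    ∑ᵖ (λ σ → typeWeight T σ * apply (mainOp Ts O) g (π ∙ σ))
      ≡⟨ ∑ᵖ-def _ ⟩
    ∑ (elems (words (suc n))) (λ σ → ⟦ perm? σ ⟧ * (typeWeight T σ * apply (mainOp Ts O) g (π ∙ σ)))
      ≡⟨ ∑-cong (elems (words (suc n))) (λ σ → trans (sym (*-assoc ⟦ perm? σ ⟧ (typeWeight T σ) _))
           (cong₂ _*_ (sym (⟦⟧-× (perm? σ) (hasTail? σ T))) (apply-main Ts O g (π ∙ σ)))) ⟩
    ∑ (elems (words (suc n))) (λ σ → ⟦ perm? σ ×-dec hasTail? σ T ⟧ * ∑ (elems (vec d (words (suc n)))) (λ σs → ⟦ mainOK? σs Ts ⟧ * apply O g ((π ∙ σ) ∙∙ σs)))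
      ≡⟨ ∑-first (words (suc n)) (vec d (words (suc n))) (λ σ → perm? σ ×-dec hasTail? σ T) (λ σs → mainOK? σs Ts) (λ σ σs → apply O g ((π ∙ σ) ∙∙ σs)) ⟩
    ∑ (elems (words (suc n))) (λ σ → ∑ (elems (vec d (words (suc n)))) (λ σs → ⟦ mainOK? (σ ∷ σs) (T ∷ Ts) ⟧ * apply O g (π ∙∙ (σ ∷ σs))))
      ≡⟨ ∑-vec (words (suc n)) d _ ⟨
    ∑ (elems (vec (suc d) (words (suc n)))) (λ σs → ⟦ mainOK? σs (T ∷ Ts) ⟧ * apply O g (π ∙∙ σs)) ∎
    where open ≡-Reasoning

  -- At most one term is nonzero. This turns the existential over the length of a factor into the
  -- sum in `blockOp`.
  anyUpTo-unique : ∀ {P Q : ℕ → Set} (P? : ∀ k → Dec (P k)) (Q? : ∀ k → Dec (Q k)) (v : ℕ) → (∀ {k k′} → P k → P k′ → k ≡ k′) →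
                   ⟦ anyUpTo? (λ k → P? k ×-dec Q? k) v ⟧ ≡ ∑ (upTo v) (λ k → ⟦ P? k ⟧ * ⟦ Q? k ⟧)
  anyUpTo-unique {P} {Q} P? Q? v unique with anyUpTo? (λ k → P? k ×-dec Q? k) v
  ... | yes (k , k<v , p , q) = sym (trans (∑-cong (upTo v) (λ k′ → trans (sym (⟦⟧-× (P? k′) (Q? k′))) (trans
          (⟦⟧-cong (P? k′ ×-dec Q? k′) (k ℕ.≟ k′) (λ (p′ , _) → unique p p′) (λ { refl → p , q })) (sym (*-identityʳ _)))))
          (∑-δ ℕ._≟_ (Unique.upTo⁺ v) (∈-upTo⁺ k<v) (λ _ → 1)))
  ... | no none = sym (trans (∑-cong-∈ (upTo v) (λ k k∈ → trans (sym (⟦⟧-× (P? k) (Q? k)))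
          (⟦⟧-no (P? k ×-dec Q? k) (λ pq → none (k , ∈-upTo⁻ k∈ , pq))))) (∑-zero (upTo v) {λ _ → 0} (λ _ → refl)))

  apply-block : ∀ m s (O : Op (suc n)) (g : Word (suc n) → ℕ) (π : Word (suc n)) →
                apply (blockOp m s O) g π ≡ ∑ (elems (vec m (words (suc n)))) (λ b → ⟦ blockOK? b s ⟧ * apply O g (π ∙∙ b))
  apply-block zero zero    O g π = sym (trans (+-identityʳ _) (+-identityʳ _))
  apply-block zero (suc s) O g π = refl
  apply-block (suc m) s    O g π = begin
    ∑ (upTo (suc s)) (λ k → ∑ᵖ (λ σ → rankWeight k σ * apply (blockOp m (s ∸ k) O) g (π ∙ σ)))
      ≡⟨ ∑ᵖ-∑ (upTo (suc s)) _ ⟨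
    ∑ᵖ (λ σ → ∑ (upTo (suc s)) (λ k → rankWeight k σ * apply (blockOp m (s ∸ k) O) g (π ∙ σ)))
      ≡⟨ ∑ᵖ-def _ ⟩
    ∑ (elems (words (suc n))) (λ σ → ⟦ perm? σ ⟧ * ∑ (upTo (suc s)) (λ k → rankWeight k σ * apply (blockOp m (s ∸ k) O) g (π ∙ σ)))
      ≡⟨ ∑-cong (elems (words (suc n))) (λ σ → trans (cong (⟦ perm? σ ⟧ *_) (each σ)) (sym (∑-*ˡ (elems V) ⟦ perm? σ ⟧ _))) ⟩
    ∑ (elems (words (suc n))) (λ σ → ∑ (elems V) (λ b → ⟦ perm? σ ⟧ * (⟦ rest? σ b ⟧ * apply O g ((π ∙ σ) ∙∙ b))))
      ≡⟨ ∑-cong (elems (words (suc n))) (λ σ → ∑-cong (elems V) (λ b → trans (sym (*-assoc ⟦ perm? σ ⟧ ⟦ rest? σ b ⟧ _))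
           (cong (_* apply O g ((π ∙ σ) ∙∙ b)) (sym (⟦⟧-× (perm? σ) (rest? σ b)))))) ⟩
    ∑ (elems (words (suc n))) (λ σ → ∑ (elems V) (λ b → ⟦ blockOK? (σ ∷ b) s ⟧ * apply O g (π ∙∙ (σ ∷ b))))
      ≡⟨ ∑-vec (words (suc n)) m _ ⟨
    ∑ (elems (vec (suc m) (words (suc n)))) (λ b → ⟦ blockOK? b s ⟧ * apply O g (π ∙∙ b)) ∎
    where
    open ≡-Reasoning
    V = vec m (words (suc n))
    rest? : ∀ σ b → Dec (∃[ k ] (k < suc s × (cyc σ + k ≡ suc n × BlockOK′ b (s ∸ k))))
    rest? σ b = anyUpTo? (λ k → (cyc σ + k ℕ.≟ suc n) ×-dec blockOK? b (s ∸ k)) (suc s)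
    each : ∀ σ → ∑ (upTo (suc s)) (λ k → rankWeight k σ * apply (blockOp m (s ∸ k) O) g (π ∙ σ)) ≡
                 ∑ (elems V) (λ b → ⟦ rest? σ b ⟧ * apply O g ((π ∙ σ) ∙∙ b))
    each σ = begin
      ∑ (upTo (suc s)) (λ k → rankWeight k σ * apply (blockOp m (s ∸ k) O) g (π ∙ σ))
        ≡⟨ ∑-cong (upTo (suc s)) (λ k → trans (cong (rankWeight k σ *_) (apply-block m (s ∸ k) O g (π ∙ σ))) (sym (∑-*ˡ (elems V) (rankWeight k σ) _))) ⟩
      ∑ (upTo (suc s)) (λ k → ∑ (elems V) (λ b → rankWeight k σ * (⟦ blockOK? b (s ∸ k) ⟧ * apply O g ((π ∙ σ) ∙∙ b))))
        ≡⟨ ∑-swap (upTo (suc s)) (elems V) _ ⟩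
      ∑ (elems V) (λ b → ∑ (upTo (suc s)) (λ k → rankWeight k σ * (⟦ blockOK? b (s ∸ k) ⟧ * apply O g ((π ∙ σ) ∙∙ b))))
        ≡⟨ ∑-cong (elems V) (λ b → trans (∑-cong (upTo (suc s)) (λ k → sym (*-assoc (rankWeight k σ) ⟦ blockOK? b (s ∸ k) ⟧ (apply O g ((π ∙ σ) ∙∙ b)))))
             (trans (∑-*ʳ (upTo (suc s)) (λ k → rankWeight k σ * ⟦ blockOK? b (s ∸ k) ⟧) (apply O g ((π ∙ σ) ∙∙ b))) (cong (_* apply O g ((π ∙ σ) ∙∙ b))
               (sym (anyUpTo-unique (λ k → cyc σ + k ℕ.≟ suc n) (λ k → blockOK? b (s ∸ k)) (suc s) (λ p p′ → +-cancelˡ-≡ (cyc σ) _ _ (trans p (sym p′)))))))) ⟩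
      ∑ (elems V) (λ b → ⟦ rest? σ b ⟧ * apply O g ((π ∙ σ) ∙∙ b)) ∎

  apply-blocks : ∀ {l} (ms ss : Vec ℕ l) (O : Op (suc n)) (g : Word (suc n) → ℕ) (π : Word (suc n)) →
                 apply (blocksOp ms ss O) g π ≡ ∑ (elems (blocks n ms)) (λ bs → ⟦ blocksOK? bs ss ⟧ * apply O g (π ∙∙∙ bs))
  apply-blocks [] [] O g π = sym (trans (+-identityʳ _) (+-identityʳ _))
  apply-blocks (m ∷ ms) (s ∷ ss) O g π = begin
    apply (blockOp m s (blocksOp ms ss O)) g π
      ≡⟨ apply-block m s (blocksOp ms ss O) g π ⟩
    ∑ (elems V) (λ b → ⟦ blockOK? b s ⟧ * apply (blocksOp ms ss O) g (π ∙∙ b))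
      ≡⟨ ∑-cong (elems V) (λ b → cong (⟦ blockOK? b s ⟧ *_) (apply-blocks ms ss O g (π ∙∙ b))) ⟩
    ∑ (elems V) (λ b → ⟦ blockOK? b s ⟧ * ∑ (elems (blocks n ms)) (λ bs → ⟦ blocksOK? bs ss ⟧ * apply O g ((π ∙∙ b) ∙∙∙ bs)))
      ≡⟨ ∑-first V (blocks n ms) (λ b → blockOK? b s) (λ bs → blocksOK? bs ss) (λ b bs → apply O g ((π ∙∙ b) ∙∙∙ bs)) ⟩
    ∑ (elems V) (λ b → ∑ (elems (blocks n ms)) (λ bs → ⟦ blocksOK? (b ∷ bs) (s ∷ ss) ⟧ * apply O g (π ∙∙∙ (b ∷ bs))))
      ≡⟨ ∑-cartesianProductWith _∷_ (elems V) (elems (blocks n ms)) _ ⟨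
    ∑ (elems (blocks n (m ∷ ms))) (λ bs → ⟦ blocksOK? bs (s ∷ ss) ⟧ * apply O g (π ∙∙∙ bs)) ∎
    where
    open ≡-Reasoning
    V = vec m (words (suc n))

  mainOK⇒ : ∀ {d} (σs : Vec (Word (suc n)) d) (Ts : Vec (CoxType n) d) → MainOK σs Ts → MainOK′ σs Ts
  mainOK⇒ []       []       _         = tt
  mainOK⇒ (σ ∷ σs) (T ∷ Ts) (ok , oks) = hasType⇒ {T = T} ok , mainOK⇒ σs Ts oks

  mainOK⇐ : ∀ {d} (σs : Vec (Word (suc n)) d) (Ts : Vec (CoxType n) d) → MainOK′ σs Ts → MainOK σs Ts
  mainOK⇐ []       []       _                  = tt
  mainOK⇐ (σ ∷ σs) (T ∷ Ts) ((pσ , tail) , oks) = hasType⇐ {T = T} pσ tail , mainOK⇐ σs Ts oks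

  blockOK⇒ : ∀ {m} (b : Vec (Word (suc n)) m) {s} → ReflLenSum b s → BlockOK′ b s
  blockOK⇒ []      ([] , [] , refl) = refl
  blockOK⇒ (σ ∷ b) (k ∷ ks , refl-k ∷ refl-ks , refl) with pσ , rank ← reflLen⇒ refl-k =
    pσ , k , s≤s (m≤m+n k (sum ks)) , rank , blockOK⇒ b (ks , refl-ks , sym (m+n∸m≡n k (sum ks)))

  blockOK⇐ : ∀ {m} (b : Vec (Word (suc n)) m) {s} → BlockOK′ b s → ReflLenSum b s
  blockOK⇐ []      refl = [] , [] , refl
  blockOK⇐ (σ ∷ b) (pσ , k , s≤s k≤s , rank , rest) with ks , refl-ks , total ← blockOK⇐ b rest =
    k ∷ ks , reflLen⇐ pσ rank ∷ refl-ks , trans (cong (k +_) total) (m+[n∸m]≡n k≤s)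

  blocksOK⇒ : ∀ {l} {ms : Vec ℕ l} (bs : Blocks n ms) (ss : Vec ℕ l) → BlocksOK bs ss → BlocksOK′ bs ss
  blocksOK⇒ []       []       _          = tt
  blocksOK⇒ (b ∷ bs) (s ∷ ss) (ok , oks) = blockOK⇒ b ok , blocksOK⇒ bs ss oks

  blocksOK⇐ : ∀ {l} {ms : Vec ℕ l} (bs : Blocks n ms) (ss : Vec ℕ l) → BlocksOK′ bs ss → BlocksOK bs ss
  blocksOK⇐ []       []       _          = tt
  blocksOK⇐ (b ∷ bs) (s ∷ ss) (ok , oks) = blockOK⇐ b ok , blocksOK⇐ bs ss oks

  all-main : ∀ {d} (σs : Vec (Word (suc n)) d) (Ts : Vec (CoxType n) d) {ws} → MainOK′ σs Ts → AllPerm ws → AllPerm (toList σs ++ ws)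
  all-main []       []       _               all = all
  all-main (σ ∷ σs) (T ∷ Ts) ((pσ , _) , oks) all = injective pσ ∷ all-main σs Ts oks all

  all-block : ∀ {m} (b : Vec (Word (suc n)) m) {s ws} → BlockOK′ b s → AllPerm ws → AllPerm (toList b ++ ws)
  all-block []      _                       all = all
  all-block (σ ∷ b) (pσ , _ , _ , _ , rest) all = injective pσ ∷ all-block b rest all

  all-blocks : ∀ {l} {ms : Vec ℕ l} (bs : Blocks n ms) (ss : Vec ℕ l) → BlocksOK′ bs ss → AllPerm (concatBlocks bs)
  all-blocks []       []       _          = []
  all-blocks (b ∷ bs) (s ∷ ss) (ok , oks) = all-block b ok (all-blocks bs ss oks)

  module _ {d l : ℕ} (c : Word (suc n)) (Ts : Vec (CoxType n) d) (ms ss : Vec ℕ l) where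

    private
      Tuple : Set
      Tuple = Vec (Word (suc n)) d × Blocks n ms

      product : Tuple → Word (suc n)
      product (σs , bs) = (ε ∙∙ σs) ∙∙∙ bs

      product-prod : ∀ σs bs → product (σs , bs) ≡ prod (toList σs ++ concatBlocks bs)
      product-prod σs bs = trans (∙∙∙-prod (ε ∙∙ σs) bs) (trans (perm-∙∙-prod ε σs (concatBlocks bs)) (∙-identityˡ _))

      Valid : Tuple → Set
      Valid (σs , bs) = MainOK′ σs Ts × (BlocksOK′ bs ss × product (σs , bs) ≡ c)

      is-c? : ∀ ρ → Dec (ρ ≡ c)
      is-c? ρ = Finite.decEq (words (suc n)) ρ c

      valid? : ∀ t → Dec (Valid t)
      valid? (σs , bs) = mainOK? σs Ts ×-dec (blocksOK? bs ss ×-dec is-c? (product (σs , bs)))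

      tuples : Finite Tuple
      tuples = pair (vec d (words (suc n))) (blocks n ms)

    factorisation-count : ℕ
    factorisation-count = L.length (L.filter valid? (elems tuples))

    factorisation-bijection : Fin factorisation-count ↔ Factorisation n d l c Ts ms ss
    factorisation-bijection = enumerate tuples valid? tuple tuple-valid build (λ _ _ → refl) tuple-injective
      where
      open Factorisation
      tuple : Factorisation n d l c Ts ms ss → Tuple
      tuple x = main x , Factorisation.blocks x
      tuple-valid : ∀ x → Valid (tuple x)
      tuple-valid (fact σs bs _ isProd types lengths) =
        -- The proofs stored in a `Factorisation` are irrelevant; a usable one is recovered by
        -- deciding `Valid`.
        recompute (valid? (σs , bs)) (mainOK⇒ σs Ts types , blocksOK⇒ bs ss lengths , trans (product-prod σs bs) isProd)
      build : ∀ t → Valid t → Factorisation n d l c Ts ms ss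
      build (σs , bs) (mok , bok , eq) = fact σs bs (all-main σs Ts mok (all-blocks bs ss bok))
        (trans (sym (product-prod σs bs)) eq) (mainOK⇐ σs Ts mok) (blocksOK⇐ bs ss bok)
      tuple-injective : ∀ {x y} → tuple x ≡ tuple y → x ≡ y
      tuple-injective {fact _ _ _ _ _ _} {fact _ _ _ _ _ _} refl = refl

    factorisation-count-apply : factorisation-count ≡ apply (factorisationOp Ts ms ss) (δ c) ε
    factorisation-count-apply = begin
      factorisation-count
        ≡⟨ length-filter-∑ valid? (elems tuples) ⟩
      ∑ (elems tuples) (λ t → ⟦ valid? t ⟧)
        ≡⟨ ∑-pair (vec d (words (suc n))) (blocks n ms) _ ⟩
      ∑ (elems (vec d (words (suc n)))) (λ σs → ∑ (elems (blocks n ms)) (λ bs → ⟦ valid? (σs , bs) ⟧))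
        ≡⟨ ∑-cong (elems (vec d (words (suc n)))) (λ σs → trans (∑-cong (elems (blocks n ms)) (λ bs →
             trans (⟦⟧-× (mainOK? σs Ts) (blocksOK? bs ss ×-dec is-c? (product (σs , bs))))
                   (cong (⟦ mainOK? σs Ts ⟧ *_) (⟦⟧-× (blocksOK? bs ss) (is-c? (product (σs , bs)))))))
             (∑-*ˡ (elems (blocks n ms)) ⟦ mainOK? σs Ts ⟧ _)) ⟩
      ∑ (elems (vec d (words (suc n)))) (λ σs → ⟦ mainOK? σs Ts ⟧ * ∑ (elems (blocks n ms)) (λ bs → ⟦ blocksOK? bs ss ⟧ * δ c (product (σs , bs))))
        ≡⟨ ∑-cong (elems (vec d (words (suc n)))) (λ σs → cong (⟦ mainOK? σs Ts ⟧ *_) (sym (apply-blocks ms ss idOp (δ c) (ε ∙∙ σs)))) ⟩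
      ∑ (elems (vec d (words (suc n)))) (λ σs → ⟦ mainOK? σs Ts ⟧ * apply (blocksOp ms ss idOp) (δ c) (ε ∙∙ σs))
        ≡⟨ apply-main Ts (blocksOp ms ss idOp) (δ c) ε ⟨
      apply (factorisationOp Ts ms ss) (δ c) ε ∎
      where open ≡-Reasoning

theorem8 : (n d l : ℕ) → 1 ≤ n → 1 ≤ d →
    (c : Word (suc n)) → IsCoxeter c →
    (Ts : Vec (CoxType n) d) → (ms ss : Vec ℕ l) →
    sum (map rank Ts) + sum ss ≡ n →
    ∃[ K ] ((Fin K ↔ Factorisation n d l c Ts ms ss) ×
    (K * prodV (map (λ T → n ∸ rank T + 1) Ts)
    ≡ (n + 1) ^ (d ∸ 1)
    * prodV (map (λ T → multinomial (n ∸ rank T + 1) T) Ts)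
    * prodV (zipWith (λ m s → (m * (n + 1)) C s) ms ss)))
theorem8 n (suc d) l _ _ c coxeter Ts ms ss total with pc , single ← coxeter-cyc coxeter =
  factorisation-count c Ts ms ss , factorisation-bijection c Ts ms ss ,
  trans (cong (_* prodV (map (λ T → n ∸ rank T + 1) Ts)) (factorisation-count-apply c Ts ms ss))
        (factorisation-formula Ts ms ss total pc single)
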